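{- (1) Every t-diagram $X$ has a characteristic tree, unique up to simultaneous reversal of the cyclic orders at all vertices: if $(G,\varphi)$ and $(G',\varphi')$ are characteristic trees of $X$, there is a graph isomorphism $\psi:G\to G'$ with $\psi\circ\varphi=\varphi'$ which either preserves the cyclic order at every degree-3 vertex or reverses it at every degree-3 vertex. (2) For every $d\ge 0$ and every 3-tree $G$ with $2d+4$ vertices there exists a t-diagram for which $G$ is a characteristic tree (for a suitable bijection), and this t-diagram is unique up to equivalence by diagonals.
   Context: A t-diagram is a set $X$ of $2d+4$ black and white points in the plane ($d\ge 0$) such that: the points are in general position; exactly $d+3$ are black and in convex position; no white point lies outside the convex hull of the black points; every triangle with black vertices contains exactly one white point. The boundary of the convex hull of the black points gives an unoriented cyclic order on them. A 3-tree is a finite tree all of whose vertices have degree 1 or 3, with a cyclic order on the three edges at each degree-3 vertex; it induces a cyclic order on the leaves (walk around the tree, at each degree-3 vertex leaving along the edge following the arrival edge in its cyclic order). A characteristic tree of a t-diagram $X$ is a 3-tree $G$ with a bijection $\varphi$ from $X$ to the vertices of $G$ such that: (i) white points go to degree-3 vertices, black points to leaves; (ii) the unoriented cyclic order of leaves agrees via $\varphi$ with the unoriented cyclic order of black points; (iii) a white point $B$ lies inside the triangle with black vertices $A_i,A_j,A_k$ iff there are three paths from $\varphi(B)$ to $\varphi(A_i),\varphi(A_j),\varphi(A_k)$ pairwise sharing only $\varphi(B)$. Two t-diagrams $X,Y$ are equivalent by diagonals if there is a bijection $\varphi:X\to Y$ preserving colors and the unoriented cyclic order of black points, such that a white point $B$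 lies in the convex hull of a set of cyclically consecutive black points $\{A_i\}$ of $X$ iff $\varphi(B)$ lies in the convex hull of $\{\varphi(A_i)\}$ in $Y$. -}

module Defs where

open import Data.Nat as ℕ using (ℕ; zero; suc)
open import Data.Fin using (Fin; zero; suc)
open import Data.List using (List; []; _∷_; length; map; reverse; _++_)
open import Data.List.Membership.Propositional using (_∈_; _∉_)
open import Data.List.Relation.Unary.Unique.Propositional using (Unique)
open import Data.Sum using (_⊎_; inj₁; inj₂)
open import Data.Product using (Σ; ∃; ∃₂; _×_; _,_; proj₁; proj₂; ∃-syntax)
open import Relation.Binary.PropositionalEquality using (_≡_; _≢_; refl)
open import Relation.Nullary using (¬_; yes; no)
open import Relation.Binary.Structures using (IsStrictTotalOrder)
open import Function.Bundles using (_⤖_; _⇔_; Bijection)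
import Data.Fin.Properties as FinP
import Algebra.Structures as AS

record OrderedField : Set₁ where
  infixl 6 _+_
  infixl 7 _*_
  infix 4 _<_
  field
    Carrier : Set
    _+_ _*_ : Carrier → Carrier → Carrier
    -_      : Carrier → Carrier
    0# 1#   : Carrier
    _<_     : Carrier → Carrier → Set
    isCommutativeRing : AS.IsCommutativeRing {A = Carrier} _≡_ _+_ _*_ -_ 0# 1#
    0≢1     : 0# ≢ 1#
    inverse : ∀ x → x ≢ 0# → ∃ λ y → x * y ≡ 1#
    isStrictTotalOrder : IsStrictTotalOrder _≡_ _<_
    +-mono-< : ∀ {x y} z → x < y → x + z < y + z
    *-pos    : ∀ {x y} → 0# < x → 0# < y → 0# < x * y

-- 3-trees: vertices Fin m, nbrs v lists the neighbours of v in their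
-- cyclic order (the list is read up to rotation).

record Graph (m : ℕ) : Set where
  field
    nbrs : Fin m → List (Fin m)
open Graph public

module _ {m : ℕ} (G : Graph m) where

  Adj : Fin m → Fin m → Set
  Adj u v = u ∈ nbrs G v

  IsLeaf : Fin m → Set
  IsLeaf v = length (nbrs G v) ≡ 1

  IsDeg3 : Fin m → Set
  IsDeg3 v = length (nbrs G v) ≡ 3

  data Walk : Fin m → Fin m → List (Fin m) → Set where
    here : ∀ v → Walk v v (v ∷ [])
    step : ∀ {u w v vs} → Adj u w → Walk w v vs → Walk u v (u ∷ vs)

  Path : Fin m → Fin m → List (Fin m) → Set
  Path u v vs = Walk u v vs × Unique vs

  Connected : Set
  Connected = ∀ u v → ∃ λ vs → Path u v vs

  HasCycle : Set
  HasCycle = ∃₂ λ u v → ∃ λ vs → Path u v vs × 3 ℕ.≤ length vs × Adj v u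

  record IsThreeTree : Set where
    field
      degree    : ∀ v → IsLeaf v ⊎ IsDeg3 v
      noRepeat  : ∀ v → Unique (nbrs G v)
      noLoop    : ∀ v → v ∉ nbrs G v
      symmetric : ∀ u v → Adj u v → Adj v u
      connected : Connected
      acyclic   : ¬ HasCycle

  cycNext : List (Fin m) → Fin m → Fin m
  cycNext [] u = u
  cycNext (x ∷ xs) u = go (x ∷ xs)
    where
    go : List (Fin m) → Fin m
    go [] = u
    go (y ∷ ys) with y FinP.≟ u
    ... | yes _ = first ys
      where
      first : List (Fin m) → Fin m
      first [] = x
      first (z ∷ _) = z
    ... | no _ = go ys

  -- walking around the tree, having traversed the edge u → v
  -- (fuel bounds the number of steps; 2m suffices for a tree)
  walkToLeaf : ℕ → Fin m → Fin m → Fin m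
  walkToLeaf zero u v = v
  walkToLeaf (suc n) u v with length (nbrs G v) ℕ.≟ 1
  ... | yes _ = v
  ... | no _ = walkToLeaf n v (cycNext (nbrs G v) u)

  nextLeaf : Fin m → Fin m
  nextLeaf l with nbrs G l
  ... | [] = l
  ... | x ∷ _ = walkToLeaf (2 ℕ.* m) l x

  ThreePaths : Fin m → Fin m → Fin m → Fin m → Set
  ThreePaths b a1 a2 a3 =
    ∃ λ p1 → ∃ λ p2 → ∃ λ p3 →
      Path b a1 p1 × Path b a2 p2 × Path b a3 p3 ×
      (∀ x → x ∈ p1 → x ∈ p2 → x ≡ b) ×
      (∀ x → x ∈ p1 → x ∈ p3 → x ≡ b) ×
      (∀ x → x ∈ p2 → x ∈ p3 → x ≡ b)

RotEq : ∀ {A : Set} → List A → List A → Set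
RotEq xs ys = ∃₂ λ as bs → xs ≡ as ++ bs × ys ≡ bs ++ as

module Geometry (F : OrderedField) where
  open OrderedField F

  Point : Set
  Point = Carrier × Carrier

  _-_ : Carrier → Carrier → Carrier
  x - y = x + (- y)

  _≤_ : Carrier → Carrier → Set
  x ≤ y = x < y ⊎ x ≡ y

  orient : Point → Point → Point → Carrier
  orient (px , py) (qx , qy) (rx , ry) =
    ((qx - px) * (ry - py)) - ((qy - py) * (rx - px))

  sumF : ∀ {k} → (Fin k → Carrier) → Carrier
  sumF {zero} f = 0#
  sumF {suc k} f = f zero + sumF (λ i → f (suc i))

  InConv : ∀ {k} → (Fin k → Set) → (Fin k → Point) → Point → Set
  InConv S f p = ∃ λ (w : Fin _ → Carrier) →
    (∀ i → ¬ S i → w i ≡ 0#) ×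
    (∀ i → 0# ≤ w i) ×
    sumF w ≡ 1# ×
    sumF (λ i → w i * proj₁ (f i)) ≡ proj₁ p ×
    sumF (λ i → w i * proj₂ (f i)) ≡ proj₂ p

  record Diagram (d : ℕ) : Set where
    field
      black : Fin (3 ℕ.+ d) → Point
      white : Fin (1 ℕ.+ d) → Point

    Pt : Set
    Pt = Fin (3 ℕ.+ d) ⊎ Fin (1 ℕ.+ d)

    pt : Pt → Point
    pt (inj₁ i) = black i
    pt (inj₂ w) = white w

  open Diagram public

  Tri : ∀ {k} → Fin k → Fin k → Fin k → Fin k → Set
  Tri i j k l = l ≡ i ⊎ l ≡ j ⊎ l ≡ k

  module _ {d : ℕ} (D : Diagram d) where

    GeneralPosition : Set
    GeneralPosition = ∀ x y z → x ≢ y → y ≢ z → x ≢ z →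
      orient (pt D x) (pt D y) (pt D z) ≢ 0#

    BlackConvexPosition : Set
    BlackConvexPosition = ∀ i → ¬ InConv (λ j → j ≢ i) (black D) (black D i)

    WhiteInsideHull : Set
    WhiteInsideHull = ∀ w → InConv (λ _ → ⊤') (black D) (white D w)
      where open import Data.Unit renaming (⊤ to ⊤')

    InTriangle : Fin (1 ℕ.+ d) → Fin (3 ℕ.+ d) → Fin (3 ℕ.+ d) → Fin (3 ℕ.+ d) → Set
    InTriangle w i j k = InConv (Tri i j k) (black D) (white D w)

    TrianglesOneWhite : Set
    TrianglesOneWhite = ∀ i j k → i ≢ j → j ≢ k → i ≢ k →
      ∃ λ w → InTriangle w i j k × (∀ w' → InTriangle w' i j k → w' ≡ w)

    record IsTDiagram : Set where
      field
        generalPosition : GeneralPosition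
        convexPosition  : BlackConvexPosition
        whiteInside     : WhiteInsideHull
        oneWhite        : TrianglesOneWhite

    -- black i and black j are consecutive on the boundary of the hull:
    -- all other black points lie strictly on one side of the line through them
    HullEdge : Fin (3 ℕ.+ d) → Fin (3 ℕ.+ d) → Set
    HullEdge i j = i ≢ j × (∀ k l → k ≢ i → k ≢ j → l ≢ i → l ≢ j →
      0# < orient (black D i) (black D j) (black D k)
         * orient (black D i) (black D j) (black D l))

    data Chain : List (Fin (3 ℕ.+ d)) → Set where
      nil  : Chain []
      one  : ∀ i → Chain (i ∷ [])
      cons : ∀ {i j is} → HullEdge i j → Chain (j ∷ is) → Chain (i ∷ j ∷ is)

    Arc : List (Fin (3 ℕ.+ d)) → Set
    Arc is = Unique is × Chain is

    record IsCharTree {m : ℕ} (G : Graph m) (φ : Pt D ⤖ Fin m) : Set where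
      φ' : Pt D → Fin m
      φ' = Bijection.to φ
      field
        isThreeTree : IsThreeTree G
        whiteDeg3   : ∀ w → IsDeg3 G (φ' (inj₂ w))
        blackLeaf   : ∀ i → IsLeaf G (φ' (inj₁ i))
        cyclicOrder : ∀ i j → nextLeaf G (φ' (inj₁ i)) ≡ φ' (inj₁ j) → HullEdge i j
        triangles   : ∀ w i j k → i ≢ j → j ≢ k → i ≢ k →
          InTriangle w i j k ⇔
          ThreePaths G (φ' (inj₂ w)) (φ' (inj₁ i)) (φ' (inj₁ j)) (φ' (inj₁ k))

  EquivDiag : ∀ {d} → Diagram d → Diagram d → Set
  EquivDiag {d} D E =
    ∃ λ (σ : Fin (3 ℕ.+ d) ⤖ Fin (3 ℕ.+ d)) →
    ∃ λ (τ : Fin (1 ℕ.+ d) ⤖ Fin (1 ℕ.+ d)) →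
      (∀ i j → HullEdge D i j ⇔
               HullEdge E (Bijection.to σ i) (Bijection.to σ j)) ×
      (∀ is → Arc D is → ∀ w →
         InConv (λ j → j ∈ is) (black D) (white D w) ⇔
         InConv (λ j → j ∈ map (Bijection.to σ) is) (black E)
                (white E (Bijection.to τ w)))

  IsoCompatible : ∀ {d m m'} (D : Diagram d) (G : Graph m) (G' : Graph m')
    → (Pt D ⤖ Fin m) → (Pt D ⤖ Fin m') → Set
  IsoCompatible D G G' φ φ' =
    ∃ λ (ψ : Fin _ ⤖ Fin _) →
      let ψf = Bijection.to ψ in
      (∀ u v → Adj G u v ⇔ Adj G' (ψf u) (ψf v)) ×
      (∀ x → ψf (Bijection.to φ x) ≡ Bijection.to φ' x) ×
      ((∀ v → IsDeg3 G v → RotEq (nbrs G' (ψf v)) (map ψf (nbrs G v)))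
       ⊎ (∀ v → IsDeg3 G v → RotEq (nbrs G' (ψf v)) (reverse (map ψf (nbrs G v)))))

{-# OPTIONS --safe #-}
module Submission where

-- A 3-tree rooted at a leaf o is a plane binary tree t, in which the three paths condition says that a vertex is
-- the median of three leaves. A t-diagram carries the same data. Seen from black point 0 the other black points
-- are linearly ordered; the white point of the triangle formed by 0 and the two ends of an interval of them cuts
-- the interval in two, and iterating this yields t.
--
-- The link between t and the plane is that every inner vertex v lies strictly inside each black triangle with one
-- vertex in each of the three branches at v. It lies in no other black triangle, because a triangle that misses a
-- branch at v lies on one side of a line through v and a black point.
--
-- Uniqueness of the tree: the hull edge relation has degree two, which fixes the cyclic sequence of leaves up to
-- reversal, and a plane binary tree is determined by its leaf sequence and the lowest common ancestors of leaves.
-- Uniqueness of the diagram: a white point in the hull of some black points lies in a triangle of them.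
-- Existence of the diagram: induct by replacing a leaf a with a cherry (a, b), where b is placed infinitesimally
-- close to a towards the next leaf, and the new white point infinitesimally close to a towards b.

open import Defs
open import Algebra.Bundles using (CommutativeRing)
import Algebra.Properties.Ring as RingProperties
import Algebra.Solver.Ring as RingSolver
open import Algebra.Solver.Ring.AlmostCommutativeRing
  using (AlmostCommutativeRing; fromCommutativeRing; _-Raw-AlmostCommutative⟶_)
open import Data.Empty using (⊥; ⊥-elim)
open import Data.Fin as Fin using (Fin; zero; suc)
import Data.Fin.Properties as FinP
open import Data.Integer as ℤ using (ℤ; +_; -[1+_])
import Data.Integer.Properties as ℤP
open import Data.List using (List; []; _∷_; _++_; length; map; reverse; lookup; allFin)
import Data.List.Membership.DecPropositional as DecMembership
open import Data.List.Membership.Propositional using (_∈_; _∉_)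
open import Data.List.Membership.Propositional.Properties
  using (∈-++⁺ˡ; ∈-++⁺ʳ; ∈-++⁻; ∈-map⁺; ∈-map⁻; ∈-lookup; ∈-allFin)
import Data.List.Properties as ListP
open import Data.List.Relation.Unary.All as All using (All; []; _∷_)
import Data.List.Relation.Unary.All.Properties as AllP
open import Data.List.Relation.Unary.AllPairs using (AllPairs; []; _∷_)
open import Data.List.Relation.Unary.Any as Any using (here; there)
open import Data.List.Relation.Unary.Any.Properties using (lookup-index)
open import Data.List.Relation.Unary.Linked using (Linked; []; [-]; _∷_)
open import Data.List.Relation.Unary.Unique.Propositional using (Unique)
import Data.List.Relation.Unary.Unique.Propositional.Properties as UniqueP
open import Data.Maybe using (Maybe; just; nothing)
open import Data.Nat as ℕ using (ℕ; zero; suc; s≤s; z≤n)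
import Data.Nat.Properties as ℕP
open import Data.Nat.Solver using (module +-*-Solver)
open import Data.Product as Product using (∃; ∃₂; _×_; _,_; proj₁; proj₂)
open import Data.Sum as Sum using (_⊎_; inj₁; inj₂)
open import Data.Unit using (tt)
open import Function using (_∘_)
open import Function.Bundles using (_⤖_; _⇔_; mk⇔; mk⤖; Bijection; Equivalence)
open import Relation.Binary.Definitions using (DecidableEquality; tri<; tri≈; tri>)
open import Relation.Binary.PropositionalEquality
open import Relation.Binary.Structures using (IsStrictTotalOrder)
open import Relation.Nullary using (¬_; yes; no; contradiction)

-- The ordered field is arbitrary: it need not be Archimedean and may lack roots, so no regular
-- polygon is at hand, and every small perturbation comes with an explicit bound. Such bounds exist
-- because an orientation is affine in each of its points. Both existence statements aim at one
-- oriented condition, `Good`. Since `Split` lists three leaves in cyclic order, `Good` is a list of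
-- strict signs, and from it follow convex position, the hull edges, the unique white point of each
-- triangle and the characteristic tree; general position is kept track of separately. Orientation
-- is lost in the other direction. A characteristic tree only has to respect unoriented hull edges,
-- and triangles are unordered; this is the source of the global reversal, which is decided once, at
-- a hull neighbour of black point 0. In the inductive construction the leaf `a` does not move, and
-- the two new points are so close to it that they inherit its side of every line through two other
-- points. Only triples containing at least two of these three points need an argument, and for them
-- the direction of approach matters.

module _ {A : Set} where

  lookup-injective : ∀ {xs : List A} → Unique xs → ∀ {i j} → lookup xs i ≡ lookup xs j → i ≡ j
  lookup-injective {x ∷ xs} (x≢ ∷ u) {zero}  {zero}  e = refl
  lookup-injective {x ∷ xs} (x≢ ∷ u) {zero}  {suc j} e = contradiction e (All.lookup x≢ (∈-lookup j))
  lookup-injective {x ∷ xs} (x≢ ∷ u) {suc i} {zero}  e = contradiction (sym e) (All.lookup x≢ (∈-lookup i))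
  lookup-injective {x ∷ xs} (x≢ ∷ u) {suc i} {suc j} e = cong suc (lookup-injective u e)

  unique-⊆-length : ∀ {xs ys : List A} → Unique xs → (∀ {x} → x ∈ xs → x ∈ ys) → length xs ℕ.≤ length ys
  unique-⊆-length {xs} {ys} u xs⊆ys = FinP.injective⇒≤ {f = λ i → Any.index (xs⊆ys (∈-lookup i))} λ {i} {j} e →
    lookup-injective u (trans (lookup-index (xs⊆ys (∈-lookup i))) (trans (cong (lookup ys) e)
      (sym (lookup-index (xs⊆ys (∈-lookup j))))))

  ∉⇒≢ : ∀ {x y : A} {ys} → x ∉ ys → y ∈ ys → x ≢ y
  ∉⇒≢ x∉ y∈ refl = x∉ y∈

  ∉⇒All≢ : ∀ {x : A} {ys} → x ∉ ys → All (x ≢_) ys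
  ∉⇒All≢ x∉ = All.tabulate (∉⇒≢ x∉)

  All≢⇒∉ : ∀ {x : A} {ys} → All (x ≢_) ys → x ∉ ys
  All≢⇒∉ a m = All.lookup a m refl

  -- In a symmetric relation of degree at most two, a sequence without repetitions has no choice
  -- left after its first edge: of the neighbours of `b`, one is `a` and at most one other remains.
  linked-unique : ∀ {R : A → A → Set} → (∀ {x y} → R x y → R y x) →
    (∀ {b a c d} → a ≢ c → a ≢ d → R b a → R b c → R b d → c ≡ d) →
    ∀ {a b xs ys} → Linked R (a ∷ b ∷ xs) → Linked R (a ∷ b ∷ ys) → Unique (a ∷ b ∷ xs) → Unique (a ∷ b ∷ ys) →
    length xs ≡ length ys → xs ≡ ys
  linked-unique rs deg {xs = []}     {[]}     _ _ _ _ _ = refl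
  linked-unique rs deg {xs = c ∷ xs} {d ∷ ys} (ab ∷ p@(bc ∷ _)) (_ ∷ q@(bd ∷ _)) (a∉ ∷ u) (a∉' ∷ u') e
    with deg (All.lookup a∉ (there (here refl))) (All.lookup a∉' (there (here refl))) (rs ab) bc bd
  ... | refl = cong (c ∷_) (linked-unique rs deg p q u u' (ℕP.suc-injective e))

  Disjoint : List A → List A → Set
  Disjoint xs ys = ∀ {x} → x ∈ xs → x ∈ ys → ⊥

  -- Membership alone tells on which side of the cut an element lies, since `cs` and `ds` are
  -- disjoint. If one cut came before the other, the element between them would belong to both.
  ++-split-≡ : ∀ {as bs cs ds : List A} → as ++ bs ≡ cs ++ ds → Disjoint cs ds →
    (∀ {x} → x ∈ as → x ∈ cs) → (∀ {x} → x ∈ bs → x ∈ ds) → as ≡ cs × bs ≡ ds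
  ++-split-≡ {as} {bs} {cs} {ds} e dis f g = go as cs e (λ m → m) (λ m → m)
    where
    go : ∀ as' cs' → as' ++ bs ≡ cs' ++ ds → (∀ {x} → x ∈ as' → x ∈ as) → (∀ {x} → x ∈ cs' → x ∈ cs) →
      as' ≡ cs' × bs ≡ ds
    go [] []          e p q = refl , e
    go [] (c ∷ cs')   e p q = ⊥-elim (dis (q (here refl)) (g (subst (c ∈_) (sym e) (here refl))))
    go (a ∷ as') []   e p q = ⊥-elim (dis (f (p (here refl))) (subst (a ∈_) e (here refl)))
    go (a ∷ as') (c ∷ cs') e p q with go as' cs' (ListP.∷-injectiveʳ e) (p ∘ there) (q ∘ there)
    ... | e₁ , e₂ = cong₂ _∷_ (ListP.∷-injectiveˡ e) e₁ , e₂

-- Plane binary trees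

-- A 3-tree rooted at one of its leaves; the cyclic order at an inner vertex is parent, left child, right child.
data Tree (V : Set) : Set where
  leaf : V → Tree V
  node : V → Tree V → Tree V → Tree V

module _ {V : Set} where

  root first last : Tree V → V
  root (leaf v)      = v
  root (node v _ _)  = v
  first (leaf v)     = v
  first (node _ l _) = first l
  last (leaf v)      = v
  last (node _ _ r)  = last r

  leaves nodes verts : Tree V → List V
  leaves (leaf v)     = v ∷ []
  leaves (node _ l r) = leaves l ++ leaves r
  nodes (leaf v)      = []
  nodes (node v l r)  = v ∷ nodes l ++ nodes r
  verts (leaf v)      = v ∷ []
  verts (node v l r)  = v ∷ verts l ++ verts r

  data Simple : Tree V → Set where
    leaf : ∀ {v} → Simple (leaf v)
    node : ∀ {v l r} → v ∉ verts l → v ∉ verts r → Disjoint (verts l) (verts r) →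
      Simple l → Simple r → Simple (node v l r)

  infix 4 _⊑_
  data _⊑_ : Tree V → Tree V → Set where
    top : ∀ {t} → t ⊑ t
    inl : ∀ {s v l r} → s ⊑ l → s ⊑ node v l r
    inr : ∀ {s v l r} → s ⊑ r → s ⊑ node v l r

  ⊑-trans : ∀ {s t u} → s ⊑ t → t ⊑ u → s ⊑ u
  ⊑-trans p top     = p
  ⊑-trans p (inl q) = inl (⊑-trans p q)
  ⊑-trans p (inr q) = inr (⊑-trans p q)

  leaves⊆verts : ∀ t {x} → x ∈ leaves t → x ∈ verts t
  leaves⊆verts (leaf v)     m = m
  leaves⊆verts (node v l r) m with ∈-++⁻ (leaves l) m
  ... | inj₁ m = there (∈-++⁺ˡ (leaves⊆verts l m))
  ... | inj₂ m = there (∈-++⁺ʳ (verts l) (leaves⊆verts r m))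

  nodes⊆verts : ∀ t {x} → x ∈ nodes t → x ∈ verts t
  nodes⊆verts (node v l r) (here e)  = here e
  nodes⊆verts (node v l r) (there m) with ∈-++⁻ (nodes l) m
  ... | inj₁ m = there (∈-++⁺ˡ (nodes⊆verts l m))
  ... | inj₂ m = there (∈-++⁺ʳ (verts l) (nodes⊆verts r m))

  verts⊆leaves∪nodes : ∀ t {x} → x ∈ verts t → x ∈ leaves t ⊎ x ∈ nodes t
  verts⊆leaves∪nodes (leaf v)     m = inj₁ m
  verts⊆leaves∪nodes (node v l r) (here e) = inj₂ (here e)
  verts⊆leaves∪nodes (node v l r) (there m) with ∈-++⁻ (verts l) m
  ... | inj₁ m = Sum.map ∈-++⁺ˡ (there ∘ ∈-++⁺ˡ) (verts⊆leaves∪nodes l m)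
  ... | inj₂ m = Sum.map (∈-++⁺ʳ (leaves l)) (there ∘ ∈-++⁺ʳ (nodes l)) (verts⊆leaves∪nodes r m)

  root∈verts : ∀ t → root t ∈ verts t
  root∈verts (leaf v)     = here refl
  root∈verts (node v l r) = here refl

  first∈leaves : ∀ t → first t ∈ leaves t
  first∈leaves (leaf v)     = here refl
  first∈leaves (node v l r) = ∈-++⁺ˡ (first∈leaves l)

  last∈leaves : ∀ t → last t ∈ leaves t
  last∈leaves (leaf v)     = here refl
  last∈leaves (node v l r) = ∈-++⁺ʳ (leaves l) (last∈leaves r)

  ⊑-verts : ∀ {s t} → s ⊑ t → ∀ {x} → x ∈ verts s → x ∈ verts t
  ⊑-verts top     m = m
  ⊑-verts (inl p) m = there (∈-++⁺ˡ (⊑-verts p m))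
  ⊑-verts (inr p) m = there (∈-++⁺ʳ _ (⊑-verts p m))

  ⊑-leaves : ∀ {s t} → s ⊑ t → ∀ {x} → x ∈ leaves s → x ∈ leaves t
  ⊑-leaves top     m = m
  ⊑-leaves (inl p) m = ∈-++⁺ˡ (⊑-leaves p m)
  ⊑-leaves {t = node _ l _} (inr p) m = ∈-++⁺ʳ (leaves l) (⊑-leaves p m)

  ⊑-simple : ∀ {s t} → s ⊑ t → Simple t → Simple s
  ⊑-simple top     σ = σ
  ⊑-simple (inl p) (node _ _ _ σ _) = ⊑-simple p σ
  ⊑-simple (inr p) (node _ _ _ _ σ) = ⊑-simple p σ

  leaves-disjoint : ∀ {v l r} → Simple (node v l r) → Disjoint (leaves l) (leaves r)
  leaves-disjoint {l = l} {r} (node _ _ dis _ _) m n = dis (leaves⊆verts l m) (leaves⊆verts r n)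

  verts-node⁻ : ∀ {v l r x} → x ∈ verts (node v l r) → x ≡ v ⊎ x ∈ verts l ⊎ x ∈ verts r
  verts-node⁻ (here e) = inj₁ e
  verts-node⁻ {l = l} (there m) = inj₂ (∈-++⁻ (verts l) m)

  vertsˡ : ∀ {v l r x} → x ∈ verts l → x ∈ verts (node v l r)
  vertsˡ m = there (∈-++⁺ˡ m)

  vertsʳ : ∀ {v} l {r x} → x ∈ verts r → x ∈ verts (node v l r)
  vertsʳ l m = there (∈-++⁺ʳ (verts l) m)

  leaf-in-subtree : ∀ {s t x} → Simple t → s ⊑ t → x ∈ leaves t → x ∈ verts s → x ∈ leaves s
  leaf-in-subtree σ top m n = m
  leaf-in-subtree {t = node v l r} (node _ _ dis σl _) (inl p) m n with ∈-++⁻ (leaves l) m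
  ... | inj₁ m = leaf-in-subtree σl p m n
  ... | inj₂ m = ⊥-elim (dis (⊑-verts p n) (leaves⊆verts r m))
  leaf-in-subtree {t = node v l r} (node _ _ dis _ σr) (inr p) m n with ∈-++⁻ (leaves l) m
  ... | inj₁ m = ⊥-elim (dis (leaves⊆verts l m) (⊑-verts p n))
  ... | inj₂ m = leaf-in-subtree σr p m n

  node-not-leaf : ∀ {t v l r} → Simple t → node v l r ⊑ t → v ∉ leaves t
  node-not-leaf {v = v} {l} {r} σ p m with ⊑-simple p σ
  ... | node v∉l v∉r _ _ _ with ∈-++⁻ (leaves l) (leaf-in-subtree σ p m (here refl))
  ...   | inj₁ n = v∉l (leaves⊆verts l n)
  ...   | inj₂ n = v∉r (leaves⊆verts r n)

  ∈nodes⇒⊑ : ∀ t {x} → x ∈ nodes t → ∃₂ λ l r → node x l r ⊑ t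
  ∈nodes⇒⊑ (node v l r) (here refl) = l , r , top
  ∈nodes⇒⊑ (node v l r) (there m) with ∈-++⁻ (nodes l) m
  ... | inj₁ m = Product.map₂ (Product.map₂ inl) (∈nodes⇒⊑ l m)
  ... | inj₂ m = Product.map₂ (Product.map₂ inr) (∈nodes⇒⊑ r m)

  ⊑⇒∈nodes : ∀ {t x l r} → node x l r ⊑ t → x ∈ nodes t
  ⊑⇒∈nodes top     = here refl
  ⊑⇒∈nodes (inl p) = there (∈-++⁺ˡ (⊑⇒∈nodes p))
  ⊑⇒∈nodes {node _ l _} (inr p) = there (∈-++⁺ʳ (nodes l) (⊑⇒∈nodes p))

  ∈leaves⇒⊑ : ∀ t {x} → x ∈ leaves t → leaf x ⊑ t
  ∈leaves⇒⊑ (leaf v) (here refl) = top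
  ∈leaves⇒⊑ (node v l r) m with ∈-++⁻ (leaves l) m
  ... | inj₁ m = inl (∈leaves⇒⊑ l m)
  ... | inj₂ m = inr (∈leaves⇒⊑ r m)

  unique-leaves : ∀ {t} → Simple t → Unique (leaves t)
  unique-leaves leaf = [] ∷ []
  unique-leaves σ@(node _ _ _ σl σr) =
    UniqueP.++⁺ (unique-leaves σl) (unique-leaves σr) λ { (m , n) → leaves-disjoint σ m n }

  unique-verts : ∀ {t} → Simple t → Unique (verts t)
  unique-verts leaf = [] ∷ []
  unique-verts {node v l r} (node v∉l v∉r dis σl σr) =
    ∉⇒All≢ (Sum.[ v∉l , v∉r ] ∘ ∈-++⁻ (verts l)) ∷
    UniqueP.++⁺ (unique-verts σl) (unique-verts σr) λ { (m , n) → dis m n }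

  unique-nodes : ∀ {t} → Simple t → Unique (nodes t)
  unique-nodes leaf = []
  unique-nodes {node v l r} (node v∉l v∉r dis σl σr) =
    ∉⇒All≢ (Sum.[ v∉l ∘ nodes⊆verts l , v∉r ∘ nodes⊆verts r ] ∘ ∈-++⁻ (nodes l)) ∷
    UniqueP.++⁺ (unique-nodes σl) (unique-nodes σr) λ { (m , n) → dis (nodes⊆verts l m) (nodes⊆verts r n) }

  length-leaves : ∀ t → length (leaves t) ≡ suc (length (nodes t))
  length-leaves (leaf v)     = refl
  length-leaves (node v l r) = begin
    length (leaves l ++ leaves r)                  ≡⟨ ListP.length-++ (leaves l) ⟩
    length (leaves l) ℕ.+ length (leaves r)        ≡⟨ cong₂ ℕ._+_ (length-leaves l) (length-leaves r) ⟩
    suc (length (nodes l) ℕ.+ suc (length (nodes r))) ≡⟨ cong suc (ℕP.+-suc _ _) ⟩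
    suc (suc (length (nodes l) ℕ.+ length (nodes r))) ≡⟨ cong (λ k → suc (suc k)) (sym (ListP.length-++ (nodes l))) ⟩
    suc (suc (length (nodes l ++ nodes r)))        ∎
    where open ≡-Reasoning

  length-verts : ∀ t → length (verts t) ≡ length (leaves t) ℕ.+ length (nodes t)
  length-verts (leaf v)     = refl
  length-verts (node v l r) = begin
    suc (length (verts l ++ verts r)) ≡⟨ cong suc (trans (ListP.length-++ (verts l)) (cong₂ ℕ._+_ (length-verts l) (length-verts r))) ⟩
    suc ((a ℕ.+ b) ℕ.+ (c ℕ.+ d))     ≡⟨ cong suc (solve 4 (λ a b c d → (a :+ b) :+ (c :+ d) := (a :+ c) :+ (b :+ d)) refl a b c d) ⟩
    suc ((a ℕ.+ c) ℕ.+ (b ℕ.+ d))     ≡⟨ sym (ℕP.+-suc _ _) ⟩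
    (a ℕ.+ c) ℕ.+ suc (b ℕ.+ d)       ≡⟨ sym (cong₂ (λ x y → x ℕ.+ suc y) (ListP.length-++ (leaves l)) (ListP.length-++ (nodes l))) ⟩
    length (leaves l ++ leaves r) ℕ.+ suc (length (nodes l ++ nodes r)) ∎
    where
    open ≡-Reasoning
    open +-*-Solver
    a = length (leaves l)
    b = length (nodes l)
    c = length (leaves r)
    d = length (nodes r)

  Lca : Tree V → V → V → V → Set
  Lca t w x y = ∃₂ λ l r → node w l r ⊑ t × x ∈ leaves l × y ∈ leaves r

  lca-⊑ : ∀ {s t w x y} → s ⊑ t → Lca s w x y → Lca t w x y
  lca-⊑ p (l , r , q , m) = l , r , ⊑-trans q p , m

  lca-∈ : ∀ {t w x y} → Lca t w x y → x ∈ leaves t × y ∈ leaves t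
  lca-∈ (l , r , p , m , n) = ⊑-leaves p (∈-++⁺ˡ m) , ⊑-leaves p (∈-++⁺ʳ (leaves l) n)

  lca-node⁻ : ∀ {v l r w x y} → Lca (node v l r) w x y →
    (w ≡ v × x ∈ leaves l × y ∈ leaves r) ⊎ Lca l w x y ⊎ Lca r w x y
  lca-node⁻ (_ , _ , top   , m , n) = inj₁ (refl , m , n)
  lca-node⁻ (_ , _ , inl p , m , n) = inj₂ (inj₁ (_ , _ , p , m , n))
  lca-node⁻ (_ , _ , inr p , m , n) = inj₂ (inj₂ (_ , _ , p , m , n))

  lca-exists : ∀ t {x y} → x ≢ y → x ∈ leaves t → y ∈ leaves t → ∃ λ w → Lca t w x y ⊎ Lca t w y x
  lca-exists (leaf v) x≢y (here refl) (here refl) = contradiction refl x≢y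
  lca-exists (node v l r) x≢y m n with ∈-++⁻ (leaves l) m | ∈-++⁻ (leaves l) n
  ... | inj₁ m | inj₁ n = Product.map₂ (Sum.map (lca-⊑ (inl top)) (lca-⊑ (inl top))) (lca-exists l x≢y m n)
  ... | inj₁ m | inj₂ n = v , inj₁ (l , r , top , m , n)
  ... | inj₂ m | inj₁ n = v , inj₂ (l , r , top , n , m)
  ... | inj₂ m | inj₂ n = Product.map₂ (Sum.map (lca-⊑ (inr top)) (lca-⊑ (inr top))) (lca-exists r x≢y m n)

  lca-first : ∀ t {x} → x ∈ leaves t → x ≡ first t ⊎ ∃ λ w → Lca t w (first t) x
  lca-first (leaf v) (here e) = inj₁ e
  lca-first (node v l r) m with ∈-++⁻ (leaves l) m
  ... | inj₁ m = Sum.map₂ (Product.map₂ (lca-⊑ (inl top))) (lca-first l m)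
  ... | inj₂ m = inj₂ (v , l , r , top , first∈leaves l , m)

  lca-last : ∀ t {x} → x ∈ leaves t → x ≡ last t ⊎ ∃ λ w → Lca t w x (last t)
  lca-last (leaf v) (here e) = inj₁ e
  lca-last (node v l r) m with ∈-++⁻ (leaves l) m
  ... | inj₁ m = inj₂ (v , l , r , top , m , last∈leaves r)
  ... | inj₂ m = Sum.map₂ (Product.map₂ (lca-⊑ (inr top))) (lca-last r m)

  first≢last : ∀ {v l r} → Simple (node v l r) → first l ≢ last r
  first≢last {l = l} {r} σ e = leaves-disjoint σ (first∈leaves l) (subst (_∈ leaves r) (sym e) (last∈leaves r))

  headOr endOr : V → List V → V
  headOr d []       = d
  headOr d (x ∷ _)  = x
  endOr d []        = d
  endOr d (x ∷ xs)  = endOr x xs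

  headOr-++ : ∀ {d x} xs {ys d'} → x ∈ xs → headOr d xs ≡ headOr d' (xs ++ ys)
  headOr-++ (x ∷ xs) _ = refl

  endOr-++ : ∀ {d} xs {ys y} → y ∈ ys → ∀ {d'} → endOr d (xs ++ ys) ≡ endOr d' ys
  endOr-++ []       {y ∷ ys} m = refl
  endOr-++ (x ∷ xs) m          = endOr-++ xs m

  first-head : ∀ t {d} → first t ≡ headOr d (leaves t)
  first-head (leaf v)         = refl
  first-head (node v l r) {d} = trans (first-head l {d}) (headOr-++ (leaves l) (first∈leaves l))

  last-end : ∀ t {d} → last t ≡ endOr d (leaves t)
  last-end (leaf v)         = refl
  last-end (node v l r) {d} = trans (last-end r {d}) (sym (endOr-++ (leaves l) (last∈leaves r)))

  Before : List V → V → V → Set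
  Before xs x y = ∃₂ λ as bs → xs ≡ as ++ bs × x ∈ as × y ∈ bs

  lca⇒before : ∀ {t w x y} → Lca t w x y → Before (leaves t) x y
  lca⇒before (l , r , top , m , n) = leaves l , leaves r , refl , m , n
  lca⇒before {t = node _ l₁ r₁} (l , r , inl p , m , n) with lca⇒before (l , r , p , m , n)
  ... | as , bs , e , m , n =
    as , bs ++ leaves r₁ , trans (cong (_++ leaves r₁) e) (ListP.++-assoc as bs _) , m , ∈-++⁺ˡ n
  lca⇒before {t = node _ l₁ r₁} (l , r , inr p , m , n) with lca⇒before (l , r , p , m , n)
  ... | as , bs , e , m , n =
    leaves l₁ ++ as , bs , trans (cong (leaves l₁ ++_) e) (sym (ListP.++-assoc (leaves l₁) as bs)) , ∈-++⁺ʳ (leaves l₁) m , n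

  before-asym : ∀ xs {x y} → Unique xs → Before xs x y → Before xs y x → ⊥
  before-asym [] u ([] , _ , _ , () , _) _
  before-asym (z ∷ xs) (z∉ ∷ u) (a ∷ as , bs , refl , m , n) (c ∷ cs , ds , e , m' , n')
    with ListP.∷-injectiveˡ e | ListP.∷-injectiveʳ e | m | m'
  ... | refl | e' | here refl | _         = All≢⇒∉ z∉ (subst (z ∈_) (sym e') (∈-++⁺ʳ cs n'))
  ... | refl | e' | there m   | here refl = All≢⇒∉ z∉ (∈-++⁺ʳ as n)
  ... | refl | e' | there m   | there m'  = before-asym xs u (as , bs , refl , m , n) (cs , ds , e' , m' , n')

  lca-asym : ∀ {t w w' x y} → Simple t → Lca t w x y → Lca t w' y x → ⊥
  lca-asym σ p q = before-asym _ (unique-leaves σ) (lca⇒before p) (lca⇒before q)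

  -- The root is recovered as the lowest common ancestor of the first and the last leaf, and the
  -- pairs with this ancestor show where the leaf sequence splits into left and right. The
  -- hypothesis allows either order of `x` and `y` because it will come from unordered triangles;
  -- the common leaf sequence restores the order.
  tree-≡ : ∀ {t t'} → Simple t → Simple t' → leaves t ≡ leaves t' →
    (∀ {w x y} → Lca t w x y → Lca t' w x y ⊎ Lca t' w y x) → t ≡ t'
  tree-≡ {leaf v} {leaf v'} σ σ' e h = cong leaf (ListP.∷-injectiveˡ e)
  tree-≡ {leaf v} {t'@(node _ _ _)} σ σ' e h with trans (cong length e) (length-leaves t')
  ... | ()
  tree-≡ {node v l r} {leaf v'} σ σ' e h with trans (sym (cong length e)) (length-leaves (node v l r))
  ... | ()
  tree-≡ {t@(node v l r)} {t'@(node v' l' r')} σ@(node v∉l v∉r _ σl σr) σ'@(node v'∉l' v'∉r' _ σl' σr') e h =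
    combine v≡v' (tree-≡ σl σl' (proj₁ split) hl) (tree-≡ σr σr' (proj₂ split) hr)
    where
    dis' = leaves-disjoint σ'

    combine : ∀ {v v' : V} {l l' r r'} → v ≡ v' → l ≡ l' → r ≡ r' → node v l r ≡ node v' l' r'
    combine refl refl refl = refl

    order : ∀ {w x y} → Lca t w x y → Lca t' w x y
    order p with h p
    ... | inj₁ q = q
    ... | inj₂ q = ⊥-elim (before-asym (leaves t) (unique-leaves σ) (lca⇒before p)
                     (subst (λ xs → Before xs _ _) (sym e) (lca⇒before q)))

    firsts : first l ≡ first l'
    firsts = trans (first-head t) (trans (cong (headOr (first l)) e) (sym (first-head t')))

    lasts : last r ≡ last r'
    lasts = trans (last-end t) (trans (cong (endOr (last r)) e) (sym (last-end t')))

    v≡v' : v ≡ v'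
    v≡v' with lca-node⁻ (order (l , r , top , first∈leaves l , last∈leaves r))
    ... | inj₁ (v≡v' , _) = v≡v'
    ... | inj₂ (inj₁ p) = ⊥-elim (dis' (proj₂ (lca-∈ p)) (subst (_∈ leaves r') (sym lasts) (last∈leaves r')))
    ... | inj₂ (inj₂ p) = ⊥-elim (dis' (first∈leaves l') (subst (_∈ leaves r') firsts (proj₁ (lca-∈ p))))

    rooted : ∀ {x y} → x ∈ leaves l → y ∈ leaves r → x ∈ leaves l' × y ∈ leaves r'
    rooted m n with lca-node⁻ (order (l , r , top , m , n))
    ... | inj₁ (_ , c) = c
    ... | inj₂ (inj₁ (_ , _ , p , _)) = ⊥-elim (v'∉l' (subst (_∈ verts l') v≡v' (⊑-verts p (here refl))))
    ... | inj₂ (inj₂ (_ , _ , p , _)) = ⊥-elim (v'∉r' (subst (_∈ verts r') v≡v' (⊑-verts p (here refl))))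

    split : leaves l ≡ leaves l' × leaves r ≡ leaves r'
    split = ++-split-≡ e dis'
      (λ m → proj₁ (rooted m (first∈leaves r))) (λ n → proj₂ (rooted (first∈leaves l) n))

    hl : ∀ {w x y} → Lca l w x y → Lca l' w x y ⊎ Lca l' w y x
    hl p with lca-node⁻ (order (lca-⊑ (inl top) p))
    ... | inj₁ (_ , _ , n) = ⊥-elim (dis' (subst (_ ∈_) (proj₁ split) (proj₂ (lca-∈ p))) n)
    ... | inj₂ (inj₁ q) = inj₁ q
    ... | inj₂ (inj₂ q) = ⊥-elim (dis' (subst (_ ∈_) (proj₁ split) (proj₂ (lca-∈ p))) (proj₂ (lca-∈ q)))

    hr : ∀ {w x y} → Lca r w x y → Lca r' w x y ⊎ Lca r' w y x
    hr p with lca-node⁻ (order (lca-⊑ (inr top) p))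
    ... | inj₁ (_ , m , _) = ⊥-elim (dis' m (subst (_ ∈_) (proj₂ split) (proj₁ (lca-∈ p))))
    ... | inj₂ (inj₁ q) = ⊥-elim (dis' (proj₁ (lca-∈ q)) (subst (_ ∈_) (proj₂ split) (proj₁ (lca-∈ p))))
    ... | inj₂ (inj₂ q) = inj₁ q

  leaves≡first∷ : ∀ t → ∃ λ xs → leaves t ≡ first t ∷ xs
  leaves≡first∷ (leaf v) = [] , refl
  leaves≡first∷ (node v l r) with leaves≡first∷ l
  ... | xs , e = xs ++ leaves r , cong (_++ leaves r) e

  module _ {R : V → V → Set} where

    linked-leaves-++ : ∀ t {y ys} → (∀ {v l r} → node v l r ⊑ t → R (last l) (first r)) →
      R (last t) y → Linked R (y ∷ ys) → Linked R (leaves t ++ y ∷ ys)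
    linked-leaves-++ (leaf v) h r q = r ∷ q
    linked-leaves-++ (node v l r) {y} {ys} h R-last q with leaves≡first∷ r | linked-leaves-++ r (h ∘ inr) R-last q
    ... | xs , e | q' rewrite ListP.++-assoc (leaves l) (leaves r) (y ∷ ys) | e =
      linked-leaves-++ l (h ∘ inl) (h top) q'

    linked-leaves : ∀ t → (∀ {v l r} → node v l r ⊑ t → R (last l) (first r)) → Linked R (leaves t)
    linked-leaves (leaf v) h = [-]
    linked-leaves (node v l r) h with leaves≡first∷ r | linked-leaves r (h ∘ inr)
    ... | xs , e | q rewrite e = linked-leaves-++ l (h ∘ inl) (h top) q

  mirror : Tree V → Tree V
  mirror (leaf v)     = leaf v
  mirror (node v l r) = node v (mirror r) (mirror l)

  root-mirror : ∀ t → root (mirror t) ≡ root t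
  root-mirror (leaf v)     = refl
  root-mirror (node v l r) = refl

  first-mirror : ∀ t → first (mirror t) ≡ last t
  first-mirror (leaf v)     = refl
  first-mirror (node v l r) = first-mirror r

  last-mirror : ∀ t → last (mirror t) ≡ first t
  last-mirror (leaf v)     = refl
  last-mirror (node v l r) = last-mirror l

  verts-mirror⁻ : ∀ t {x} → x ∈ verts (mirror t) → x ∈ verts t
  verts-mirror⁻ (leaf v)     m = m
  verts-mirror⁻ (node v l r) m with verts-node⁻ {l = mirror r} m
  ... | inj₁ e        = here e
  ... | inj₂ (inj₁ m) = vertsʳ l (verts-mirror⁻ r m)
  ... | inj₂ (inj₂ m) = vertsˡ (verts-mirror⁻ l m)

  leaves-mirror⁻ : ∀ t {x} → x ∈ leaves (mirror t) → x ∈ leaves t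
  leaves-mirror⁻ (leaf v)     m = m
  leaves-mirror⁻ (node v l r) m with ∈-++⁻ (leaves (mirror r)) m
  ... | inj₁ m = ∈-++⁺ʳ (leaves l) (leaves-mirror⁻ r m)
  ... | inj₂ m = ∈-++⁺ˡ (leaves-mirror⁻ l m)

  mirror-mirror : ∀ t → mirror (mirror t) ≡ t
  mirror-mirror (leaf v)     = refl
  mirror-mirror (node v l r) = cong₂ (node v) (mirror-mirror l) (mirror-mirror r)

  leaves-mirror⁺ : ∀ t {x} → x ∈ leaves t → x ∈ leaves (mirror t)
  leaves-mirror⁺ t m = leaves-mirror⁻ (mirror t) (subst (λ s → _ ∈ leaves s) (sym (mirror-mirror t)) m)

  simple-mirror : ∀ {t} → Simple t → Simple (mirror t)
  simple-mirror leaf = leaf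
  simple-mirror {node v l r} (node v∉l v∉r dis σl σr) =
    node (v∉r ∘ verts-mirror⁻ r) (v∉l ∘ verts-mirror⁻ l) (λ m n → dis (verts-mirror⁻ l n) (verts-mirror⁻ r m))
      (simple-mirror σr) (simple-mirror σl)

  ⊑-mirror : ∀ {s t} → s ⊑ t → mirror s ⊑ mirror t
  ⊑-mirror top     = top
  ⊑-mirror (inl p) = inr (⊑-mirror p)
  ⊑-mirror (inr p) = inl (⊑-mirror p)

  lca-mirror : ∀ {t w x y} → Lca t w x y → Lca (mirror t) w y x
  lca-mirror (l , r , p , m , n) = mirror r , mirror l , ⊑-mirror p , leaves-mirror⁺ r n , leaves-mirror⁺ l m

  -- v is the median of x, y, z, which occur in this cyclic order around the tree rooted at o.
  record Split (o : V) (t : Tree V) (v x y z : V) : Set where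
    constructor split
    field
      {l r} : Tree V
      sub   : node v l r ⊑ t
      x∈    : x ∈ leaves l
      y∈    : y ∈ leaves r
      z∈    : z ∈ o ∷ leaves t
      z∉    : z ∉ verts (node v l r)

  -- The vertex sought is the one where the descents from the root to `s` and to `z` part.
  separating-node : ∀ {s t z} → s ⊑ t → z ∈ leaves t → z ∉ verts s → ∃ λ v → ∃₂ λ l r → node v l r ⊑ t ×
    (((∀ {x} → x ∈ leaves s → x ∈ leaves l) × z ∈ leaves r) ⊎ ((∀ {x} → x ∈ leaves s → x ∈ leaves r) × z ∈ leaves l))
  separating-node {s} top m z∉ = contradiction (leaves⊆verts s m) z∉
  separating-node {t = node v l r} (inl p) m z∉ with ∈-++⁻ (leaves l) m
  ... | inj₂ n = v , l , r , top , inj₁ (⊑-leaves p , n)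
  ... | inj₁ n with separating-node p n z∉
  ...   | _ , _ , _ , q , e = _ , _ , _ , inl q , e
  separating-node {t = node v l r} (inr p) m z∉ with ∈-++⁻ (leaves l) m
  ... | inj₁ n = v , l , r , top , inj₂ (⊑-leaves p , n)
  ... | inj₂ n with separating-node p n z∉
  ...   | _ , _ , _ , q , e = _ , _ , _ , inr q , e

  -- The cyclic order of the sequence o ∷ leaves t.
  data Succ (o : V) (t : Tree V) : V → V → Set where
    start : Succ o t o (first t)
    close : Succ o t (last t) o
    inner : ∀ {v l r} → node v l r ⊑ t → Succ o t (last l) (first r)

  -- Below the lowest ancestor that has `x` in its left subtree, the descent to `x` only turns
  -- right. If there is no such ancestor, `x` is the last leaf of all.
  last∨inner : ∀ t {x} → x ∈ leaves t → x ≡ last t ⊎ ∃ λ v → ∃₂ λ l r → node v l r ⊑ t × x ≡ last l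
  last∨inner (leaf v) (here e) = inj₁ e
  last∨inner (node v l r) m with ∈-++⁻ (leaves l) m
  ... | inj₂ m = Sum.map₂ (λ { (_ , _ , _ , p , e) → _ , _ , _ , inr p , e }) (last∨inner r m)
  ... | inj₁ m with last∨inner l m
  ...   | inj₁ e                   = inj₂ (_ , _ , _ , top , e)
  ...   | inj₂ (_ , _ , _ , p , e) = inj₂ (_ , _ , _ , inl p , e)

  first∨inner : ∀ t {x} → x ∈ leaves t → x ≡ first t ⊎ ∃ λ v → ∃₂ λ l r → node v l r ⊑ t × x ≡ first r
  first∨inner (leaf v) (here e) = inj₁ e
  first∨inner (node v l r) m with ∈-++⁻ (leaves l) m
  ... | inj₁ m = Sum.map₂ (λ { (_ , _ , _ , p , e) → _ , _ , _ , inl p , e }) (first∨inner l m)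
  ... | inj₂ m with first∨inner r m
  ...   | inj₁ e                   = inj₂ (_ , _ , _ , top , e)
  ...   | inj₂ (_ , _ , _ , p , e) = inj₂ (_ , _ , _ , inr p , e)

  succ-exists : ∀ {o t x} → x ∈ o ∷ leaves t → ∃ (Succ o t x)
  succ-exists (here refl) = _ , start
  succ-exists {t = t} (there m) with last∨inner t m
  ... | inj₁ refl                   = _ , close
  ... | inj₂ (_ , _ , _ , p , refl) = _ , inner p

  pred-exists : ∀ {o t x} → x ∈ o ∷ leaves t → ∃ λ p → Succ o t p x
  pred-exists (here refl) = _ , close
  pred-exists {t = t} (there m) with first∨inner t m
  ... | inj₁ refl                   = _ , start
  ... | inj₂ (_ , _ , _ , p , refl) = _ , inner p

  succ-∈ : ∀ {o t x y} → Succ o t x y → x ∈ o ∷ leaves t × y ∈ o ∷ leaves t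
  succ-∈ {t = t} start = here refl , there (first∈leaves t)
  succ-∈ {t = t} close = there (last∈leaves t) , here refl
  succ-∈ (inner {l = l} {r} p) =
    there (⊑-leaves p (∈-++⁺ˡ (last∈leaves l))) , there (⊑-leaves p (∈-++⁺ʳ (leaves l) (first∈leaves r)))

  inner-∈ : ∀ {t v l r} → node v l r ⊑ t → last l ∈ leaves t × first r ∈ leaves t
  inner-∈ {l = l} {r} p = ⊑-leaves p (∈-++⁺ˡ (last∈leaves l)) , ⊑-leaves p (∈-++⁺ʳ (leaves l) (first∈leaves r))

  -- An inner vertex guarantees at least two leaves besides `o`, hence a cycle of length at least
  -- three. Two inner steps in opposite directions would place each leaf before the other.
  succ-no-2cycle : ∀ {o} t {n} → n ∈ nodes t → o ∉ verts t → Simple t → ∀ {x y} → Succ o t x y → ¬ Succ o t y x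
  succ-no-2cycle {o} t@(node v l r) _ o∉verts σ = λ p q → go p q refl refl
    where
    o∉ : o ∉ leaves t
    o∉ = o∉verts ∘ leaves⊆verts t
    fl : ∀ {a} → first t ≡ a → last t ≡ a → ⊥
    fl e e' = first≢last σ (trans e (sym e'))
    -- The endpoints are matched by equations, because indices such as `last l` and `first r` cannot
    -- be unified when both steps are analysed.
    go : ∀ {x y y' x'} → Succ o t x y → Succ o t y' x' → y ≡ y' → x ≡ x' → ⊥
    go start start e _ = o∉ (subst (_∈ leaves t) e (first∈leaves t))
    go start close e _ = fl e refl
    go start (inner q) _ e = o∉ (subst (_∈ leaves t) (sym e) (proj₂ (inner-∈ q)))
    go close start _ e = fl (sym e) refl
    go close close e _ = o∉ (subst (_∈ leaves t) (sym e) (last∈leaves t))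
    go close (inner q) e _ = o∉ (subst (_∈ leaves t) (sym e) (proj₁ (inner-∈ q)))
    go (inner p) start e _ = o∉ (subst (_∈ leaves t) e (proj₂ (inner-∈ p)))
    go (inner p) close _ e = o∉ (subst (_∈ leaves t) e (proj₁ (inner-∈ p)))
    go (inner {l = l₁} {r₁} p) (inner {l = l₂} {r₂} q) e e' =
      lca-asym σ (l₁ , r₁ , p , last∈leaves l₁ , first∈leaves r₁)
        (subst₂ (Lca t _) (sym e) (sym e') (l₂ , r₂ , q , last∈leaves l₂ , first∈leaves r₂))

  succ-irrefl : ∀ {o} t {n} → n ∈ nodes t → o ∉ verts t → Simple t → ∀ {x y} → Succ o t x y → x ≢ y
  succ-irrefl t n o∉ σ s refl = succ-no-2cycle t n o∉ σ s s

  module _ {o : V} {t : Tree V} (o∉ : o ∉ verts t) (σ : Simple t) (Q : V → V → V → Set)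
    (swap : ∀ {x y z} → Q x y z → Q y x z) (cyc : ∀ {x y z} → Q x y z → Q y z x)
    (median : ∀ {v x y z} → Split o t v x y z → Q x y z) where

    private
      two : ∀ {s x y z} → s ⊑ t → x ≢ y → x ∈ leaves s → y ∈ leaves s → z ∈ o ∷ leaves t → z ∉ verts s → Q x y z
      two {s} p x≢y x∈ y∈ z∈ z∉ with lca-exists s x≢y x∈ y∈
      ... | _ , inj₁ (_ , _ , q , m , n) = median (split (⊑-trans q p) m n z∈ (z∉ ∘ ⊑-verts q))
      ... | _ , inj₂ (_ , _ , q , m , n) = swap (median (split (⊑-trans q p) m n z∈ (z∉ ∘ ⊑-verts q)))

      three : ∀ s {x y z} → s ⊑ t → x ≢ y → y ≢ z → x ≢ z → x ∈ leaves s → y ∈ leaves s → z ∈ leaves s → Q x y z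
      three (leaf v) p x≢y _ _ (here refl) (here refl) _ = contradiction refl x≢y
      three s@(node v l r) p x≢y y≢z x≢z x∈ y∈ z∈ with ⊑-simple p σ
      ... | node _ _ dis _ _ = cases (∈-++⁻ (leaves l) x∈) (∈-++⁻ (leaves l) y∈) (∈-++⁻ (leaves l) z∈)
        where
        l⊑ = ⊑-trans (inl top) p
        r⊑ = ⊑-trans (inr top) p
        ∉l : ∀ {a} → a ∈ leaves r → a ∉ verts l
        ∉l m n = dis n (leaves⊆verts r m)
        ∉r : ∀ {a} → a ∈ leaves l → a ∉ verts r
        ∉r m n = dis (leaves⊆verts l m) n
        L : ∀ {a} → a ∈ leaves l → a ∈ o ∷ leaves t
        L m = there (⊑-leaves l⊑ m)
        R : ∀ {a} → a ∈ leaves r → a ∈ o ∷ leaves t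
        R m = there (⊑-leaves r⊑ m)
        cases : _ → _ → _ → Q _ _ _
        cases (inj₁ m) (inj₁ n) (inj₁ k) = three l l⊑ x≢y y≢z x≢z m n k
        cases (inj₁ m) (inj₁ n) (inj₂ k) = two l⊑ x≢y m n (R k) (∉l k)
        cases (inj₁ m) (inj₂ n) (inj₁ k) = swap (cyc (cyc (two l⊑ x≢z m k (R n) (∉l n))))
        cases (inj₁ m) (inj₂ n) (inj₂ k) = cyc (cyc (two r⊑ y≢z n k (L m) (∉r m)))
        cases (inj₂ m) (inj₁ n) (inj₁ k) = cyc (cyc (two l⊑ y≢z n k (R m) (∉l m)))
        cases (inj₂ m) (inj₁ n) (inj₂ k) = swap (cyc (cyc (two r⊑ x≢z m k (L n) (∉r n))))
        cases (inj₂ m) (inj₂ n) (inj₁ k) = two r⊑ x≢y m n (L k) (∉r k)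
        cases (inj₂ m) (inj₂ n) (inj₂ k) = three r r⊑ x≢y y≢z x≢z m n k

    -- Any three distinct leaves form a `Split` after a permutation, and `swap` and `cyc` generate
    -- all permutations. If the three do not lie in one proper subtree, some two of them share a
    -- branch, and their lowest common ancestor is the median; this is `two`, while `three` descends
    -- until it applies.
    median-ind : ∀ {x y z} → x ∈ o ∷ leaves t → y ∈ o ∷ leaves t → z ∈ o ∷ leaves t →
      x ≢ y → y ≢ z → x ≢ z → Q x y z
    median-ind (here refl) (here refl) _           x≢y _   _   = contradiction refl x≢y
    median-ind (here refl) (there m)   (here refl) _   _   x≢z = contradiction refl x≢z
    median-ind (here refl) (there m)   (there n)   _   y≢z _   = cyc (cyc (two top y≢z m n (here refl) o∉))
    median-ind (there m)   (here refl) (here refl) _   y≢z _   = contradiction refl y≢z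
    median-ind (there m)   (here refl) (there n)   _   _   x≢z = swap (cyc (cyc (two top x≢z m n (here refl) o∉)))
    median-ind (there m)   (there n)   (here refl) x≢y _   _   = two top x≢y m n (here refl) o∉
    median-ind (there m)   (there n)   (there k)   x≢y y≢z x≢z = three t top x≢y y≢z x≢z m n k

-- Relabelling the vertices of a tree

module _ {V W : Set} (f : V → W) where

  mapTree : Tree V → Tree W
  mapTree (leaf v)     = leaf (f v)
  mapTree (node v l r) = node (f v) (mapTree l) (mapTree r)

  root-map : ∀ t → root (mapTree t) ≡ f (root t)
  root-map (leaf v)     = refl
  root-map (node v l r) = refl

  first-map : ∀ t → first (mapTree t) ≡ f (first t)
  first-map (leaf v)     = refl
  first-map (node v l r) = first-map l

  last-map : ∀ t → last (mapTree t) ≡ f (last t)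
  last-map (leaf v)     = refl
  last-map (node v l r) = last-map r

  leaves-map : ∀ t → leaves (mapTree t) ≡ map f (leaves t)
  leaves-map (leaf v)     = refl
  leaves-map (node v l r) = trans (cong₂ _++_ (leaves-map l) (leaves-map r)) (sym (ListP.map-++ f (leaves l) (leaves r)))

  verts-map : ∀ t → verts (mapTree t) ≡ map f (verts t)
  verts-map (leaf v)     = refl
  verts-map (node v l r) =
    cong (f v ∷_) (trans (cong₂ _++_ (verts-map l) (verts-map r)) (sym (ListP.map-++ f (verts l) (verts r))))

  ∈-verts-map⁻ : ∀ t {x} → x ∈ verts (mapTree t) → ∃ λ y → y ∈ verts t × x ≡ f y
  ∈-verts-map⁻ t m = ∈-map⁻ f (subst (_ ∈_) (verts-map t) m)

  ∈-leaves-map⁻ : ∀ t {x} → x ∈ leaves (mapTree t) → ∃ λ y → y ∈ leaves t × x ≡ f y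
  ∈-leaves-map⁻ t m = ∈-map⁻ f (subst (_ ∈_) (leaves-map t) m)

  ⊑-map⁻ : ∀ t {w l r} → node w l r ⊑ mapTree t →
    ∃ λ w₀ → ∃₂ λ l₀ r₀ → node w₀ l₀ r₀ ⊑ t × w ≡ f w₀ × l ≡ mapTree l₀ × r ≡ mapTree r₀
  ⊑-map⁻ (node v l r) top = _ , _ , _ , top , refl , refl , refl
  ⊑-map⁻ (node v l r) (inl p) with ⊑-map⁻ l p
  ... | _ , _ , _ , q , e = _ , _ , _ , inl q , e
  ⊑-map⁻ (node v l r) (inr p) with ⊑-map⁻ r p
  ... | _ , _ , _ , q , e = _ , _ , _ , inr q , e

  lca-map⁻ : ∀ t {w x y} → Lca (mapTree t) w x y →
    ∃ λ w₀ → ∃₂ λ x₀ y₀ → Lca t w₀ x₀ y₀ × w ≡ f w₀ × x ≡ f x₀ × y ≡ f y₀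
  lca-map⁻ t (_ , _ , p , m , n) with ⊑-map⁻ t p
  ... | _ , l₀ , r₀ , q , e , refl , refl with ∈-leaves-map⁻ l₀ m | ∈-leaves-map⁻ r₀ n
  ...   | _ , m' , e₁ | _ , n' , e₂ = _ , _ , _ , (l₀ , r₀ , q , m' , n') , e , e₁ , e₂

  simple-map : (∀ {x y} → f x ≡ f y → x ≡ y) → ∀ {t} → Simple t → Simple (mapTree t)
  simple-map inj leaf = leaf
  simple-map inj {node v l r} (node v∉l v∉r dis σl σr) =
    node (fresh l v∉l) (fresh r v∉r) dis' (simple-map inj σl) (simple-map inj σr)
    where
    fresh : ∀ s → v ∉ verts s → f v ∉ verts (mapTree s)
    fresh s v∉ m with ∈-verts-map⁻ s m
    ... | y , n , e = v∉ (subst (_∈ verts s) (sym (inj e)) n)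
    dis' : Disjoint (verts (mapTree l)) (verts (mapTree r))
    dis' m n with ∈-verts-map⁻ l m | ∈-verts-map⁻ r n
    ... | x , m' , e | y , n' , e' = dis m' (subst (_∈ verts r) (sym (inj (trans (sym e) e'))) n')

-- Growing a leaf into a cherry

module _ {V : Set} (_≟_ : DecidableEquality V) (a b w : V) where

  data Grow : Tree V → Tree V → Set where
    cherry : Grow (leaf a) (node w (leaf a) (leaf b))
    inl    : ∀ {v l' l r} → Grow l' l → Grow (node v l' r) (node v l r)
    inr    : ∀ {v l r' r} → Grow r' r → Grow (node v l r') (node v l r)

  -- The retraction of the grown leaf set onto the old one. At every old vertex `b` lies in the same
  -- branch as `a`, so medians other than `w` are unaffected by it.
  collapse : V → V
  collapse x with x ≟ b
  ... | yes _ = a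
  ... | no _  = x

  collapse-b : collapse b ≡ a
  collapse-b with b ≟ b
  ... | yes _ = refl
  ... | no ¬e = contradiction refl ¬e

  collapse-≢ : ∀ {x} → x ≢ b → collapse x ≡ x
  collapse-≢ {x} x≢b with x ≟ b
  ... | yes e = contradiction e x≢b
  ... | no _  = refl

  grow-verts : ∀ {t' t} → Grow t' t → ∀ {x} → x ∈ verts t' → x ∈ verts t
  grow-verts cherry (here e) = there (here e)
  grow-verts (inl g) (here e) = here e
  grow-verts (inl {l' = l'} g) (there m) with ∈-++⁻ (verts l') m
  ... | inj₁ m = vertsˡ (grow-verts g m)
  ... | inj₂ m = vertsʳ _ m
  grow-verts (inr g) (here e) = here e
  grow-verts (inr {l = l} g) (there m) with ∈-++⁻ (verts l) m
  ... | inj₁ m = vertsˡ m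
  ... | inj₂ m = vertsʳ l (grow-verts g m)

  grow-b : ∀ {t' t} → Grow t' t → b ∈ leaves t
  grow-b cherry                = there (here refl)
  grow-b (inl g)               = ∈-++⁺ˡ (grow-b g)
  grow-b (inr {l = l} g)       = ∈-++⁺ʳ (leaves l) (grow-b g)

  grow-w : ∀ {t' t} → Grow t' t → w ∈ nodes t
  grow-w cherry          = here refl
  grow-w (inl g)         = there (∈-++⁺ˡ (grow-w g))
  grow-w (inr {l = l} g) = there (∈-++⁺ʳ (nodes l) (grow-w g))

  grow-a : ∀ {t' t} → Grow t' t → a ∈ leaves t'
  grow-a cherry          = here refl
  grow-a (inl g)         = ∈-++⁺ˡ (grow-a g)
  grow-a (inr {l = l} g) = ∈-++⁺ʳ (leaves l) (grow-a g)

  grow-verts⁻ : ∀ {t' t} → Grow t' t → ∀ {x} → x ∈ verts t → x ≡ b ⊎ x ≡ w ⊎ x ∈ verts t'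
  grow-verts⁻ cherry (here e)                 = inj₂ (inj₁ e)
  grow-verts⁻ cherry (there (here e))         = inj₂ (inj₂ (here e))
  grow-verts⁻ cherry (there (there (here e))) = inj₁ e
  grow-verts⁻ (inl {l = l} g) m with verts-node⁻ {l = l} m
  ... | inj₁ e        = inj₂ (inj₂ (here e))
  ... | inj₂ (inj₁ m) = Sum.map₂ (Sum.map₂ vertsˡ) (grow-verts⁻ g m)
  ... | inj₂ (inj₂ m) = inj₂ (inj₂ (vertsʳ _ m))
  grow-verts⁻ (inr {l = l} g) m with verts-node⁻ {l = l} m
  ... | inj₁ e        = inj₂ (inj₂ (here e))
  ... | inj₂ (inj₁ m) = inj₂ (inj₂ (vertsˡ m))
  ... | inj₂ (inj₂ m) = Sum.map₂ (Sum.map₂ (vertsʳ l)) (grow-verts⁻ g m)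

  grow-b∉ : ∀ {t' t} → Simple t → Grow t' t → b ∉ verts t'
  grow-b∉ (node _ _ dis _ _) cherry (here e) = dis (here e) (here refl)
  grow-b∉ (node v∉l _ dis σl _) (inl {l' = l'} {l} g) m with verts-node⁻ {l = l'} m
  ... | inj₁ refl     = v∉l (leaves⊆verts l (grow-b g))
  ... | inj₂ (inj₁ n) = grow-b∉ σl g n
  ... | inj₂ (inj₂ n) = dis (leaves⊆verts l (grow-b g)) n
  grow-b∉ (node _ v∉r dis _ σr) (inr {l = l} {r = r} g) m with verts-node⁻ {l = l} m
  ... | inj₁ refl     = v∉r (leaves⊆verts r (grow-b g))
  ... | inj₂ (inj₁ n) = dis n (leaves⊆verts r (grow-b g))
  ... | inj₂ (inj₂ n) = grow-b∉ σr g n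

  grow-w∉ : ∀ {t' t} → Simple t → Grow t' t → w ∉ verts t'
  grow-w∉ (node w∉l _ _ _ _) cherry m = w∉l m
  grow-w∉ (node v∉l _ dis σl _) (inl {l' = l'} {l} g) m with verts-node⁻ {l = l'} m
  ... | inj₁ refl     = v∉l (nodes⊆verts l (grow-w g))
  ... | inj₂ (inj₁ n) = grow-w∉ σl g n
  ... | inj₂ (inj₂ n) = dis (nodes⊆verts l (grow-w g)) n
  grow-w∉ (node _ v∉r dis _ σr) (inr {l = l} {r = r} g) m with verts-node⁻ {l = l} m
  ... | inj₁ refl     = v∉r (nodes⊆verts r (grow-w g))
  ... | inj₂ (inj₁ n) = dis n (nodes⊆verts r (grow-w g))
  ... | inj₂ (inj₂ n) = grow-w∉ σr g n

  grow-simple : ∀ {t' t} → Simple t → Grow t' t → Simple t'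
  grow-simple σ cherry = leaf
  grow-simple (node v∉l v∉r dis σl σr) (inl g) =
    node (v∉l ∘ grow-verts g) v∉r (λ m n → dis (grow-verts g m) n) (grow-simple σl g) σr
  grow-simple (node v∉l v∉r dis σl σr) (inr g) =
    node v∉l (v∉r ∘ grow-verts g) (λ m n → dis m (grow-verts g n)) σl (grow-simple σr g)

  grow-nodes : ∀ {t' t} → Grow t' t → length (nodes t) ≡ suc (length (nodes t'))
  grow-nodes cherry = refl
  grow-nodes (inl {l' = l'} {l} {r} g) = cong suc (trans (ListP.length-++ (nodes l))
    (trans (cong (ℕ._+ _) (grow-nodes g)) (cong suc (sym (ListP.length-++ (nodes l'))))))
  grow-nodes (inr {l = l} {r'} {r} g) = cong suc (trans (ListP.length-++ (nodes l))
    (trans (cong (length (nodes l) ℕ.+_) (grow-nodes g)) (trans (ℕP.+-suc _ _) (cong suc (sym (ListP.length-++ (nodes l)))))))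

  collapse-leaves : ∀ {t' t} → Simple t → Grow t' t → ∀ {x} → x ∈ leaves t → collapse x ∈ leaves t'
  collapse-leaves (node _ _ dis _ _) cherry (here refl) =
    subst (_∈ a ∷ []) (sym (collapse-≢ λ e → dis (here refl) (here e))) (here refl)
  collapse-leaves σ cherry (there (here refl)) = subst (_∈ a ∷ []) (sym collapse-b) (here refl)
  collapse-leaves σ@(node _ _ _ σl _) (inl {l' = l'} {l} {r} g) m with ∈-++⁻ (leaves l) m
  ... | inj₁ m = ∈-++⁺ˡ (collapse-leaves σl g m)
  ... | inj₂ m = ∈-++⁺ʳ (leaves l') (subst (_∈ leaves r)
    (sym (collapse-≢ λ { refl → leaves-disjoint σ (grow-b g) m })) m)
  collapse-leaves σ@(node _ _ _ _ σr) (inr {l = l} {r = r} g) m with ∈-++⁻ (leaves l) m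
  ... | inj₁ m = ∈-++⁺ˡ (subst (_∈ leaves l) (sym (collapse-≢ λ { refl → leaves-disjoint σ m (grow-b g) })) m)
  ... | inj₂ m = ∈-++⁺ʳ (leaves l) (collapse-leaves σr g m)

  -- The old vertex `v` as it was before growing. The last two fields keep a leaf outside `v`
  -- outside after `collapse`: `inside` serves for the leaves that stay fixed, `a-in⇒b-in` for `b`,
  -- whose image is `a`.
  record Shrunk (t' : Tree V) (v : V) (l r : Tree V) : Set where
    field
      {l' r'} : Tree V
      sub     : node v l' r' ⊑ t'
      left    : ∀ {x} → x ∈ leaves l → collapse x ∈ leaves l'
      right   : ∀ {x} → x ∈ leaves r → collapse x ∈ leaves r'
      inside  : ∀ {x} → x ∈ verts (node v l' r') → x ∈ verts (node v l r)
      a-in⇒b-in : a ∈ verts (node v l' r') → b ∈ verts (node v l r)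

  shrink : ∀ {t' t v l r} → Simple t → Grow t' t → node v l r ⊑ t →
    (v ≡ w × l ≡ leaf a × r ≡ leaf b) ⊎ Shrunk t' v l r
  shrink σ cherry top = inj₁ (refl , refl , refl)
  shrink σ@(node _ _ dis σl _) (inl {l = l} g) top = inj₂ record
    { sub = top
    ; left = collapse-leaves σl g
    ; right = λ m → subst (_∈ _) (sym (collapse-≢ λ { refl → leaves-disjoint σ (grow-b g) m })) m
    ; inside = grow-verts (inl g)
    ; a-in⇒b-in = λ _ → vertsˡ (leaves⊆verts l (grow-b g)) }
  shrink σ@(node _ _ dis _ σr) (inr {l = l} {r = r} g) top = inj₂ record
    { sub = top
    ; left = λ m → subst (_∈ _) (sym (collapse-≢ λ { refl → leaves-disjoint σ m (grow-b g) })) m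
    ; right = collapse-leaves σr g
    ; inside = grow-verts (inr g)
    ; a-in⇒b-in = λ _ → vertsʳ l (leaves⊆verts r (grow-b g)) }
  shrink (node _ _ _ σl _) (inl g) (inl p) = Sum.map₂ (λ s → record
    { sub = inl (Shrunk.sub s) ; left = Shrunk.left s ; right = Shrunk.right s
    ; inside = Shrunk.inside s ; a-in⇒b-in = Shrunk.a-in⇒b-in s }) (shrink σl g p)
  shrink (node _ _ _ _ σr) (inr g) (inr p) = Sum.map₂ (λ s → record
    { sub = inr (Shrunk.sub s) ; left = Shrunk.left s ; right = Shrunk.right s
    ; inside = Shrunk.inside s ; a-in⇒b-in = Shrunk.a-in⇒b-in s }) (shrink σr g p)
  shrink (node _ _ dis σl _) (inl {l' = l'} {l} {r} g) (inr {s = node v l₁ r₁} p) = inj₂ record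
    { sub = inr p
    ; left = λ m → subst (_∈ leaves l₁) (sym (collapse-≢ (b≢ (⊑-leaves p (∈-++⁺ˡ m))))) m
    ; right = λ m → subst (_∈ leaves r₁) (sym (collapse-≢ (b≢ (⊑-leaves p (∈-++⁺ʳ (leaves l₁) m))))) m
    ; inside = λ m → m
    ; a-in⇒b-in = λ m → ⊥-elim (dis (grow-verts g (leaves⊆verts l' (grow-a g))) (⊑-verts p m)) }
    where
    b≢ : ∀ {x} → x ∈ leaves r → x ≢ b
    b≢ m refl = dis (leaves⊆verts l (grow-b g)) (leaves⊆verts r m)
  shrink (node _ _ dis _ σr) (inr {l = l} {r'} {r} g) (inl {s = node v l₁ r₁} p) = inj₂ record
    { sub = inl p
    ; left = λ m → subst (_∈ leaves l₁) (sym (collapse-≢ (b≢ (⊑-leaves p (∈-++⁺ˡ m))))) m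
    ; right = λ m → subst (_∈ leaves r₁) (sym (collapse-≢ (b≢ (⊑-leaves p (∈-++⁺ʳ (leaves l₁) m))))) m
    ; inside = λ m → m
    ; a-in⇒b-in = λ m → ⊥-elim (dis (⊑-verts p m) (grow-verts g (leaves⊆verts r' (grow-a g)))) }
    where
    b≢ : ∀ {x} → x ∈ leaves l → x ≢ b
    b≢ m refl = dis (leaves⊆verts l m) (leaves⊆verts r (grow-b g))

  -- The vertex `w` is the only new median, and its two lower branches are single leaves. At any
  -- other vertex the three branches survive `collapse`.
  split-shrink : ∀ {o t' t v x y z} → o ∉ verts t → Simple t → Grow t' t → Split o t v x y z →
    (v ≡ w × x ≡ a × y ≡ b × z ≢ a × z ≢ b) ⊎ Split o t' v (collapse x) (collapse y) (collapse z)
  split-shrink {o} {t'} {t} {z = z} o∉ σ g (split {l} {r} p m n k k∉) with shrink σ g p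
  ... | inj₁ (refl , refl , refl) with m | n
  ...   | here refl | here refl = inj₁ (refl , refl , refl , (λ e → k∉ (there (here e))) , λ e → k∉ (there (there (here e))))
  split-shrink {o} {t'} {t} {v} {z = z} o∉ σ g (split {l} {r} p m n k k∉) | inj₂ s =
    inj₂ (split (Shrunk.sub s) (Shrunk.left s m) (Shrunk.right s n) (z'∈ k) z'∉)
    where
    z'∈ : z ∈ o ∷ leaves t → collapse z ∈ o ∷ leaves t'
    z'∈ (here refl) = here (collapse-≢ λ { refl → o∉ (leaves⊆verts t (grow-b g)) })
    z'∈ (there k)   = there (collapse-leaves σ g k)
    z'∉ : collapse z ∉ verts (node v (Shrunk.l' s) (Shrunk.r' s))
    z'∉ i with z ≟ b
    ... | yes refl = k∉ (Shrunk.a-in⇒b-in s i)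
    ... | no _     = k∉ (Shrunk.inside s i)

-- The descent stops at a vertex both of whose children are leaves.
grow-exists : ∀ {V : Set} (_≟_ : DecidableEquality V) (v : V) l r →
  ∃ λ a → ∃₂ λ b w → ∃ λ t' → Grow _≟_ a b w t' (node v l r)
grow-exists _≟_ v (leaf a) (leaf b) = a , b , v , leaf a , cherry
grow-exists _≟_ v (node v' l r) r' with grow-exists _≟_ v' l r
... | a , b , w , t' , g = a , b , w , node v t' r' , inl g
grow-exists _≟_ v (leaf a') (node v' l r) with grow-exists _≟_ v' l r
... | a , b , w , t' , g = a , b , w , node v (leaf a') t' , inr g

-- Walks in 3-trees

unique-length : ∀ {m} {xs : List (Fin m)} → Unique xs → length xs ℕ.≤ m
unique-length {m} {xs} u = subst (length xs ℕ.≤_) (ListP.length-tabulate {n = m} (λ i → i))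
  (unique-⊆-length u λ {x} _ → ∈-allFin x)

unique-++⁻ˡ : ∀ {A : Set} (xs : List A) {ys} → Unique (xs ++ ys) → Unique xs
unique-++⁻ˡ []       u       = []
unique-++⁻ˡ (x ∷ xs) (a ∷ u) = AllP.++⁻ˡ xs a ∷ unique-++⁻ˡ xs u

-- Neighbour lists count only up to rotation. At an inner vertex the first index will be the parent
-- and the other two the left and the right child.
data Rot3 {A : Set} (x y z : A) : List A → Set where
  rot₀ : Rot3 x y z (x ∷ y ∷ z ∷ [])
  rot₁ : Rot3 x y z (z ∷ x ∷ y ∷ [])
  rot₂ : Rot3 x y z (y ∷ z ∷ x ∷ [])

rot3-length : ∀ {A : Set} {x y z : A} {xs} → Rot3 x y z xs → length xs ≡ 3
rot3-length rot₀ = refl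
rot3-length rot₁ = refl
rot3-length rot₂ = refl

rot3-exists : ∀ {A : Set} {x : A} {xs} → length xs ≡ 3 → x ∈ xs → ∃₂ λ y z → Rot3 x y z xs
rot3-exists {xs = _ ∷ _ ∷ _ ∷ []} _ (here refl)                 = _ , _ , rot₀
rot3-exists {xs = _ ∷ _ ∷ _ ∷ []} _ (there (here refl))         = _ , _ , rot₁
rot3-exists {xs = _ ∷ _ ∷ _ ∷ []} _ (there (there (here refl))) = _ , _ , rot₂

rot3-cyc : ∀ {A : Set} {x y z : A} {xs} → Rot3 x y z xs → Rot3 y z x xs
rot3-cyc rot₀ = rot₁
rot3-cyc rot₁ = rot₂
rot3-cyc rot₂ = rot₀

rot3-∈ : ∀ {A : Set} {x y z : A} {xs} → Rot3 x y z xs → x ∈ xs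
rot3-∈ rot₀ = here refl
rot3-∈ rot₁ = there (here refl)
rot3-∈ rot₂ = there (there (here refl))

rot3-∈⁻ : ∀ {A : Set} {x y z w : A} {xs} → Rot3 x y z xs → w ∈ xs → w ≡ x ⊎ w ≡ y ⊎ w ≡ z
rot3-∈⁻ rot₀ (here e)                 = inj₁ e
rot3-∈⁻ rot₀ (there (here e))         = inj₂ (inj₁ e)
rot3-∈⁻ rot₀ (there (there (here e))) = inj₂ (inj₂ e)
rot3-∈⁻ rot₁ (here e)                 = inj₂ (inj₂ e)
rot3-∈⁻ rot₁ (there (here e))         = inj₁ e
rot3-∈⁻ rot₁ (there (there (here e))) = inj₂ (inj₁ e)
rot3-∈⁻ rot₂ (here e)                 = inj₂ (inj₁ e)
rot3-∈⁻ rot₂ (there (here e))         = inj₂ (inj₂ e)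
rot3-∈⁻ rot₂ (there (there (here e))) = inj₁ e

rot3-≢ : ∀ {A : Set} {x y z : A} {xs} → Rot3 x y z xs → Unique xs → x ≢ y
rot3-≢ rot₀ ((p ∷ _) ∷ _)           = p
rot3-≢ rot₁ (_ ∷ (p ∷ _) ∷ _)       = p
rot3-≢ rot₂ ((_ ∷ p ∷ _) ∷ _)       = p ∘ sym

rot3-unique : ∀ {A : Set} {x y z : A} {xs} → Rot3 x y z xs → x ≢ y → y ≢ z → x ≢ z → Unique xs
rot3-unique rot₀ p q r = (p ∷ r ∷ []) ∷ (q ∷ []) ∷ [] ∷ []
rot3-unique rot₁ p q r = ((r ∘ sym) ∷ (q ∘ sym) ∷ []) ∷ (p ∷ []) ∷ [] ∷ []
rot3-unique rot₂ p q r = (q ∷ (p ∘ sym) ∷ []) ∷ ((r ∘ sym) ∷ []) ∷ [] ∷ []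

module _ {m : ℕ} (G : Graph m) where

  private
    V = Fin m

  cycNext-rot3 : ∀ {x y z xs} → Rot3 x y z xs → Unique xs → cycNext G xs x ≡ y
  cycNext-rot3 {x} rot₀ _ with x FinP.≟ x
  ... | yes _ = refl
  ... | no ¬e = contradiction refl ¬e
  cycNext-rot3 {x} {y} {z} rot₁ ((z≢x ∷ _) ∷ _) with z FinP.≟ x
  ... | yes e = contradiction e z≢x
  ... | no _ with x FinP.≟ x
  ...   | yes _ = refl
  ...   | no ¬e = contradiction refl ¬e
  cycNext-rot3 {x} {y} {z} rot₂ ((_ ∷ y≢x ∷ _) ∷ (z≢x ∷ _) ∷ _) with y FinP.≟ x
  ... | yes e = contradiction e y≢x
  ... | no _ with z FinP.≟ x
  ...   | yes e = contradiction e z≢x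
  ...   | no _ with x FinP.≟ x
  ...     | yes _ = refl
  ...     | no ¬e = contradiction refl ¬e

  walk-start∈ : ∀ {u v vs} → Walk G u v vs → u ∈ vs
  walk-start∈ (here v)   = here refl
  walk-start∈ (step _ _) = here refl

  walk-end∈ : ∀ {u v vs} → Walk G u v vs → v ∈ vs
  walk-end∈ (here v)   = here refl
  walk-end∈ (step _ p) = there (walk-end∈ p)

  -- Walks are used for constructions because they compose, which paths do not. The predicate
  -- confines them to a region and survives `loop-erase`; disjoint regions later give disjoint
  -- paths.
  WalkIn : (V → Set) → V → V → Set
  WalkIn P u v = ∃ λ vs → Walk G u v vs × (∀ {x} → x ∈ vs → P x)

  walkIn-refl : ∀ {P : V → Set} {v} → P v → WalkIn P v v
  walkIn-refl {v = v} p = v ∷ [] , here v , λ { (here refl) → p }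

  walkIn-step : ∀ {P : V → Set} {u w v} → P u → Adj G u w → WalkIn P w v → WalkIn P u v
  walkIn-step pu a (vs , p , h) = _ , step a p , λ { (here refl) → pu ; (there m) → h m }

  walkIn-trans : ∀ {P : V → Set} {u v w} → WalkIn P u v → WalkIn P v w → WalkIn P u w
  walkIn-trans {P} {w = w} (_ , p , h) q = go p h
    where
    go : ∀ {u vs} → Walk G u _ vs → (∀ {x} → x ∈ vs → P x) → WalkIn P u w
    go (here v)   h = q
    go (step a p) h = walkIn-step (h (here refl)) a (go p (h ∘ there))

  walkIn-mono : ∀ {P Q : V → Set} {u v} → (∀ {x} → P x → Q x) → WalkIn P u v → WalkIn Q u v
  walkIn-mono f (vs , p , h) = vs , p , f ∘ h

  PathIn : (V → Set) → V → V → Set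
  PathIn P u v = ∃ λ vs → Path G u v vs × (∀ {x} → x ∈ vs → P x)

  private
    module M = DecMembership (FinP._≟_ {m})

  path-suffix : ∀ {w v u vs} → Path G w v vs → u ∈ vs → ∃ λ us → Path G u v us × (∀ {x} → x ∈ us → x ∈ vs)
  path-suffix (here v , q) (here refl)             = _ , (here v , q) , λ m → m
  path-suffix (step a p , q) (here refl)           = _ , (step a p , q) , λ m → m
  path-suffix (step a p , _ ∷ q) (there m) with path-suffix (p , q) m
  ... | us , r , h = us , r , there ∘ h

  -- Loop erasure from the far end: if `u` already occurs on the erased remainder, the part before
  -- that occurrence is dropped.
  erase : ∀ {u v vs} → Walk G u v vs → PathIn (_∈ vs) u v
  erase (here v) = _ , (here v , [] ∷ []) , λ m → m
  erase {u} (step a p) with erase p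
  ... | ps , path@(p' , q) , h with u M.∈? ps
  ...   | no u∉ = u ∷ ps , (step a p' , ∉⇒All≢ u∉ ∷ q) , λ { (here refl) → here refl ; (there m) → there (h m) }
  ...   | yes u∈ with path-suffix path u∈
  ...     | us , r , ⊆ = us , r , there ∘ h ∘ ⊆

  loop-erase : ∀ {P : V → Set} {u v} → WalkIn P u v → PathIn P u v
  loop-erase (_ , p , h) with erase p
  ... | ps , path , ⊆ = ps , path , h ∘ ⊆

  walk-prefix : ∀ {x y z vs} → Walk G x y vs → z ∈ vs → ∃₂ λ ws rest → Walk G x z ws × vs ≡ ws ++ rest
  walk-prefix (here v)   (here refl) = _ , [] , here v , refl
  walk-prefix (step {vs = vs} a p) (here refl) = _ , vs , here _ , refl
  walk-prefix (step a p) (there m) with walk-prefix p m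
  ... | ws , rest , q , e = _ , rest , step a q , cong (_ ∷_) e

  -- The neighbour lists of `G` at all vertices of the tree are those of a subtree hanging below
  -- `u`. The list at `u` itself is left open.
  data Sub : V → Tree V → Set where
    leaf : ∀ {u v} → nbrs G v ≡ u ∷ [] → Sub u (leaf v)
    node : ∀ {u v l r} → Rot3 u (root l) (root r) (nbrs G v) → Sub v l → Sub v r → Sub u (node v l r)

  parent-adj : ∀ {u t} → Sub u t → Adj G u (root t)
  parent-adj (leaf e)     = subst (_ ∈_) (sym e) (here refl)
  parent-adj (node r _ _) = rot3-∈ r

  walk-down : ∀ {u t x} → Sub u t → x ∈ verts t → WalkIn (_∈ verts t) (root t) x
  walk-down (leaf e) (here refl) = walkIn-refl (here refl)
  walk-down {t = node v l r} (node ρ sl sr) m with verts-node⁻ {l = l} m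
  ... | inj₁ refl     = walkIn-refl (here refl)
  ... | inj₂ (inj₁ m) = walkIn-step (here refl) (parent-adj sl) (walkIn-mono vertsˡ (walk-down sl m))
  ... | inj₂ (inj₂ m) = walkIn-step (here refl) (parent-adj sr) (walkIn-mono (vertsʳ l) (walk-down sr m))

  walk-up : ∀ {u t x} → Sub u t → x ∈ verts t → WalkIn (_∈ verts t) x (root t)
  walk-up (leaf e) (here refl) = walkIn-refl (here refl)
  walk-up {t = node v l r} (node ρ sl sr) m with verts-node⁻ {l = l} m
  ... | inj₁ refl     = walkIn-refl (here refl)
  ... | inj₂ (inj₁ m) = walkIn-trans (walkIn-mono vertsˡ (walk-up sl m))
    (walkIn-step (vertsˡ (root∈verts l)) (rot3-∈ (rot3-cyc ρ)) (walkIn-refl (here refl)))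
  ... | inj₂ (inj₂ m) = walkIn-trans (walkIn-mono (vertsʳ l) (walk-up sr m))
    (walkIn-step (vertsʳ l (root∈verts r)) (rot3-∈ (rot3-cyc (rot3-cyc ρ))) (walkIn-refl (here refl)))

  -- This makes the edge above `s` a bridge and underlies all separation arguments. A step out of a
  -- child's subtree can only lead to the vertex above it, which still belongs to `s`.
  nbr-in : ∀ {u s x w} → Sub u s → x ∈ verts s → w ∈ nbrs G x → w ∈ verts s ⊎ (x ≡ root s × w ≡ u)
  nbr-in (leaf e) (here refl) n rewrite e with n
  ... | here w≡u = inj₂ (refl , w≡u)
  nbr-in {s = node v l r} (node ρ sl sr) m n with verts-node⁻ {l = l} m
  ... | inj₂ (inj₁ m) with nbr-in sl m n
  ...   | inj₁ k        = inj₁ (vertsˡ k)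
  ...   | inj₂ (_ , e)  = inj₁ (here e)
  nbr-in {s = node v l r} (node ρ sl sr) m n | inj₂ (inj₂ m') with nbr-in sr m' n
  ...   | inj₁ k        = inj₁ (vertsʳ l k)
  ...   | inj₂ (_ , e)  = inj₁ (here e)
  nbr-in {s = node v l r} (node ρ sl sr) m n | inj₁ refl with rot3-∈⁻ ρ n
  ...   | inj₁ e           = inj₂ (refl , e)
  ...   | inj₂ (inj₁ refl) = inj₁ (vertsˡ (root∈verts l))
  ...   | inj₂ (inj₂ refl) = inj₁ (vertsʳ l (root∈verts r))

  enters : ∀ {u s x y vs} → Sub u s → Walk G x y vs → x ∉ verts s → y ∈ verts s → root s ∈ vs × u ∈ vs
  enters σ (here v) x∉ y∈ = contradiction y∈ x∉
  enters {s = s} σ (step {w = w} a p) x∉ y∈ with w M.∈? verts s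
  ... | no w∉ = Product.map there there (enters σ p w∉ y∈)
  ... | yes w∈ with nbr-in σ w∈ a
  ...   | inj₁ x∈            = contradiction x∈ x∉
  ...   | inj₂ (refl , refl) = there (walk-start∈ p) , here refl

  -- `Adj u w` reads the list at `w`, which suits a walk entering the subtree. For one that leaves
  -- it the edge has to be turned round first, hence the symmetry.
  exits : (∀ u v → Adj G u v → Adj G v u) → ∀ {u s x y vs} → Sub u s → Walk G x y vs →
    x ∈ verts s → y ∉ verts s → root s ∈ vs × u ∈ vs
  exits symm σ (here v) x∈ y∉ = contradiction x∈ y∉
  exits symm σ (step a p) x∈ y∉ with nbr-in σ x∈ (symm _ _ a)
  ... | inj₁ w∈            = Product.map there there (exits symm σ p w∈ y∉)
  ... | inj₂ (refl , refl) = here refl , there (walk-start∈ p)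

  -- G is the 3-tree obtained from t by attaching the leaf o above the root.
  record Rep (o : V) (t : Tree V) : Set where
    field
      rootNbr : nbrs G o ≡ root t ∷ []
      sub     : Sub o t
      fresh   : o ∉ verts t
      simple  : Simple t
      cover   : ∀ v → v ≡ o ⊎ v ∈ verts t

  module FromThreeTree (T : IsThreeTree G) where
    open IsThreeTree T

    -- Together with the edges from `v` to `a` and to `b`, a walk that avoids `v` would close up to
    -- a cycle.
    no-detour : ∀ {v a b} {P : V → Set} → a ∈ nbrs G v → b ∈ nbrs G v → a ≢ b → WalkIn P a b → (∀ {x} → P x → x ≢ v) → ⊥
    no-detour {v} {a} {b} a∈ b∈ a≢b w P⇒≢ with loop-erase w
    ... | ps , (p , q) , h = acyclic (v , b , v ∷ ps ,
      (step (symmetric _ _ a∈) p , ∉⇒All≢ (λ m → P⇒≢ (h m) refl) ∷ q) , s≤s (long p) , b∈)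
      where
      long : ∀ {ps} → Walk G a b ps → 2 ℕ.≤ length ps
      long (here _)            = contradiction refl a≢b
      long (step _ (here _))   = s≤s (s≤s z≤n)
      long (step _ (step _ _)) = s≤s (s≤s z≤n)

    -- The list is the path from `v` back to the origin. A neighbour of `v` found on it beyond `u`
    -- closes a cycle with at least three vertices.
    new-neighbour : ∀ {o u v vis a} → Walk G v o (v ∷ u ∷ vis) → Unique (v ∷ u ∷ vis) → a ∈ nbrs G v → a ≢ u →
      a ∉ v ∷ u ∷ vis
    new-neighbour {v = v} w q a∈ a≢u (here refl)         = noLoop v a∈
    new-neighbour         w q a∈ a≢u (there (here e))    = a≢u e
    new-neighbour {u = u} {v} {a = a} (step b (step c p)) q a∈ a≢u (there (there m)) with walk-prefix p m
    ... | ws , rest , p' , refl =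
      acyclic (v , a , v ∷ u ∷ ws , (step b (step c p') , unique-++⁻ˡ (v ∷ u ∷ ws) q) , s≤s (s≤s (nonempty p')) , a∈)
      where
      nonempty : ∀ {x y ws} → Walk G x y ws → 1 ℕ.≤ length ws
      nonempty (here _)   = s≤s z≤n
      nonempty (step _ _) = s≤s z≤n

    -- Each call lengthens the repetition-free path back to `o` by one, while such a path has at
    -- most `m` vertices; hence fuel plus length stays above `m` and the fuel never runs out. The
    -- path keeps the subtree away from what lies above it, and `no-detour` keeps the two children
    -- apart.
    unfold : ∀ {o} fuel u v vis → Walk G v o (v ∷ u ∷ vis) → Unique (v ∷ u ∷ vis) → m ℕ.< fuel ℕ.+ length (v ∷ u ∷ vis) →
      ∃ λ t → root t ≡ v × Sub u t × (∀ {x} → x ∈ verts t → x ∉ u ∷ vis) × Simple t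
    unfold zero u v vis w q m< = contradiction (unique-length q) (ℕP.<⇒≱ m<)
    unfold {o} (suc fuel) u v vis w@(step uv w') q@(v∉ ∷ _) m< with degree v | symmetric _ _ (adj w')
      where
      adj : ∀ {xs} → Walk G _ o (u ∷ xs) → Adj G v u
      adj (here _)   = uv
      adj (step _ _) = uv
    ... | inj₁ len | u∈ = leaf v , refl , leaf (singleton (nbrs G v) len u∈) , (λ { (here refl) → All≢⇒∉ v∉ }) , leaf
      where
      singleton : ∀ xs → length xs ≡ 1 → u ∈ xs → xs ≡ u ∷ []
      singleton (x ∷ []) _ (here refl) = refl
    ... | inj₂ len | u∈ with rot3-exists len u∈
    ...   | a , b , ρ
      with new-neighbour w q (rot3-∈ (rot3-cyc ρ)) (rot3-≢ ρ (noRepeat v) ∘ sym)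
         | new-neighbour w q (rot3-∈ (rot3-cyc (rot3-cyc ρ))) (rot3-≢ (rot3-cyc (rot3-cyc ρ)) (noRepeat v))
    ...   | a∉ | b∉
      with unfold fuel v a (u ∷ vis) (step (rot3-∈ (rot3-cyc ρ)) w) (∉⇒All≢ a∉ ∷ q) (subst (m ℕ.<_) (sym (ℕP.+-suc fuel _)) m<)
         | unfold fuel v b (u ∷ vis) (step (rot3-∈ (rot3-cyc (rot3-cyc ρ))) w) (∉⇒All≢ b∉ ∷ q) (subst (m ℕ.<_) (sym (ℕP.+-suc fuel _)) m<)
    ...   | l , refl , sl , l∉ , σl | r , refl , sr , r∉ , σr =
      node v l r , refl , node ρ sl sr , avoid ,
        node (λ m → l∉ m (here refl)) (λ m → r∉ m (here refl)) disjoint σl σr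
      where
      avoid : ∀ {x} → x ∈ verts (node v l r) → x ∉ u ∷ vis
      avoid m with verts-node⁻ {l = l} m
      ... | inj₁ refl     = All≢⇒∉ v∉
      ... | inj₂ (inj₁ m) = l∉ m ∘ there
      ... | inj₂ (inj₂ m) = r∉ m ∘ there
      disjoint : Disjoint (verts l) (verts r)
      disjoint ml mr = no-detour {P = _≢ v} (rot3-∈ (rot3-cyc ρ)) (rot3-∈ (rot3-cyc (rot3-cyc ρ)))
        (rot3-≢ (rot3-cyc ρ) (noRepeat v))
        (walkIn-trans (walkIn-mono (λ { m refl → l∉ m (here refl) }) (walk-down sl ml))
          (walkIn-mono (λ { m refl → r∉ m (here refl) }) (walk-up sr mr)))
        (λ x≢v → x≢v)

    edge-subtree : ∀ {o v} → v ∈ nbrs G o → ∃ λ t → root t ≡ v × Sub o t × o ∉ verts t × Simple t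
    edge-subtree {o} {v} v∈ with unfold m o v [] (step v∈ (here o))
      (((λ { refl → noLoop o v∈ }) ∷ []) ∷ [] ∷ []) (ℕP.m<m+n m (s≤s z≤n))
    ... | t , e , s , ∉ , σ = t , e , s , (λ m → ∉ m (here refl)) , σ

    rep-at-leaf : ∀ {o} → IsLeaf G o → ∃ (Rep o)
    rep-at-leaf {o} len with nbrs G o in eq
    rep-at-leaf {o} len | v ∷ [] with edge-subtree {o} {v} (subst (v ∈_) (sym eq) (here refl))
    ... | t , refl , s , fr , σ = t , record
      { rootNbr = eq ; sub = s ; fresh = fr ; simple = σ
      ; cover = λ x → closed (proj₁ (proj₂ (connected o x))) (inj₁ refl) }
      where
      InTree : V → Set
      InTree x = x ≡ o ⊎ x ∈ verts t
      closed : ∀ {x y vs} → Walk G x y vs → InTree x → InTree y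
      closed (here _)   i = i
      closed (step {w = w} a p) i = closed p (next i)
        where
        next : InTree _ → InTree w
        next (inj₁ refl) with subst (w ∈_) eq (symmetric _ _ a)
        ... | here refl = inj₂ (root∈verts t)
        next (inj₂ m) with nbr-in s m (symmetric _ _ a)
        ... | inj₁ n       = inj₂ n
        ... | inj₂ (_ , e) = inj₁ e

    leaf-degree : ∀ {u t x} → Sub u t → x ∈ leaves t → IsLeaf G x
    leaf-degree (leaf e) (here refl) = cong length e
    leaf-degree (node {l = l} _ sl sr) m with ∈-++⁻ (leaves l) m
    ... | inj₁ m = leaf-degree sl m
    ... | inj₂ m = leaf-degree sr m

    -- Unfolding the tree beyond any edge at `v` ends in leaves.
    leaf-exists : V → ∃ (IsLeaf G)
    leaf-exists v with nbrs G v in eq | degree v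
    ... | x ∷ xs | _ with edge-subtree {v} {x} (subst (x ∈_) (sym eq) (here refl))
    ...   | t , _ , s , _ = first t , leaf-degree s (first∈leaves t)
    leaf-exists v | [] | inj₁ ()
    leaf-exists v | [] | inj₂ ()

-- Occ o t u s: the subtree s occurs in t below the vertex u, where o is the vertex above t.
data Occ {V : Set} (o : V) (t : Tree V) : V → Tree V → Set where
  top   : Occ o t o t
  left  : ∀ {u v l r} → Occ o t u (node v l r) → Occ o t v l
  right : ∀ {u v l r} → Occ o t u (node v l r) → Occ o t v r

occ⇒⊑ : ∀ {V : Set} {o u : V} {t s} → Occ o t u s → s ⊑ t
occ⇒⊑ top       = top
occ⇒⊑ (left p)  = ⊑-trans (inl top) (occ⇒⊑ p)
occ⇒⊑ (right p) = ⊑-trans (inr top) (occ⇒⊑ p)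

⊑⇒occ : ∀ {V : Set} {o u : V} {t s s'} → Occ o t u s → s' ⊑ s → ∃ λ u' → Occ o t u' s'
⊑⇒occ p top     = _ , p
⊑⇒occ p (inl q) = ⊑⇒occ (left p) q
⊑⇒occ p (inr q) = ⊑⇒occ (right p) q

vert-occ : ∀ {V : Set} {o u : V} {t} s {x} → Occ o t u s → x ∈ verts s → ∃₂ λ u' s' → Occ o t u' s' × x ≡ root s'
vert-occ (leaf v) p (here e) = _ , _ , p , e
vert-occ (node v l r) p m with verts-node⁻ {l = l} m
... | inj₁ e        = _ , _ , p , e
... | inj₂ (inj₁ m) = vert-occ l (left p) m
... | inj₂ (inj₂ m) = vert-occ r (right p) m

occ-parent∉ : ∀ {V : Set} {o u : V} {t s} → o ∉ verts t → Simple t → Occ o t u s → u ∉ verts s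
occ-parent∉ o∉ σ top = o∉
occ-parent∉ o∉ σ (left p) with ⊑-simple (occ⇒⊑ p) σ
... | node v∉l _ _ _ _ = v∉l
occ-parent∉ o∉ σ (right p) with ⊑-simple (occ⇒⊑ p) σ
... | node _ v∉r _ _ _ = v∉r

module RepLemmas {m : ℕ} {G : Graph m} {o : Fin m} {t : Tree (Fin m)} (R : Rep G o t) where
  open Rep R

  occ-sub : ∀ {u s} → Occ o t u s → Sub G u s
  occ-sub top = sub
  occ-sub (left p) with occ-sub p
  ... | node _ sl _ = sl
  occ-sub (right p) with occ-sub p
  ... | node _ _ sr = sr

  occ-∉ : ∀ {u s} → Occ o t u s → u ∉ verts s
  occ-∉ = occ-parent∉ fresh simple

  child-adj : ∀ {u s} → Occ o t u s → Adj G (root s) u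
  child-adj top = subst (root t ∈_) (sym rootNbr) (here refl)
  child-adj (left p) with occ-sub p
  ... | node ρ _ _ = rot3-∈ (rot3-cyc ρ)
  child-adj (right p) with occ-sub p
  ... | node ρ _ _ = rot3-∈ (rot3-cyc (rot3-cyc ρ))

  node-rot : ∀ {u v l r} → Occ o t u (node v l r) → Rot3 u (root l) (root r) (nbrs G v)
  node-rot p with occ-sub p
  ... | node ρ _ _ = ρ

  node-parts : ∀ {u v l r} → Occ o t u (node v l r) → v ∉ verts l × v ∉ verts r × Disjoint (verts l) (verts r)
  node-parts p with ⊑-simple (occ⇒⊑ p) simple
  ... | node a b c _ _ = a , b , c

  node-nbrs-distinct : ∀ {u v l r} → Occ o t u (node v l r) → u ≢ root l × root l ≢ root r × u ≢ root r
  node-nbrs-distinct {l = l} {r} p =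
    ∉⇒≢ (occ-∉ p) (vertsˡ (root∈verts l)) ,
    (λ e → proj₂ (proj₂ (node-parts p)) (root∈verts l) (subst (_∈ verts r) (sym e) (root∈verts r))) ,
    ∉⇒≢ (occ-∉ p) (vertsʳ l (root∈verts r))

  node-nbrs-unique : ∀ {u v l r} → Occ o t u (node v l r) → Unique (nbrs G v)
  node-nbrs-unique p with node-nbrs-distinct p
  ... | a , b , c = rot3-unique (node-rot p) a b c

  data Position (v : Fin m) : Set where
    origin : v ≡ o → Position v
    atLeaf : ∀ {u} → Occ o t u (leaf v) → Position v
    atNode : ∀ {u l r} → Occ o t u (node v l r) → Position v

  position : ∀ v → Position v
  position v with cover v
  ... | inj₁ e = origin e
  ... | inj₂ n with vert-occ t top n
  ...   | _ , leaf _ , p , refl     = atLeaf p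
  ...   | _ , node _ _ _ , p , refl = atNode p

  leaf-nbrs : ∀ {u v} → Occ o t u (leaf v) → nbrs G v ≡ u ∷ []
  leaf-nbrs p with occ-sub p
  ... | leaf e = e

  adj-sym : ∀ u v → Adj G u v → Adj G v u
  adj-sym u v a with position v
  ... | origin refl with subst (u ∈_) rootNbr a
  ...   | here refl = parent-adj G sub
  adj-sym u v a | atLeaf p with subst (u ∈_) (leaf-nbrs p) a
  ...   | here refl = child-adj p
  adj-sym u v a | atNode p with rot3-∈⁻ (node-rot p) a
  ...   | inj₁ refl        = child-adj p
  ...   | inj₂ (inj₁ refl) = parent-adj G (occ-sub (left p))
  ...   | inj₂ (inj₂ refl) = parent-adj G (occ-sub (right p))

  leaf-is-leaf : ∀ {x} → x ∈ o ∷ leaves t → IsLeaf G x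
  leaf-is-leaf (here refl) = cong length rootNbr
  leaf-is-leaf (there n) with ⊑⇒occ top (∈leaves⇒⊑ t n)
  ... | _ , p = cong length (leaf-nbrs p)

  node-is-deg3 : ∀ {x} → x ∈ nodes t → IsDeg3 G x
  node-is-deg3 n with ∈nodes⇒⊑ t n
  ... | _ , _ , q with ⊑⇒occ top q
  ...   | _ , p = rot3-length (node-rot p)

  leaf∨node : ∀ v → v ∈ o ∷ leaves t ⊎ v ∈ nodes t
  leaf∨node v with cover v
  ... | inj₁ e = inj₁ (here e)
  ... | inj₂ n = Sum.map₁ there (verts⊆leaves∪nodes t n)

  leaf-vertex : ∀ {v} → IsLeaf G v → v ∈ o ∷ leaves t
  leaf-vertex {v} e with leaf∨node v
  ... | inj₁ n = n
  ... | inj₂ n with trans (sym e) (node-is-deg3 n)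
  ...   | ()

  deg3-vertex : ∀ {v} → IsDeg3 G v → v ∈ nodes t
  deg3-vertex {v} e with leaf∨node v
  ... | inj₂ n = n
  ... | inj₁ n with trans (sym e) (leaf-is-leaf n)
  ...   | ()

  -- Outside a child's subtree there are its parent, the sibling's subtree and whatever lies outside
  -- the parent's subtree, which is reached recursively.
  walk-outside : ∀ {u s z} → Occ o t u s → z ∉ verts s → WalkIn G (_∉ verts s) u z
  walk-outside {z = z} top z∉ with cover z
  ... | inj₁ refl = walkIn-refl G fresh
  ... | inj₂ n    = contradiction n z∉
  walk-outside {z = z} (left {u} {v} {l} {r} p) z∉ = go (M._∈?_ z (verts (node v l r)))
    where
    module M = DecMembership (FinP._≟_ {m})
    parts = node-parts p
    go : _ → WalkIn G (_∉ verts l) v z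
    go (no z∉n) = walkIn-step G (proj₁ parts) (child-adj p) (walkIn-mono G (_∘ vertsˡ) (walk-outside p z∉n))
    go (yes n) with verts-node⁻ {l = l} n
    ... | inj₁ refl     = walkIn-refl G (proj₁ parts)
    ... | inj₂ (inj₁ k) = contradiction k z∉
    ... | inj₂ (inj₂ k) = walkIn-step G (proj₁ parts) (parent-adj G (occ-sub (right p)))
      (walkIn-mono G (λ i j → proj₂ (proj₂ parts) j i) (walk-down G (occ-sub (right p)) k))
  walk-outside {z = z} (right {u} {v} {l} {r} p) z∉ = go (M._∈?_ z (verts (node v l r)))
    where
    module M = DecMembership (FinP._≟_ {m})
    parts = node-parts p
    v∉r = proj₁ (proj₂ parts)
    go : _ → WalkIn G (_∉ verts r) v z
    go (no z∉n) = walkIn-step G v∉r (child-adj p) (walkIn-mono G (_∘ vertsʳ l) (walk-outside p z∉n))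
    go (yes n) with verts-node⁻ {l = l} n
    ... | inj₁ refl     = walkIn-refl G v∉r
    ... | inj₂ (inj₂ k) = contradiction k z∉
    ... | inj₂ (inj₁ k) = walkIn-step G v∉r (parent-adj G (occ-sub (left p)))
      (walkIn-mono G (λ i j → proj₂ (proj₂ parts) i j) (walk-down G (occ-sub (left p)) k))

  -- Different neighbours of `u` lie in different branches, and only `u` connects the branches.
  -- Acyclicity follows: a cycle with `u` removed is a walk between two neighbours of `u`, so these
  -- coincide, which the length of the cycle forbids.
  first-hop : ∀ {u a b vs} → a ∈ nbrs G u → b ∈ nbrs G u → Walk G a b vs → u ∉ vs → a ≡ b
  first-hop {u} a∈ b∈ w u∉ with position u
  ... | origin refl with subst (_ ∈_) rootNbr a∈ | subst (_ ∈_) rootNbr b∈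
  ...   | here refl | here refl = refl
  first-hop {u} a∈ b∈ w u∉ | atLeaf p with subst (_ ∈_) (leaf-nbrs p) a∈ | subst (_ ∈_) (leaf-nbrs p) b∈
  ...   | here refl | here refl = refl
  first-hop {u} a∈ b∈ w u∉ | atNode {l = l} {r} p = cases (rot3-∈⁻ (node-rot p) a∈) (rot3-∈⁻ (node-rot p) b∈) w u∉
    where
    dis = proj₂ (proj₂ (node-parts p))
    l→ : ∀ {b vs} → Walk G (root l) b vs → u ∉ vs → b ∈ verts l
    l→ {b} w u∉ with DecMembership._∈?_ (FinP._≟_ {m}) b (verts l)
    ... | yes n = n
    ... | no b∉ = contradiction (proj₂ (exits G adj-sym (occ-sub (left p)) w (root∈verts l) b∉)) u∉
    r→ : ∀ {b vs} → Walk G (root r) b vs → u ∉ vs → b ∈ verts r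
    r→ {b} w u∉ with DecMembership._∈?_ (FinP._≟_ {m}) b (verts r)
    ... | yes n = n
    ... | no b∉ = contradiction (proj₂ (exits G adj-sym (occ-sub (right p)) w (root∈verts r) b∉)) u∉
    cases : ∀ {a b vs} → a ≡ _ ⊎ a ≡ root l ⊎ a ≡ root r → b ≡ _ ⊎ b ≡ root l ⊎ b ≡ root r → Walk G a b vs → u ∉ vs → a ≡ b
    cases (inj₁ refl) (inj₁ refl) w u∉               = refl
    cases (inj₁ refl) (inj₂ (inj₁ refl)) w u∉        =
      contradiction (proj₂ (enters G (occ-sub (left p)) w (occ-∉ p ∘ vertsˡ) (root∈verts l))) u∉
    cases (inj₁ refl) (inj₂ (inj₂ refl)) w u∉        =
      contradiction (proj₂ (enters G (occ-sub (right p)) w (occ-∉ p ∘ vertsʳ l) (root∈verts r))) u∉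
    cases (inj₂ (inj₁ refl)) (inj₁ refl) w u∉        = contradiction (vertsˡ (l→ w u∉)) (occ-∉ p)
    cases (inj₂ (inj₁ refl)) (inj₂ (inj₁ refl)) w u∉ = refl
    cases (inj₂ (inj₁ refl)) (inj₂ (inj₂ refl)) w u∉ = ⊥-elim (dis (l→ w u∉) (root∈verts r))
    cases (inj₂ (inj₂ refl)) (inj₁ refl) w u∉        = contradiction (vertsʳ l (r→ w u∉)) (occ-∉ p)
    cases (inj₂ (inj₂ refl)) (inj₂ (inj₁ refl)) w u∉ = ⊥-elim (dis (root∈verts l) (r→ w u∉))
    cases (inj₂ (inj₂ refl)) (inj₂ (inj₂ refl)) w u∉ = refl

  isThreeTree : IsThreeTree G
  isThreeTree = record
    { degree    = λ v → Sum.map leaf-is-leaf node-is-deg3 (leaf∨node v)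
    ; noRepeat  = noRepeat
    ; noLoop    = noLoop
    ; symmetric = adj-sym
    ; connected = λ u v → Product.map₂ proj₁ (loop-erase G (walkIn-trans G (to-o u) (from-o v)))
    ; acyclic   = acyclic
    }
    where
    Any : Fin m → Set
    Any x = x ≡ x

    noRepeat : ∀ v → Unique (nbrs G v)
    noRepeat v with position v
    ... | origin refl = subst Unique (sym rootNbr) ([] ∷ [])
    ... | atLeaf p    = subst Unique (sym (leaf-nbrs p)) ([] ∷ [])
    ... | atNode p    = node-nbrs-unique p

    noLoop : ∀ v → v ∉ nbrs G v
    noLoop v n with position v
    ... | origin refl with subst (v ∈_) rootNbr n
    ...   | here e = fresh (subst (_∈ verts t) (sym e) (root∈verts t))
    noLoop v n | atLeaf p with subst (v ∈_) (leaf-nbrs p) n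
    ...   | here e = occ-∉ p (here (sym e))
    noLoop v n | atNode {l = l} {r} p with rot3-∈⁻ (node-rot p) n | node-parts p
    ...   | inj₁ e        | _               = occ-∉ p (here (sym e))
    ...   | inj₂ (inj₁ e) | v∉l , _ , _     = v∉l (subst (_∈ verts l) (sym e) (root∈verts l))
    ...   | inj₂ (inj₂ e) | _ , v∉r , _     = v∉r (subst (_∈ verts r) (sym e) (root∈verts r))

    to-o : ∀ x → WalkIn G Any x o
    to-o x with cover x
    ... | inj₁ refl = walkIn-refl G refl
    ... | inj₂ n    = walkIn-trans G (walkIn-mono G (λ _ → refl) (walk-up G sub n))
      (walkIn-step G refl (child-adj top) (walkIn-refl G refl))

    from-o : ∀ x → WalkIn G Any o x
    from-o x with cover x
    ... | inj₁ refl = walkIn-refl G refl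
    ... | inj₂ n    = walkIn-step G refl (parent-adj G sub) (walkIn-mono G (λ _ → refl) (walk-down G sub n))

    acyclic : ¬ HasCycle G
    acyclic (u , _ , _ , (here _ , _) , s≤s () , _)
    acyclic (u , v , _ , (step {w = w} a p , u∉ ∷ q) , s≤s long , vu)
      with first-hop (adj-sym _ _ a) vu p (All≢⇒∉ u∉)
    ... | refl = closed p q long
      where
      closed : ∀ {vs} → Walk G w w vs → Unique vs → 2 ℕ.≤ length vs → ⊥
      closed (here _)   _        (s≤s ())
      closed (step _ p) (w∉ ∷ _) _ = All≢⇒∉ w∉ (walk-end∈ G p)

  split⇒threePaths : ∀ {v x y z} → Split o t v x y z → ThreePaths G v x y z
  split⇒threePaths {v} {x} {y} {z} (split {l} {r} p x∈ y∈ z∈ z∉) with ⊑⇒occ top p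
  ... | u , q with node-parts q
  ...   | v∉l , v∉r , dis =
    path pl , path pr , path po , isPath pl , isPath pr , isPath po ,
    (λ a i j → common InL InR (within pl i) (within pr j) dis) ,
    (λ a i j → common InL Out (within pl i) (within po j) (λ k n → n (vertsˡ k))) ,
    (λ a i j → common InR Out (within pr i) (within po j) (λ k n → n (vertsʳ l k)))
    where
    pl = loop-erase G (walkIn-step G (inj₁ refl) (parent-adj G (occ-sub (left q)))
      (walkIn-mono G inj₂ (walk-down G (occ-sub (left q)) (leaves⊆verts l x∈))))
    pr = loop-erase G (walkIn-step G (inj₁ refl) (parent-adj G (occ-sub (right q)))
      (walkIn-mono G inj₂ (walk-down G (occ-sub (right q)) (leaves⊆verts r y∈))))
    po = loop-erase G (walkIn-step G (inj₁ refl) (child-adj q) (walkIn-mono G inj₂ (walk-outside q z∉)))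
    path : ∀ {P a b} → PathIn G P a b → List (Fin m)
    path = proj₁
    isPath : ∀ {P a b} (w : PathIn G P a b) → Path G a b (proj₁ w)
    isPath w = proj₁ (proj₂ w)
    within : ∀ {P a b} (w : PathIn G P a b) → ∀ {c} → c ∈ proj₁ w → P c
    within w = proj₂ (proj₂ w)
    InL InR Out : Fin m → Set
    InL a = a ∈ verts l
    InR a = a ∈ verts r
    Out a = a ∉ verts (node v l r)
    common : ∀ (P Q : Fin m → Set) {a} → a ≡ v ⊎ P a → a ≡ v ⊎ Q a → (P a → Q a → ⊥) → a ≡ v
    common _ _ (inj₁ e) _        _ = e
    common _ _ (inj₂ _) (inj₁ e) _ = e
    common _ _ (inj₂ i) (inj₂ j) f = ⊥-elim (f i j)

  -- Two of the three paths leave the component of G minus v that contains b, hence pass through v.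
  threePaths-unique : ∀ {v b x y z} → Split o t v x y z → ThreePaths G b x y z → b ≡ v
  threePaths-unique {v} {b} {x} {y} {z} (split {l} {r} p x∈ y∈ z∈ z∉)
    (px , py , pz , (wx , _) , (wy , _) , (wz , _) , xy , xz , yz) with ⊑⇒occ top p
  ... | u , q with node-parts q | b M.∈? verts (node v l r)
    where module M = DecMembership (FinP._≟_ {m})
  ...   | v∉l , v∉r , dis | no b∉ = sym (xy v
    (proj₁ (enters G (occ-sub q) wx b∉ (vertsˡ (leaves⊆verts l x∈))))
    (proj₁ (enters G (occ-sub q) wy b∉ (vertsʳ l (leaves⊆verts r y∈)))))
  ...   | v∉l , v∉r , dis | yes b∈ with verts-node⁻ {l = l} b∈
  ...     | inj₁ e        = e
  ...     | inj₂ (inj₁ k) = sym (yz v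
    (proj₂ (exits G adj-sym (occ-sub (left q)) wy k (λ n → dis n (leaves⊆verts r y∈))))
    (proj₂ (exits G adj-sym (occ-sub (left q)) wz k (z∉ ∘ vertsˡ))))
  ...     | inj₂ (inj₂ k) = sym (xz v
    (proj₂ (exits G adj-sym (occ-sub (right q)) wx k (dis (leaves⊆verts l x∈))))
    (proj₂ (exits G adj-sym (occ-sub (right q)) wz k (z∉ ∘ vertsʳ l))))

  walkToLeaf-leaf : ∀ n {u v} → IsLeaf G v → walkToLeaf G n u v ≡ v
  walkToLeaf-leaf zero    e = refl
  walkToLeaf-leaf (suc n) {u} {v} e with length (nbrs G v) ℕ.≟ 1
  ... | yes _ = refl
  ... | no ¬e = contradiction e ¬e

  walkToLeaf-turn : ∀ n {u v a b} → Rot3 u a b (nbrs G v) → Unique (nbrs G v) → walkToLeaf G (suc n) u v ≡ walkToLeaf G n v a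
  walkToLeaf-turn n {u} {v} ρ q with length (nbrs G v) ℕ.≟ 1
  ... | yes e = contradiction (trans (sym e) (rot3-length ρ)) λ ()
  ... | no _  = cong (walkToLeaf G n v) (cycNext-rot3 G ρ q)

  -- Arriving from the parent, the cyclic order continues with the left child, so the walk keeps
  -- left.
  descend : ∀ n s {u} → Occ o t u s → length (verts s) ℕ.≤ n → walkToLeaf G n u (root s) ≡ first s
  descend n (leaf v) p _ = walkToLeaf-leaf n (cong length (leaf-nbrs p))
  descend (suc n) (node v l r) p (s≤s h) = trans (walkToLeaf-turn n (node-rot p) (node-nbrs-unique p))
    (descend n l (left p) (ℕP.≤-trans (subst (length (verts l) ℕ.≤_) (sym (ListP.length-++ (verts l))) (ℕP.m≤m+n _ _)) h))

  -- Arriving from a right child, the cyclic order continues with the parent, so the walk climbs for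
  -- as long as it comes from the right. Leaving the remaining fuel `n` free allows the walk to be
  -- continued from the root of `s`.
  ascend : ∀ s {u} → Occ o t u s → ∃₂ λ k x → nbrs G (last s) ≡ x ∷ [] × k ℕ.< length (verts s) ×
    (∀ n → walkToLeaf G (k ℕ.+ n) (last s) x ≡ walkToLeaf G n (root s) u)
  ascend (leaf v) p = 0 , _ , leaf-nbrs p , s≤s z≤n , λ n → refl
  ascend (node v l r) {u} p with ascend r (right p)
  ... | k , x , e , k< , h = suc k , x , e ,
    s≤s (ℕP.≤-trans k< (subst (length (verts r) ℕ.≤_) (sym (ListP.length-++ (verts l))) (ℕP.m≤n+m _ _))) ,
    λ n → trans (cong (λ j → walkToLeaf G j (last r) x) (sym (ℕP.+-suc k n)))
      (trans (h (suc n)) (walkToLeaf-turn n (rot3-cyc (rot3-cyc (node-rot p))) (node-nbrs-unique p)))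

  subtree-size : ∀ {u s} → Occ o t u s → length (verts s) ℕ.≤ m
  subtree-size p = unique-length (unique-verts (⊑-simple (occ⇒⊑ p) simple))

  nextLeaf-≡ : ∀ {x y} → nbrs G x ≡ y ∷ [] → nextLeaf G x ≡ walkToLeaf G (2 ℕ.* m) x y
  nextLeaf-≡ {x} e with nbrs G x
  nextLeaf-≡ refl | _ = refl

  -- Between two consecutive leaves the walk climbs to the vertex that separates them, turns once
  -- and descends. The climb takes fewer than `m` steps, so after the turn at least `m` units of
  -- fuel are left, which the descent cannot exceed.
  succ⇒nextLeaf : ∀ {x y} → Succ o t x y → nextLeaf G x ≡ y
  succ⇒nextLeaf start = trans (nextLeaf-≡ rootNbr) (descend (2 ℕ.* m) t top
    (ℕP.≤-trans (subtree-size top) (ℕP.m≤m+n m _)))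
  succ⇒nextLeaf close with ascend t top
  ... | k , x , e , k< , h = trans (nextLeaf-≡ e) (trans (cong (λ j → walkToLeaf G j (last t) x) (sym (ℕP.m+[n∸m]≡n k≤)))
    (trans (h (2 ℕ.* m ℕ.∸ k)) (walkToLeaf-leaf (2 ℕ.* m ℕ.∸ k) (leaf-is-leaf (here refl)))))
    where
    k≤ : k ℕ.≤ 2 ℕ.* m
    k≤ = ℕP.≤-trans (ℕP.<⇒≤ k<) (ℕP.≤-trans (subtree-size top) (ℕP.m≤m+n m _))
  succ⇒nextLeaf (inner {v} {l} {r} q) with ⊑⇒occ top q
  ... | u , p with ascend l (left p)
  ...   | k , x , e , k< , h = trans (nextLeaf-≡ e) (trans (cong (λ j → walkToLeaf G j (last l) x) fuel)
    (trans (h (suc n)) (trans (walkToLeaf-turn n (rot3-cyc (node-rot p)) (node-nbrs-unique p))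
      (descend n r (right p) (ℕP.≤-trans (subtree-size (right p)) m≤n)))))
    where
    k<m : k ℕ.< m
    k<m = ℕP.<-≤-trans k< (subtree-size (left p))
    n = 2 ℕ.* m ℕ.∸ suc k
    fuel : 2 ℕ.* m ≡ k ℕ.+ suc n
    fuel = trans (sym (ℕP.m+[n∸m]≡n (ℕP.≤-trans k<m (ℕP.m≤m+n m _)))) (sym (ℕP.+-suc k n))
    m≤n : m ℕ.≤ n
    m≤n = subst (ℕ._≤ n) (trans (ℕP.m+n∸m≡n m (m ℕ.+ 0)) (ℕP.+-identityʳ m)) (ℕP.∸-monoʳ-≤ (2 ℕ.* m) k<m)

-- The graph of a plane binary tree

module _ {m : ℕ} (o : Fin m) (t : Tree (Fin m)) where

  private
    module M = DecMembership (FinP._≟_ {m})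

  treeNbrs : Fin m → Tree (Fin m) → Fin m → List (Fin m)
  treeNbrs u (leaf v)     x = u ∷ []
  treeNbrs u (node v l r) x with x FinP.≟ v | x M.∈? verts l
  ... | yes _ | _     = u ∷ root l ∷ root r ∷ []
  ... | no _  | yes _ = treeNbrs v l x
  ... | no _  | no _  = treeNbrs v r x

  treeGraph : Graph m
  nbrs treeGraph x with x FinP.≟ o
  ... | yes _ = root t ∷ []
  ... | no _  = treeNbrs o t x

  treeGraph-sub : ∀ u s → Simple s → (∀ {x} → x ∈ verts s → nbrs treeGraph x ≡ treeNbrs u s x) → Sub treeGraph u s
  treeGraph-sub u (leaf v) σ h = leaf (h (here refl))
  treeGraph-sub u (node v l r) (node v∉l v∉r dis σl σr) h = node
    (subst (Rot3 u (root l) (root r)) (sym (trans (h (here refl)) at-v)) rot₀)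
    (treeGraph-sub v l σl (λ m → trans (h (vertsˡ m)) (in-l m)))
    (treeGraph-sub v r σr (λ m → trans (h (vertsʳ l m)) (in-r m)))
    where
    at-v : treeNbrs u (node v l r) v ≡ u ∷ root l ∷ root r ∷ []
    at-v with v FinP.≟ v | v M.∈? verts l
    ... | yes _ | _ = refl
    ... | no ¬e | _ = contradiction refl ¬e
    in-l : ∀ {x} → x ∈ verts l → treeNbrs u (node v l r) x ≡ treeNbrs v l x
    in-l {x} m with x FinP.≟ v | x M.∈? verts l
    ... | yes refl | _     = contradiction m v∉l
    ... | no _     | yes _ = refl
    ... | no _     | no m∉ = contradiction m m∉
    in-r : ∀ {x} → x ∈ verts r → treeNbrs u (node v l r) x ≡ treeNbrs v r x
    in-r {x} m with x FinP.≟ v | x M.∈? verts l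
    ... | yes refl | _     = contradiction m v∉r
    ... | no _     | yes n = ⊥-elim (dis n m)
    ... | no _     | no _  = refl

  treeGraph-rep : o ∉ verts t → Simple t → (∀ v → v ≡ o ⊎ v ∈ verts t) → Rep treeGraph o t
  treeGraph-rep o∉ σ cover = record
    { rootNbr = at-o ; sub = treeGraph-sub o t σ off-o ; fresh = o∉ ; simple = σ ; cover = cover }
    where
    at-o : nbrs treeGraph o ≡ root t ∷ []
    at-o with o FinP.≟ o
    ... | yes _ = refl
    ... | no ¬e = contradiction refl ¬e
    off-o : ∀ {x} → x ∈ verts t → nbrs treeGraph x ≡ treeNbrs o t x
    off-o {x} m with x FinP.≟ o
    ... | yes refl = contradiction m o∉
    ... | no _     = refl

unique-covers : ∀ {n} {xs : List (Fin n)} → Unique xs → length xs ≡ n → ∀ v → v ∈ xs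
unique-covers {n} {xs} q e v with DecMembership._∈?_ (FinP._≟_ {n}) v xs
... | yes m = m
... | no v∉ = contradiction (unique-length (∉⇒All≢ v∉ ∷ q)) (subst (λ k → ¬ suc k ℕ.≤ n) (sym e) ℕP.1+n≰n)

-- Ordered fields and the plane

module FieldLemmas (F : OrderedField) where
  open OrderedField F
  open Geometry F using (_-_; _≤_)

  ring : CommutativeRing _ _
  ring = record { isCommutativeRing = isCommutativeRing }

  open CommutativeRing ring public
    using (+-assoc; +-comm; +-identityˡ; +-identityʳ; *-assoc; *-comm; *-identityˡ; *-identityʳ;
           zeroˡ; zeroʳ; distribˡ; distribʳ; -‿inverseˡ; -‿inverseʳ)
  open RingProperties (CommutativeRing.ring ring) public
    using (-‿distribˡ-*; -‿distribʳ-*; -‿involutive; -‿+-comm; -0#≈0#)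

  fromℕ : ℕ → Carrier
  fromℕ zero    = 0#
  fromℕ (suc n) = 1# + fromℕ n

  fromℤ : ℤ → Carrier
  fromℤ (+ n)    = fromℕ n
  fromℤ -[1+ n ] = - fromℕ (suc n)

  fromℕ-+ : ∀ m n → fromℕ (m ℕ.+ n) ≡ fromℕ m + fromℕ n
  fromℕ-+ zero    n = sym (+-identityˡ _)
  fromℕ-+ (suc m) n = trans (cong (λ x → 1# + x) (fromℕ-+ m n)) (sym (+-assoc _ _ _))

  fromℕ-* : ∀ m n → fromℕ (m ℕ.* n) ≡ fromℕ m * fromℕ n
  fromℕ-* zero    n = sym (zeroˡ _)
  fromℕ-* (suc m) n = begin
    fromℕ (n ℕ.+ m ℕ.* n)              ≡⟨ fromℕ-+ n (m ℕ.* n) ⟩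
    fromℕ n + fromℕ (m ℕ.* n)          ≡⟨ cong₂ _+_ (sym (*-identityˡ _)) (fromℕ-* m n) ⟩
    1# * fromℕ n + fromℕ m * fromℕ n   ≡⟨ sym (distribʳ _ _ _) ⟩
    (1# + fromℕ m) * fromℕ n           ∎
    where open ≡-Reasoning

  fromℤ-neg : ∀ i → fromℤ (ℤ.- i) ≡ - fromℤ i
  fromℤ-neg (+ zero)    = sym -0#≈0#
  fromℤ-neg (+ suc n)   = refl
  fromℤ-neg -[1+ n ]    = sym (-‿involutive _)

  cancel : ∀ a b c → (a + b) + (- (a + c)) ≡ b + (- c)
  cancel a b c = begin
    (a + b) + (- (a + c))      ≡⟨ cong₂ _+_ (+-comm a b) (sym (-‿+-comm a c)) ⟩
    (b + a) + ((- a) + (- c))  ≡⟨ +-assoc b a _ ⟩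
    b + (a + ((- a) + (- c)))  ≡⟨ cong (λ x → b + x) (sym (+-assoc a _ _)) ⟩
    b + ((a + (- a)) + (- c))  ≡⟨ cong (λ x → b + (x + (- c))) (-‿inverseʳ a) ⟩
    b + (0# + (- c))           ≡⟨ cong (λ x → b + x) (+-identityˡ _) ⟩
    b + (- c)                  ∎
    where open ≡-Reasoning

  fromℤ-⊖ : ∀ m n → fromℤ (m ℤ.⊖ n) ≡ fromℕ m + (- fromℕ n)
  fromℤ-⊖ m       zero    = sym (trans (cong (λ x → fromℕ m + x) -0#≈0#) (+-identityʳ _))
  fromℤ-⊖ zero    (suc n) = sym (+-identityˡ _)
  fromℤ-⊖ (suc m) (suc n) = begin
    fromℤ (suc m ℤ.⊖ suc n)              ≡⟨ cong fromℤ (ℤP.[1+m]⊖[1+n]≡m⊖n m n) ⟩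
    fromℤ (m ℤ.⊖ n)                      ≡⟨ fromℤ-⊖ m n ⟩
    fromℕ m + (- fromℕ n)                ≡⟨ sym (cancel 1# (fromℕ m) (fromℕ n)) ⟩
    fromℕ (suc m) + (- fromℕ (suc n))    ∎
    where open ≡-Reasoning

  fromℤ-+ : ∀ i j → fromℤ (i ℤ.+ j) ≡ fromℤ i + fromℤ j
  fromℤ-+ (+ m)    (+ n)    = fromℕ-+ m n
  fromℤ-+ (+ m)    -[1+ n ] = fromℤ-⊖ m (suc n)
  fromℤ-+ -[1+ m ] (+ n)    = trans (fromℤ-⊖ n (suc m)) (+-comm _ _)
  fromℤ-+ -[1+ m ] -[1+ n ] = trans
    (cong (λ k → - fromℕ k) (sym (ℕP.+-suc (suc m) n)))
    (trans (cong -_ (fromℕ-+ (suc m) (suc n))) (sym (-‿+-comm _ _)))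

  fromℤ-+* : ∀ m j → fromℤ (+ m ℤ.* j) ≡ fromℕ m * fromℤ j
  fromℤ-+* m (+ n) = trans (cong fromℤ (sym (ℤP.pos-* m n))) (fromℕ-* m n)
  fromℤ-+* m -[1+ n ] = begin
    fromℤ (+ m ℤ.* -[1+ n ])        ≡⟨ cong fromℤ (sym (ℤP.neg-distribʳ-* (+ m) (+ suc n))) ⟩
    fromℤ (ℤ.- (+ m ℤ.* + suc n))   ≡⟨ fromℤ-neg (+ m ℤ.* + suc n) ⟩
    - fromℤ (+ m ℤ.* + suc n)       ≡⟨ cong -_ (fromℤ-+* m (+ suc n)) ⟩
    - (fromℕ m * fromℕ (suc n))     ≡⟨ -‿distribʳ-* _ _ ⟩
    fromℕ m * (- fromℕ (suc n))     ∎
    where open ≡-Reasoning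

  fromℤ-* : ∀ i j → fromℤ (i ℤ.* j) ≡ fromℤ i * fromℤ j
  fromℤ-* (+ m)    j = fromℤ-+* m j
  fromℤ-* -[1+ m ] j = begin
    fromℤ (-[1+ m ] ℤ.* j)          ≡⟨ cong fromℤ (sym (ℤP.neg-distribˡ-* (+ suc m) j)) ⟩
    fromℤ (ℤ.- (+ suc m ℤ.* j))     ≡⟨ fromℤ-neg (+ suc m ℤ.* j) ⟩
    - fromℤ (+ suc m ℤ.* j)         ≡⟨ cong -_ (fromℤ-+* (suc m) j) ⟩
    - (fromℕ (suc m) * fromℤ j)     ≡⟨ -‿distribˡ-* _ _ ⟩
    (- fromℕ (suc m)) * fromℤ j     ∎
    where open ≡-Reasoning

  almostRing : AlmostCommutativeRing _ _
  almostRing = fromCommutativeRing ring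

  -- Integer coefficients have an equality test that computes, so the ring solver can recognise
  -- cancelling terms although the field is abstract.
  ℤ-coefficients : CommutativeRing.rawRing ℤP.+-*-commutativeRing -Raw-AlmostCommutative⟶ almostRing
  ℤ-coefficients = record
    { ⟦_⟧    = fromℤ
    ; +-homo = fromℤ-+
    ; *-homo = fromℤ-*
    ; -‿homo = fromℤ-neg
    ; 0-homo = refl
    ; 1-homo = +-identityʳ 1#
    }

  fromℤ-≟ : ∀ i j → Maybe (fromℤ i ≡ fromℤ j)
  fromℤ-≟ i j with i ℤP.≟ j
  ... | yes i≡j = just (cong fromℤ i≡j)
  ... | no _    = nothing

  module Solver = RingSolver
    (CommutativeRing.rawRing ℤP.+-*-commutativeRing) almostRing ℤ-coefficients fromℤ-≟

-- Orientations and convex combinations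

module PlaneLemmas (F : OrderedField) where
  open OrderedField F
  open Geometry F
  open FieldLemmas F public
  open IsStrictTotalOrder isStrictTotalOrder public using (compare) renaming (trans to <-trans; irrefl to <-irrefl)
  open Solver

  Pos : Carrier → Set
  Pos x = 0# < x

  pos⇒≢0 : ∀ {x} → Pos x → x ≢ 0#
  pos⇒≢0 p refl = <-irrefl refl p

  ≡-pos : ∀ {x y} → x ≡ y → Pos x → Pos y
  ≡-pos = subst Pos

  +-pos : ∀ {x y} → Pos x → Pos y → Pos (x + y)
  +-pos {x} {y} p q = <-trans q (subst (_< x + y) (+-identityˡ y) (+-mono-< y p))

  neg⇒pos : ∀ {x} → x < 0# → Pos (- x)
  neg⇒pos {x} p = subst₂ _<_ (-‿inverseʳ x) (+-identityˡ (- x)) (+-mono-< (- x) p)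

  pos-asym : ∀ {x} → Pos x → ¬ Pos (- x)
  pos-asym {x} p q = <-irrefl refl (≡-pos (-‿inverseʳ x) (+-pos p q))

  pos∨neg : ∀ {x} → x ≢ 0# → Pos x ⊎ Pos (- x)
  pos∨neg {x} x≢0 with compare 0# x
  ... | tri< p _ _  = inj₁ p
  ... | tri≈ _ e _  = contradiction (sym e) x≢0
  ... | tri> _ _ p  = inj₂ (neg⇒pos p)

  0≤+ : ∀ {x y} → 0# ≤ x → 0# ≤ y → 0# ≤ (x + y)
  0≤+ (inj₁ p)    (inj₁ q)    = inj₁ (+-pos p q)
  0≤+ {x} (inj₁ p) (inj₂ refl) = inj₁ (≡-pos (sym (+-identityʳ x)) p)
  0≤+ {x} {y} (inj₂ refl) q   = subst (0# ≤_) (sym (+-identityˡ y)) q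

  0≤* : ∀ {x y} → 0# ≤ x → 0# ≤ y → 0# ≤ (x * y)
  0≤* (inj₁ p)        (inj₁ q)    = inj₁ (*-pos p q)
  0≤* {x} (inj₁ p)    (inj₂ refl) = inj₂ (sym (zeroʳ x))
  0≤* {x} {y} (inj₂ refl) q       = inj₂ (sym (zeroˡ y))

  ¬pos-neg : ∀ {x} → 0# ≤ x → ¬ Pos (- x)
  ¬pos-neg (inj₁ p)    q = pos-asym p q
  ¬pos-neg (inj₂ refl) q = <-irrefl (sym -0#≈0#) q

  0≤⇒pos : ∀ {x} → 0# ≤ x → x ≢ 0# → Pos x
  0≤⇒pos (inj₁ p)    _   = p
  0≤⇒pos (inj₂ refl) x≢0 = contradiction refl x≢0

  abstract
    neg*neg : ∀ x y → (- x) * (- y) ≡ x * y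
    neg*neg = solve 2 (λ x y → (:- x) :* (:- y) := x :* y) refl

  square-nonneg : ∀ x → 0# ≤ (x * x)
  square-nonneg x with compare 0# x
  ... | tri< p _ _    = inj₁ (*-pos p p)
  ... | tri≈ _ refl _ = inj₂ (sym (zeroˡ 0#))
  ... | tri> _ _ p    = inj₁ (≡-pos (neg*neg x x) (*-pos (neg⇒pos p) (neg⇒pos p)))

  square-pos : ∀ {x} → x ≢ 0# → Pos (x * x)
  square-pos x≢0 with pos∨neg x≢0
  ... | inj₁ p = *-pos p p
  ... | inj₂ p = ≡-pos (neg*neg _ _) (*-pos p p)

  0<1 : Pos 1#
  0<1 = ≡-pos (*-identityˡ 1#) (square-pos (0≢1 ∘ sym))

  *-pos-cancelˡ : ∀ {x y} → Pos x → Pos (x * y) → Pos y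
  *-pos-cancelˡ {x} {y} p q with compare 0# y
  ... | tri< r _ _    = r
  ... | tri≈ _ refl _ = contradiction (sym (zeroʳ x)) (λ e → <-irrefl e q)
  ... | tri> _ _ r    = ⊥-elim (pos-asym q (≡-pos (sym (-‿distribʳ-* x y)) (*-pos p (neg⇒pos r))))

  *-pos-cancelʳ : ∀ {x y} → Pos y → Pos (x * y) → Pos x
  *-pos-cancelʳ q r = *-pos-cancelˡ q (≡-pos (*-comm _ _) r)

  pos-inverse : ∀ {x} → Pos x → ∃ λ y → x * y ≡ 1# × Pos y
  pos-inverse {x} p with inverse x (pos⇒≢0 p)
  ... | y , e = y , e , *-pos-cancelˡ p (≡-pos (sym e) 0<1)

  pos*≡0 : ∀ {x y} → Pos y → x * y ≡ 0# → 0# ≤ x → x ≡ 0#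
  pos*≡0 q e (inj₁ p) = contradiction (*-pos p q) (λ r → <-irrefl (sym e) r)
  pos*≡0 q e (inj₂ p) = sym p

  :orient : ∀ {n} (ax ay bx by cx cy : Polynomial n) → Polynomial n
  :orient ax ay bx by cx cy = ((bx :- ax) :* (cy :- ay)) :- ((by :- ay) :* (cx :- ax))

  abstract
    orient-cyc : ∀ a b c → orient a b c ≡ orient b c a
    orient-cyc (ax , ay) (bx , by) (cx , cy) = solve 6 (λ ax ay bx by cx cy →
      :orient ax ay bx by cx cy := :orient bx by cx cy ax ay) refl ax ay bx by cx cy

    orient-swap : ∀ a b c → - orient a b c ≡ orient b a c
    orient-swap (ax , ay) (bx , by) (cx , cy) = solve 6 (λ ax ay bx by cx cy →
      :- (:orient ax ay bx by cx cy) := :orient bx by ax ay cx cy) refl ax ay bx by cx cy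

    orient-aab : ∀ a b → orient a a b ≡ 0#
    orient-aab (ax , ay) (bx , by) = solve 4 (λ ax ay bx by →
      :orient ax ay ax ay bx by := con (ℤ.+ 0)) refl ax ay bx by

  orient-aba : ∀ a b → orient a b a ≡ 0#
  orient-aba a b = trans (sym (orient-cyc a a b)) (orient-aab a b)

  orient-abb : ∀ a b → orient a b b ≡ 0#
  orient-abb a b = trans (orient-cyc a b b) (orient-aab b a)

  abstract
    -- Signed areas: the triangles that `p` forms with the three sides add up to the whole. Divided
    -- by `orient a b c` they are the barycentric coordinates of `p`, as the next two identities
    -- state for each coordinate.
    orient-sum : ∀ a b c p → orient a b p + orient b c p + orient c a p ≡ orient a b c
    orient-sum (ax , ay) (bx , by) (cx , cy) (px , py) = solve 8 (λ ax ay bx by cx cy px py →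
      :orient ax ay bx by px py :+ :orient bx by cx cy px py :+ :orient cx cy ax ay px py
        := :orient ax ay bx by cx cy) refl ax ay bx by cx cy px py

    barycentric-x : ∀ a b c p →
      orient b c p * proj₁ a + orient c a p * proj₁ b + orient a b p * proj₁ c ≡ orient a b c * proj₁ p
    barycentric-x (ax , ay) (bx , by) (cx , cy) (px , py) = solve 8 (λ ax ay bx by cx cy px py →
      :orient bx by cx cy px py :* ax :+ :orient cx cy ax ay px py :* bx :+ :orient ax ay bx by px py :* cx
        := :orient ax ay bx by cx cy :* px) refl ax ay bx by cx cy px py

    barycentric-y : ∀ a b c p →
      orient b c p * proj₂ a + orient c a p * proj₂ b + orient a b p * proj₂ c ≡ orient a b c * proj₂ p
    barycentric-y (ax , ay) (bx , by) (cx , cy) (px , py) = solve 8 (λ ax ay bx by cx cy px py →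
      :orient bx by cx cy px py :* ay :+ :orient cx cy ax ay px py :* by :+ :orient ax ay bx by px py :* cy
        := :orient ax ay bx by cx cy :* py) refl ax ay bx by cx cy px py

    -- Displays `orient a b` as an affine function of the last point, which is why it commutes with
    -- convex combinations in `conv-orient`.
    orient-affine : ∀ a b p → orient a b p
      ≡ (((proj₁ a * proj₂ b) - (proj₂ a * proj₁ b)) + (proj₂ a - proj₂ b) * proj₁ p) + (proj₁ b - proj₁ a) * proj₂ p
    orient-affine (ax , ay) (bx , by) (px , py) = solve 6 (λ ax ay bx by px py →
      :orient ax ay bx by px py
        := ((ax :* by :- ay :* bx) :+ (ay :- by) :* px) :+ (bx :- ax) :* py)
      refl ax ay bx by px py

    +-interchange : ∀ a b c d → a + b + (c + d) ≡ a + c + (b + d)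
    +-interchange = solve 4 (λ a b c d → a :+ b :+ (c :+ d) := a :+ c :+ (b :+ d)) refl

    +-rotate : ∀ x y z → x + y + z ≡ z + x + y
    +-rotate = solve 3 (λ x y z → x :+ y :+ z := z :+ x :+ y) refl

    *-swapʳ : ∀ x y z → x * y * z ≡ x * z * y
    *-swapʳ = solve 3 (λ x y z → x :* y :* z := x :* z :* y) refl

    distrib-affine : ∀ w c α x β y → w * ((c + α * x) + β * y) ≡ (w * c + (w * x) * α) + (w * y) * β
    distrib-affine = solve 6 (λ w c α x β y →
      w :* ((c :+ α :* x) :+ β :* y) := (w :* c :+ (w :* x) :* α) :+ (w :* y) :* β) refl

    distrib-weights : ∀ d e h u v t r g →
      ((d * u + e * v + h * t) * r) * g ≡ (d * (u * g) + e * (v * g) + h * (t * g)) * r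
    distrib-weights = solve 8 (λ d e h u v t r g →
      ((d :* u :+ e :* v :+ h :* t) :* r) :* g := (d :* (u :* g) :+ e :* (v :* g) :+ h :* (t :* g)) :* r) refl

  sumF-cong : ∀ {k} {f g : Fin k → Carrier} → (∀ i → f i ≡ g i) → sumF f ≡ sumF g
  sumF-cong {zero}  e = refl
  sumF-cong {suc k} e = cong₂ _+_ (e zero) (sumF-cong (e ∘ suc))

  sumF-+ : ∀ {k} (f g : Fin k → Carrier) → sumF (λ i → f i + g i) ≡ sumF f + sumF g
  sumF-+ {zero}  f g = sym (+-identityˡ 0#)
  sumF-+ {suc k} f g = trans (cong (λ x → f zero + g zero + x) (sumF-+ (f ∘ suc) (g ∘ suc)))
    (+-interchange _ _ _ _)

  sumF-* : ∀ {k} (f : Fin k → Carrier) c → sumF (λ i → f i * c) ≡ sumF f * c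
  sumF-* {zero}  f c = sym (zeroˡ c)
  sumF-* {suc k} f c = trans (cong (λ x → f zero * c + x) (sumF-* (f ∘ suc) c)) (sym (distribʳ c _ _))

  sumF-nonneg : ∀ {k} {f : Fin k → Carrier} → (∀ i → 0# ≤ f i) → 0# ≤ sumF f
  sumF-nonneg {zero}  h = inj₂ refl
  sumF-nonneg {suc k} h = 0≤+ (h zero) (sumF-nonneg (h ∘ suc))

  0≤+≡0 : ∀ {x y} → 0# ≤ x → 0# ≤ y → x + y ≡ 0# → x ≡ 0# × y ≡ 0#
  0≤+≡0 {x} {y} (inj₁ p) q e = contradiction e (pos⇒≢0 (sum q))
    where
    sum : 0# ≤ y → Pos (x + y)
    sum (inj₁ q)    = +-pos p q
    sum (inj₂ refl) = ≡-pos (sym (+-identityʳ x)) p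
  0≤+≡0 (inj₂ refl) q e = refl , trans (sym (+-identityˡ _)) e

  sumF-nonneg-≡0 : ∀ {k} {f : Fin k → Carrier} → (∀ i → 0# ≤ f i) → sumF f ≡ 0# → ∀ i → f i ≡ 0#
  sumF-nonneg-≡0 h e zero    = proj₁ (0≤+≡0 (h zero) (sumF-nonneg (h ∘ suc)) e)
  sumF-nonneg-≡0 h e (suc i) = sumF-nonneg-≡0 (h ∘ suc) (proj₂ (0≤+≡0 (h zero) (sumF-nonneg (h ∘ suc)) e)) i

  sumF-0 : ∀ {k} {f : Fin k → Carrier} → (∀ i → f i ≡ 0#) → sumF f ≡ 0#
  sumF-0 {zero}  h = refl
  sumF-0 {suc k} h = trans (cong₂ _+_ (h zero) (sumF-0 (h ∘ suc))) (+-identityˡ 0#)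

  sumF-single : ∀ {k} {f : Fin k → Carrier} s → (∀ i → i ≢ s → f i ≡ 0#) → sumF f ≡ f s
  sumF-single zero h = trans (cong (λ x → _ + x) (sumF-0 (λ i → h (suc i) λ ()))) (+-identityʳ _)
  sumF-single (suc s) h = trans
    (cong₂ _+_ (h zero λ ()) (sumF-single s λ i i≢s → h (suc i) (i≢s ∘ FinP.suc-injective))) (+-identityˡ _)

  module _ {k} {S : Fin k → Set} {f : Fin k → Point} {p : Point} where

    conv-orient : (c : InConv S f p) → ∀ a b → sumF (λ i → proj₁ c i * orient a b (f i)) ≡ orient a b p
    conv-orient (w , _ , _ , Σw , Σx , Σy) a b = begin
      sumF (λ i → w i * orient a b (f i))
        ≡⟨ sumF-cong (λ i → trans (cong (λ x → w i * x) (orient-affine a b (f i)))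
             (distrib-affine (w i) C A _ B _)) ⟩
      sumF (λ i → (w i * C + (w i * proj₁ (f i)) * A) + (w i * proj₂ (f i)) * B)
        ≡⟨ trans (sumF-+ {k} _ _) (cong (_+ sumF (λ i → (w i * proj₂ (f i)) * B)) (sumF-+ {k} _ _)) ⟩
      (sumF (λ i → w i * C) + sumF (λ i → (w i * proj₁ (f i)) * A)) + sumF (λ i → (w i * proj₂ (f i)) * B)
        ≡⟨ cong₂ _+_ (cong₂ _+_ (trans (sumF-* w C) (trans (cong (_* C) Σw) (*-identityˡ C)))
             (trans (sumF-* {k} _ A) (trans (cong (_* A) Σx) (*-comm _ A))))
             (trans (sumF-* {k} _ B) (trans (cong (_* B) Σy) (*-comm _ B))) ⟩
      (C + A * proj₁ p) + B * proj₂ p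
        ≡⟨ sym (orient-affine a b p) ⟩
      orient a b p ∎
      where
      open ≡-Reasoning
      A = proj₂ a - proj₂ b
      B = proj₁ b - proj₁ a
      C = (proj₁ a * proj₂ b) - (proj₂ a * proj₁ b)

    -- Membership in `S` need not be decidable, but the sign of `g i` is. A negative value refutes
    -- `S i`, and then the weight is zero; `weight-vanishes` argues in the same way.
    weighted-nonneg : (c : InConv S f p) (g : Fin k → Carrier) → (∀ i → S i → 0# ≤ g i) → ∀ i → 0# ≤ (proj₁ c i * g i)
    weighted-nonneg (w , w0 , w≥0 , _) g h i with w≥0 i | compare 0# (g i)
    ... | _      | tri< q _ _ = 0≤* (w≥0 i) (inj₁ q)
    ... | _      | tri≈ _ q _ = 0≤* (w≥0 i) (inj₂ q)
    ... | inj₂ e | tri> _ _ q = inj₂ (sym (trans (cong (_* g i) (sym e)) (zeroˡ _)))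
    ... | inj₁ r | tri> _ _ q = contradiction (w0 i λ s → ¬pos-neg (h i s) (neg⇒pos q)) (pos⇒≢0 r)

    conv-nonneg : InConv S f p → ∀ a b → (∀ i → S i → 0# ≤ orient a b (f i)) → 0# ≤ orient a b p
    conv-nonneg c a b h = subst (0# ≤_) (conv-orient c a b) (sumF-nonneg (weighted-nonneg c _ h))

    weight-vanishes : (c : InConv S f p) (g : Fin k → Carrier) → sumF (λ i → proj₁ c i * g i) ≡ 0# →
      (∀ i → S i → 0# ≤ g i) → ∀ j → (S j → Pos (g j)) → proj₁ c j ≡ 0#
    weight-vanishes c@(w , w0 , w≥0 , _) g Σ≡0 h j pos with compare 0# (g j)
    ... | tri< q _ _  = pos*≡0 q (sumF-nonneg-≡0 (weighted-nonneg c g h) Σ≡0 j) (w≥0 j)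
    ... | tri≈ ¬q _ _ = w0 j (¬q ∘ pos)
    ... | tri> ¬q _ _ = w0 j (¬q ∘ pos)

    conv-pos : InConv S f p → ∀ a b → (∀ i → S i → Pos (orient a b (f i))) → Pos (orient a b p)
    conv-pos c@(w , _ , _ , Σw , _) a b h = 0≤⇒pos (conv-nonneg c a b (λ i → inj₁ ∘ h i)) λ e →
      0≢1 (trans (sym (sumF-0 (λ j → weight-vanishes c _ (trans (conv-orient c a b) e) (λ i → inj₁ ∘ h i) j (h j)))) Σw)

    -- The line through `a` and `b` supports the set and touches it at most in `f s`. As `p` lies on
    -- it, every other weight vanishes.
    conv-vertex : InConv S f p → ∀ a b s → orient a b p ≡ 0# → orient a b (f s) ≡ 0# →
      (∀ j → S j → j ≡ s ⊎ Pos (orient a b (f j))) → p ≡ f s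
    conv-vertex c@(w , w0 , w≥0 , Σw , Σx , Σy) a b s p-on s-on h = cong₂ _,_ (coord Σx) (coord Σy)
      where
      nonneg : ∀ j → S j → 0# ≤ orient a b (f j)
      nonneg j sj with h j sj
      ... | inj₁ refl = inj₂ (sym s-on)
      ... | inj₂ q    = inj₁ q

      wj≡0 : ∀ j → j ≢ s → w j ≡ 0#
      wj≡0 j j≢s = weight-vanishes c _ (trans (conv-orient c a b) p-on) nonneg j
        λ sj → Sum.[ (λ e → contradiction e j≢s) , (λ q → q) ] (h j sj)

      ws≡1 : w s ≡ 1#
      ws≡1 = trans (sym (sumF-single s wj≡0)) Σw

      coord : ∀ {g : Fin k → Carrier} {x} → sumF (λ i → w i * g i) ≡ x → x ≡ g s
      coord {g} e = trans (sym e) (trans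
        (sumF-single s λ i i≢s → trans (cong (_* g i) (wj≡0 i i≢s)) (zeroˡ _))
        (trans (cong (_* g s) ws≡1) (*-identityˡ _)))

  -- Strictly inside a counterclockwise triangle; that `a`, `b`, `c` are counterclockwise is implied
  -- by summing the three areas.
  InTri : Point → Point → Point → Point → Set
  InTri p a b c = Pos (orient a b p) × Pos (orient b c p) × Pos (orient c a p)

  inTri-cyc : ∀ {p a b c} → InTri p a b c → InTri p b c a
  inTri-cyc (x , y , z) = y , z , x

  inTri-≡ : ∀ {p a b c p' a' b' c'} → p ≡ p' → a ≡ a' → b ≡ b' → c ≡ c' → InTri p a b c → InTri p' a' b' c'
  inTri-≡ refl refl refl refl s = s

  inTri⇒orient : ∀ {p a b c} → InTri p a b c → Pos (orient a b c)
  inTri⇒orient {p} {a} {b} {c} (x , y , z) = ≡-pos (orient-sum a b c p) (+-pos (+-pos x y) z)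

  inTri⇒conv : ∀ {k} (f : Fin k → Point) {p} i j l → InTri p (f i) (f j) (f l) → InConv (Tri i j l) f p
  inTri⇒conv {k} f {p} i j l t@(x , y , z) =
    w , support , nonneg , Σw , Σc proj₁ (barycentric-x _ _ _ p) , Σc proj₂ (barycentric-y _ _ _ p)
    where
    a b c : Point
    a = f i
    b = f j
    c = f l

    inv = pos-inverse (inTri⇒orient t)
    r = proj₁ inv

    δ : Fin k → Fin k → Carrier
    δ s n with n FinP.≟ s
    ... | yes _ = 1#
    ... | no _  = 0#

    δ-self : ∀ s → δ s s ≡ 1#
    δ-self s with s FinP.≟ s
    ... | yes _ = refl
    ... | no ¬e = contradiction refl ¬e

    δ-other : ∀ {s n} → n ≢ s → δ s n ≡ 0#
    δ-other {s} {n} n≢s with n FinP.≟ s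
    ... | yes e = contradiction e n≢s
    ... | no _  = refl

    δ≥0 : ∀ s n → 0# ≤ δ s n
    δ≥0 s n with n FinP.≟ s
    ... | yes _ = inj₁ 0<1
    ... | no _  = inj₂ refl

    -- Barycentric coordinates of `p`, spread over all indices by indicator functions so that each
    -- sum splits into three one-term sums.
    w : Fin k → Carrier
    w n = (δ i n * orient b c p + δ j n * orient c a p + δ l n * orient a b p) * r

    support : ∀ n → ¬ Tri i j l n → w n ≡ 0#
    support n ¬t = trans (cong (_* r) (trans (cong₂ _+_ (trans (cong₂ _+_
      (zero* (¬t ∘ inj₁)) (zero* (¬t ∘ inj₂ ∘ inj₁))) (+-identityˡ 0#)) (zero* (¬t ∘ inj₂ ∘ inj₂))) (+-identityˡ 0#))) (zeroˡ r)
      where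
      zero* : ∀ {s y} → n ≢ s → δ s n * y ≡ 0#
      zero* {s} {y} n≢s = trans (cong (_* y) (δ-other n≢s)) (zeroˡ y)

    nonneg : ∀ n → 0# ≤ w n
    nonneg n = 0≤* (0≤+ (0≤+ (0≤* (δ≥0 i n) (inj₁ y)) (0≤* (δ≥0 j n) (inj₁ z))) (0≤* (δ≥0 l n) (inj₁ x)))
      (inj₁ (proj₂ (proj₂ inv)))

    Σδ : ∀ s (g : Fin k → Carrier) → sumF (λ n → δ s n * g n) ≡ g s
    Σδ s g = trans (sumF-single s (λ n n≢s → trans (cong (_* g n) (δ-other n≢s)) (zeroˡ _)))
      (trans (cong (_* g s) (δ-self s)) (*-identityˡ _))

    expand : ∀ (g : Fin k → Carrier) →
      sumF (λ n → w n * g n) ≡ (orient b c p * g i + orient c a p * g j + orient a b p * g l) * r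
    expand g = begin
      sumF (λ n → w n * g n)
        ≡⟨ sumF-cong (λ n → distrib-weights (δ i n) (δ j n) (δ l n) _ _ _ r (g n)) ⟩
      sumF (λ n → (δ i n * (orient b c p * g n) + δ j n * (orient c a p * g n) + δ l n * (orient a b p * g n)) * r)
        ≡⟨ trans (sumF-* {k} _ r) (cong (_* r) (trans (sumF-+ {k} _ _) (cong₂ _+_ (trans (sumF-+ {k} _ _)
             (cong₂ _+_ (Σδ i _) (Σδ j _))) (Σδ l _)))) ⟩
      (orient b c p * g i + orient c a p * g j + orient a b p * g l) * r ∎
      where open ≡-Reasoning

    Σw : sumF w ≡ 1#
    Σw = begin
      sumF w                 ≡⟨ sumF-cong (λ n → sym (trans (*-comm _ _) (*-identityˡ (w n)))) ⟩
      sumF (λ n → w n * 1#)  ≡⟨ expand (λ _ → 1#) ⟩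
      (orient b c p * 1# + orient c a p * 1# + orient a b p * 1#) * r
        ≡⟨ cong (_* r) (trans (cong₂ _+_ (cong₂ _+_ (x*1 _) (x*1 _)) (x*1 _))
             (trans (+-rotate (orient b c p) (orient c a p) (orient a b p))
             (orient-sum a b c p))) ⟩
      orient a b c * r       ≡⟨ proj₁ (proj₂ inv) ⟩
      1#                     ∎
      where
      open ≡-Reasoning
      x*1 : ∀ x → x * 1# ≡ x
      x*1 x = trans (*-comm x 1#) (*-identityˡ x)

    Σc : ∀ (π : Point → Carrier) →
      orient b c p * π a + orient c a p * π b + orient a b p * π c ≡ orient a b c * π p →
      sumF (λ n → w n * π (f n)) ≡ π p
    Σc π e = begin
      sumF (λ n → w n * π (f n)) ≡⟨ expand (π ∘ f) ⟩
      (orient b c p * π a + orient c a p * π b + orient a b p * π c) * r ≡⟨ cong (_* r) e ⟩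
      orient a b c * π p * r ≡⟨ *-swapʳ _ _ _ ⟩
      orient a b c * r * π p ≡⟨ cong (_* π p) (proj₁ (proj₂ inv)) ⟩
      1# * π p               ≡⟨ *-identityˡ _ ⟩
      π p ∎
      where open ≡-Reasoning

  conv-mono : ∀ {k} {S T : Fin k → Set} {f p} → (∀ i → S i → T i) → InConv S f p → InConv T f p
  conv-mono S⊆T (w , w0 , rest) = w , (λ i ¬t → w0 i (¬t ∘ S⊆T i)) , rest

  conv-cong : ∀ {k} {S : Fin k → Set} {f g : Fin k → Point} {p q} → (∀ i → f i ≡ g i) → p ≡ q → InConv S f p → InConv S g q
  conv-cong e refl (w , w0 , w≥0 , Σw , Σx , Σy) = w , w0 , w≥0 , Σw ,
    trans (sumF-cong λ i → cong (λ p → w i * proj₁ p) (sym (e i))) Σx ,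
    trans (sumF-cong λ i → cong (λ p → w i * proj₂ p) (sym (e i))) Σy

  weaken : ∀ {A : Set} {a x i : A} {is} → i ∈ a ∷ is → i ∈ a ∷ x ∷ is
  weaken (here e)  = here e
  weaken (there m) = there (there m)

  -- A constructive form of Carathéodory's theorem in the plane. The directions from `p` are
  -- searched for a clockwise-most one, and the search fails only when three of them surround `p`.
  -- An extreme direction means that `p` is not in the hull unless it equals that point.
  extreme∨inTri : ∀ {k} (f : Fin k → Point) p i₀ (is : List (Fin k)) →
    (∀ i j → i ∈ i₀ ∷ is → j ∈ i₀ ∷ is → i ≢ j → orient p (f i) (f j) ≢ 0#) →
    (∃ λ i → ∃₂ λ j l → i ∈ i₀ ∷ is × j ∈ i₀ ∷ is × l ∈ i₀ ∷ is × InTri p (f i) (f j) (f l)) ⊎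
    (∃ λ s → s ∈ i₀ ∷ is × (∀ j → j ∈ i₀ ∷ is → j ≡ s ⊎ Pos (orient p (f s) (f j))))
  extreme∨inTri f p i₀ [] gp = inj₂ (i₀ , here refl , λ { j (here e) → inj₁ e })
  extreme∨inTri {k} f p i₀ (x ∷ is) gp with extreme∨inTri f p i₀ is (λ i j i∈ j∈ → gp i j (weaken i∈) (weaken j∈))
  ... | inj₁ (i , j , l , i∈ , j∈ , l∈ , t) = inj₁ (i , j , l , weaken i∈ , weaken j∈ , weaken l∈ , t)
  ... | inj₂ (s , s∈ , h) = goal
    where
    new∨old : ∀ {j} → j ∈ i₀ ∷ x ∷ is → j ≡ x ⊎ j ∈ i₀ ∷ is
    new∨old (here e)          = inj₂ (here e)
    new∨old (there (here e))  = inj₁ e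
    new∨old (there (there m)) = inj₂ (there m)

    x∈ : x ∈ i₀ ∷ x ∷ is
    x∈ = there (here refl)

    Goal : Set
    Goal = (∃ λ i → ∃₂ λ j l → i ∈ i₀ ∷ x ∷ is × j ∈ i₀ ∷ x ∷ is × l ∈ i₀ ∷ x ∷ is × InTri p (f i) (f j) (f l)) ⊎
      (∃ λ s → s ∈ i₀ ∷ x ∷ is × (∀ j → j ∈ i₀ ∷ x ∷ is → j ≡ s ⊎ Pos (orient p (f s) (f j))))

    side : ∀ {i j} → i ∈ i₀ ∷ x ∷ is → j ∈ i₀ ∷ x ∷ is → i ≢ j → Pos (orient p (f i) (f j)) ⊎ Pos (orient p (f j) (f i))
    side {i} {j} i∈ j∈ i≢j with pos∨neg (gp i j i∈ j∈ i≢j)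
    ... | inj₁ q = inj₁ q
    ... | inj₂ q = inj₂ (≡-pos (trans (orient-swap p (f i) (f j)) (orient-cyc _ _ _)) q)

    cyc : ∀ {a b} → Pos (orient p a b) → Pos (orient a b p)
    cyc = ≡-pos (orient-cyc _ _ _)

    -- If x lies to the right of p → s, then x replaces s, unless some j to the left of s is not to the left
    -- of x, in which case p lies inside the triangle s, j, x.
    scan : x ≢ s → Pos (orient p (f x) (f s)) → ∀ js → (∀ {j} → j ∈ js → j ∈ i₀ ∷ is) →
      Goal ⊎ (∀ j → j ∈ js → j ≡ x ⊎ Pos (orient p (f x) (f j)))
    scan x≢s q [] _ = inj₂ (λ _ ())
    scan x≢s q (j ∷ js) js⊆ with scan x≢s q js (js⊆ ∘ there)
    ... | inj₁ g = inj₁ g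
    ... | inj₂ r with j FinP.≟ x
    ...   | yes e = inj₂ λ { j' (here refl) → inj₁ e ; j' (there m) → r j' m }
    ...   | no j≢x with side x∈ (weaken (js⊆ (here refl))) (j≢x ∘ sym)
    ...     | inj₁ u = inj₂ λ { j' (here refl) → inj₂ u ; j' (there m) → r j' m }
    ...     | inj₂ u with h j (js⊆ (here refl))
    ...       | inj₁ refl = inj₂ λ { j' (here refl) → inj₂ q ; j' (there m) → r j' m }
    ...       | inj₂ v = inj₁ (inj₁ (s , j , x , weaken s∈ , weaken (js⊆ (here refl)) , x∈ , cyc v , cyc u , cyc q))

    goal : Goal
    goal with x FinP.≟ s
    ... | yes refl = inj₂ (s , x∈ , λ j m → Sum.[ inj₁ , h j ] (new∨old m))
    ... | no x≢s with side x∈ (weaken s∈) x≢s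
    ...   | inj₂ q = inj₂ (s , weaken s∈ , λ j m → Sum.[ (λ { refl → inj₂ q }) , h j ] (new∨old m))
    ...   | inj₁ q with scan x≢s q (i₀ ∷ is) (λ m → m)
    ...     | inj₁ g = g
    ...     | inj₂ r = inj₂ (x , x∈ , λ j m → Sum.[ inj₁ , r j ] (new∨old m))

-- Diagrams that represent a tree

threePaths-swap : ∀ {m} {G : Graph m} {b x y z} → ThreePaths G b x y z → ThreePaths G b y x z
threePaths-swap (p , q , r , P , Q , R , pq , pr , qr) = q , p , r , Q , P , R , (λ x i j → pq x j i) , qr , pr

threePaths-cyc : ∀ {m} {G : Graph m} {b x y z} → ThreePaths G b x y z → ThreePaths G b y z x
threePaths-cyc (p , q , r , P , Q , R , pq , pr , qr) =
  q , r , p , Q , R , P , qr , (λ x i j → pq x j i) , (λ x i j → pr x j i)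

module GoodLemmas (F : OrderedField) where
  open OrderedField F using (Carrier; 0#)
  open Geometry F
  open PlaneLemmas F

  tri-swap : ∀ {k} {i j l : Fin k} n → Tri i j l n → Tri j i l n
  tri-swap n (inj₁ e)        = inj₂ (inj₁ e)
  tri-swap n (inj₂ (inj₁ e)) = inj₁ e
  tri-swap n (inj₂ (inj₂ e)) = inj₂ (inj₂ e)

  tri-cyc : ∀ {k} {i j l : Fin k} n → Tri i j l n → Tri j l i n
  tri-cyc n (inj₁ e)        = inj₂ (inj₂ e)
  tri-cyc n (inj₂ (inj₁ e)) = inj₁ e
  tri-cyc n (inj₂ (inj₂ e)) = inj₂ (inj₁ e)

  cyc⁺ : ∀ {a b c} → Pos (orient a b c) → Pos (orient b c a)
  cyc⁺ {a} {b} {c} = ≡-pos (orient-cyc a b c)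

  pos-orient⇒≢ : ∀ {a b c} → Pos (orient a b c) → a ≢ b
  pos-orient⇒≢ {a} {c = c} q refl = pos⇒≢0 q (orient-aab a c)

  -- The invariant through which trees and point sets communicate. Orientation is part of it, since
  -- `Split` lists `x`, `y`, `z` in cyclic order.
  Good : {V : Set} → (V → Point) → V → Tree V → Set
  Good pos o t = ∀ {v x y z} → Split o t v x y z → InTri (pos v) (pos x) (pos y) (pos z)

  good-map : ∀ {V W : Set} (f : V → W) {pos : V → Point} {pos' : W → Point} → (∀ v → pos' (f v) ≡ pos v) →
    ∀ {o t} → Good pos o t → Good pos' (f o) (mapTree f t)
  good-map f {pos} {pos'} e {o} {t} good (split p m n k k∉) with ⊑-map⁻ f t p
  ... | v , l , r , q , refl , refl , refl with ∈-leaves-map⁻ f l m | ∈-leaves-map⁻ f r n | outside k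
    where
    outside : ∀ {z} → z ∈ f o ∷ leaves (mapTree f t) → ∃ λ z₀ → z₀ ∈ o ∷ leaves t × z ≡ f z₀
    outside (here refl) = o , here refl , refl
    outside (there k) with ∈-leaves-map⁻ f t k
    ... | z₀ , k' , e' = z₀ , there k' , e'
  ...   | x , m' , refl | y , n' , refl | z , k' , refl =
          inTri-≡ (sym (e v)) (sym (e x)) (sym (e y)) (sym (e z)) (good (split q m' n' k'
          λ i → k∉ (subst (f z ∈_) (sym (verts-map f (node v l r))) (∈-map⁺ f i))))

  module _ {m : ℕ} where
    private
      V = Fin m

    module _ {pos : V → Point} {o : V} {t : Tree V} (good : Good pos o t) (o∉ : o ∉ verts t) (σ : Simple t) where

      private
        module M = DecMembership (FinP._≟_ {m})

      split-orient : ∀ {v x y z} → Split o t v x y z → Pos (orient (pos x) (pos y) (pos z))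
      split-orient s = inTri⇒orient (good s)

      -- Up to rotation the three leaves form a `Split`, and its triangle is counterclockwise.
      -- Because `x` and `y` are consecutive, `z` never comes between them; its lowest common
      -- ancestor with the neighbour whose subtree it shares, or else the vertex between `x` and
      -- `y`, is the median.
      succ-left : ∀ {x y z} → Succ o t x y → z ∈ o ∷ leaves t → z ≢ x → z ≢ y → Pos (orient (pos x) (pos y) (pos z))
      succ-left start (here e) z≢x _ = contradiction e z≢x
      succ-left start (there m) _ z≢y with lca-first t m
      ... | inj₁ e = contradiction e z≢y
      ... | inj₂ (_ , _ , _ , p , a , b) = cyc⁺ (cyc⁺ (split-orient (split p a b (here refl) (o∉ ∘ ⊑-verts p))))
      succ-left close (here e) _ z≢y = contradiction e z≢y
      succ-left close (there m) z≢x _ with lca-last t m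
      ... | inj₁ e = contradiction e z≢x
      ... | inj₂ (_ , _ , _ , p , a , b) = cyc⁺ (split-orient (split p a b (here refl) (o∉ ∘ ⊑-verts p)))
      succ-left {z = z} (inner {v} {l} {r} p) m z≢x z≢y with z M.∈? verts (node v l r)
      ... | no z∉ = split-orient (split p (last∈leaves l) (first∈leaves r) m z∉)
      ... | yes n with ⊑-simple p σ | m
      ...   | _ | here refl = contradiction (⊑-verts p n) o∉
      ...   | node _ _ dis _ _ | there m with ∈-++⁻ (leaves l) (leaf-in-subtree σ p m n)
      ...     | inj₁ k with lca-last l k
      ...       | inj₁ e = contradiction e z≢x
      ...       | inj₂ (_ , _ , _ , q , a , b) = cyc⁺ (split-orient (split (⊑-trans q (⊑-trans (inl top) p)) a b
        (there (⊑-leaves p (∈-++⁺ʳ (leaves l) (first∈leaves r))))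
        (λ i → dis (⊑-verts q i) (leaves⊆verts r (first∈leaves r)))))
      succ-left {z = z} (inner {v} {l} {r} p) _ z≢x z≢y | yes n | node _ _ dis _ _ | there m | inj₂ k with lca-first r k
      ...       | inj₁ e = contradiction e z≢y
      ...       | inj₂ (_ , _ , _ , q , a , b) = cyc⁺ (cyc⁺ (split-orient (split (⊑-trans q (⊑-trans (inr top) p)) a b
        (there (⊑-leaves p (∈-++⁺ˡ (last∈leaves l))))
        (λ i → dis (leaves⊆verts l (last∈leaves l)) (⊑-verts q i)))))

      data Comp (v : V) (l r : Tree V) (x : V) : Set where
        inL : x ∈ leaves l → Comp v l r x
        inR : x ∈ leaves r → Comp v l r x
        out : x ∉ verts (node v l r) → Comp v l r x

      comp : ∀ {v l r x} → node v l r ⊑ t → x ∈ o ∷ leaves t → Comp v l r x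
      comp {v} {l} {r} p (here refl) = out (o∉ ∘ ⊑-verts p)
      comp {v} {l} {r} {x} p (there m) with x M.∈? verts (node v l r)
      ... | no x∉ = out x∉
      ... | yes n with ∈-++⁻ (leaves l) (leaf-in-subtree σ p m n)
      ...   | inj₁ k = inL k
      ...   | inj₂ k = inR k

      module _ {k : ℕ} (B : Fin k → V) (B∈ : ∀ i → B i ∈ o ∷ leaves t) {v l r} (p : node v l r ⊑ t) where

        private
          f : Fin k → Point
          f = pos ∘ B

          -- Seen from `v`, the branches follow one another counterclockwise as left, right, outside
          -- and left again: every leaf of one branch is followed within a half turn by every leaf
          -- of the next.
          Ahead : V → V → Set
          Ahead x y = Pos (orient (pos x) (pos y) (pos v))

          lr : ∀ {x y} → x ∈ leaves l → y ∈ leaves r → Ahead x y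
          lr m n = proj₁ (good (split p m n (here refl) (o∉ ∘ ⊑-verts p)))

          ro : ∀ {y z} → y ∈ leaves r → z ∈ o ∷ leaves t → z ∉ verts (node v l r) → Ahead y z
          ro n z∈ z∉ = proj₁ (proj₂ (good (split p (first∈leaves l) n z∈ z∉)))

          ol : ∀ {z x} → z ∈ o ∷ leaves t → z ∉ verts (node v l r) → x ∈ leaves l → Ahead z x
          ol z∈ z∉ m = proj₂ (proj₂ (good (split p m (first∈leaves r) z∈ z∉)))

          all-behind : ∀ {i j n e} → InConv (Tri i j n) f (pos v) →
            Ahead (B i) e → Ahead (B j) e → Ahead (B n) e → ⊥
          all-behind {i} {j} {n} {e} c pi pj pn = pos⇒≢0 (conv-pos c (pos e) (pos v) behind) (orient-abb (pos e) (pos v))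
            where
            behind : ∀ a → Tri i j n a → Pos (orient (pos e) (pos v) (f a))
            behind a (inj₁ refl)        = cyc⁺ pi
            behind a (inj₂ (inj₁ refl)) = cyc⁺ pj
            behind a (inj₂ (inj₂ refl)) = cyc⁺ pn

          -- The line runs through `v` and the corner `B n` in the next branch, so the triangle
          -- touches it in that corner only, and `v` would have to coincide with it.
          both-behind : ∀ {i j n} → InConv (Tri i j n) f (pos v) → Ahead (B i) (B n) → Ahead (B j) (B n) → ⊥
          both-behind {i} {j} {n} c pi pj = pos-orient⇒≢ (cyc⁺ pi)
            (sym (conv-vertex c (f n) (pos v) n (orient-abb _ _) (orient-aba _ _) behind))
            where
            behind : ∀ a → Tri i j n a → a ≡ n ⊎ Pos (orient (f n) (pos v) (f a))
            behind a (inj₁ refl)        = inj₂ (cyc⁺ pi)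
            behind a (inj₂ (inj₁ refl)) = inj₂ (cyc⁺ pj)
            behind a (inj₂ (inj₂ e))    = inj₁ e

          both-ahead : ∀ {i j n} → InConv (Tri i j n) f (pos v) → Ahead (B n) (B i) → Ahead (B n) (B j) → ⊥
          both-ahead {i} {j} {n} c pi pj = pos-orient⇒≢ (cyc⁺ (cyc⁺ pi))
            (conv-vertex c (pos v) (f n) n (orient-aba _ _) (orient-abb _ _) ahead)
            where
            ahead : ∀ a → Tri i j n a → a ≡ n ⊎ Pos (orient (pos v) (f n) (f a))
            ahead a (inj₁ refl)        = inj₂ (cyc⁺ (cyc⁺ pi))
            ahead a (inj₂ (inj₁ refl)) = inj₂ (cyc⁺ (cyc⁺ pj))
            ahead a (inj₂ (inj₂ e))    = inj₁ e

          C : V → Set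
          C = Comp v l r

        sameL : ∀ {i j n} → InConv (Tri i j n) f (pos v) → B i ∈ leaves l → B j ∈ leaves l → C (B n) → ⊥
        sameL c mi mj (inL mn) = all-behind c (lr mi (first∈leaves r)) (lr mj (first∈leaves r)) (lr mn (first∈leaves r))
        sameL c mi mj (inR mn) = both-behind c (lr mi mn) (lr mj mn)
        sameL c mi mj (out mn) = both-ahead c (ol (B∈ _) mn mi) (ol (B∈ _) mn mj)

        sameR : ∀ {i j n} → InConv (Tri i j n) f (pos v) → B i ∈ leaves r → B j ∈ leaves r → C (B n) → ⊥
        sameR c mi mj (inL mn) = both-ahead c (lr mn mi) (lr mn mj)
        sameR c mi mj (inR mn) = all-behind c (at-o mi) (at-o mj) (at-o mn)
          where
          at-o : ∀ {y} → y ∈ leaves r → Ahead y o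
          at-o m = ro m (here refl) (o∉ ∘ ⊑-verts p)
        sameR c mi mj (out mn) = both-behind c (ro mi (B∈ _) mn) (ro mj (B∈ _) mn)

        sameO : ∀ {i j n} → InConv (Tri i j n) f (pos v) →
          B i ∉ verts (node v l r) → B j ∉ verts (node v l r) → C (B n) → ⊥
        sameO c mi mj (inL mn) = both-behind c (ol (B∈ _) mi mn) (ol (B∈ _) mj mn)
        sameO c mi mj (inR mn) = both-ahead c (ro mn (B∈ _) mi) (ro mn (B∈ _) mj)
        sameO c mi mj (out mn) = all-behind c
          (ol (B∈ _) mi (first∈leaves l)) (ol (B∈ _) mj (first∈leaves l)) (ol (B∈ _) mn (first∈leaves l))

        -- Two corners in one branch are impossible whatever the third is, so each branch holds
        -- exactly one; the six arrangements are the permutations of a `Split`.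
        conv⇒median : (Q : V → V → V → Set) → (∀ {x y z} → Q x y z → Q y x z) → (∀ {x y z} → Q x y z → Q y z x) →
          (∀ {x y z} → Split o t v x y z → Q x y z) → ∀ {i j n} → InConv (Tri i j n) f (pos v) → Q (B i) (B j) (B n)
        conv⇒median Q swap cyc h {i} {j} {n} c = go (comp p (B∈ i)) (comp p (B∈ j)) (comp p (B∈ n))
          where
          c₁ = conv-mono tri-cyc c
          c₂ = conv-mono tri-cyc c₁
          s : ∀ {x y} a → x ∈ leaves l → y ∈ leaves r → B a ∉ verts (node v l r) → Q x y (B a)
          s a mx my mz = h (split p mx my (B∈ a) mz)
          go : C (B i) → C (B j) → C (B n) → Q (B i) (B j) (B n)
          go (inL a) (inL b) e       = ⊥-elim (sameL c a b e)
          go (inR a) (inR b) e       = ⊥-elim (sameR c a b e)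
          go (out a) (out b) e       = ⊥-elim (sameO c a b e)
          go (inL a) e       (inL b) = ⊥-elim (sameL c₂ b a e)
          go (inR a) e       (inR b) = ⊥-elim (sameR c₂ b a e)
          go (out a) e       (out b) = ⊥-elim (sameO c₂ b a e)
          go e       (inL a) (inL b) = ⊥-elim (sameL c₁ a b e)
          go e       (inR a) (inR b) = ⊥-elim (sameR c₁ a b e)
          go e       (out a) (out b) = ⊥-elim (sameO c₁ a b e)
          go (inL x) (inR y) (out z) = s n x y z
          go (inL x) (out z) (inR y) = swap (cyc (cyc (s j x y z)))
          go (inR y) (inL x) (out z) = swap (s n x y z)
          go (inR y) (out z) (inL x) = cyc (s j x y z)
          go (out z) (inL x) (inR y) = cyc (cyc (s i x y z))
          go (out z) (inR y) (inL x) = swap (cyc (s i x y z))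

third : ∀ {n} (i j : Fin (3 ℕ.+ n)) → ∃ λ k → k ≢ i × k ≢ j
third zero          zero          = suc zero , (λ ()) , (λ ())
third zero          (suc zero)    = suc (suc zero) , (λ ()) , (λ ())
third zero          (suc (suc _)) = suc zero , (λ ()) , (λ ())
third (suc zero)    zero          = suc (suc zero) , (λ ()) , (λ ())
third (suc (suc _)) zero          = suc zero , (λ ()) , (λ ())
third (suc _)       (suc _)       = zero , (λ ()) , (λ ())

module CharTreeLemmas (F : OrderedField) where
  open OrderedField F using (Carrier; 0#; _*_; *-pos)
  open Geometry F
  open PlaneLemmas F
  open GoodLemmas F

  module Coloured {d m : ℕ} {D : Diagram d} (φ : Pt D ⤖ Fin m) {G : Graph m} {o : Fin m} {t : Tree (Fin m)} (R : Rep G o t)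
    (black∈ : ∀ i → Bijection.to φ (inj₁ i) ∈ o ∷ leaves t) (white∈ : ∀ w → Bijection.to φ (inj₂ w) ∈ nodes t) where

    open Rep R using (fresh; simple)

    B : Fin (3 ℕ.+ d) → Fin m
    B i = Bijection.to φ (inj₁ i)

    W : Fin (1 ℕ.+ d) → Fin m
    W w = Bijection.to φ (inj₂ w)

    B-injective : ∀ {i j} → B i ≡ B j → i ≡ j
    B-injective e with Bijection.injective φ e
    ... | refl = refl

    W-injective : ∀ {i j} → W i ≡ W j → i ≡ j
    W-injective e with Bijection.injective φ e
    ... | refl = refl

    preimage : ∀ v → ∃ λ x → v ≡ Bijection.to φ x
    preimage v with Bijection.surjective φ v
    ... | x , e = x , sym (e refl)

    leaf∉nodes : ∀ {v} → v ∈ o ∷ leaves t → v ∉ nodes t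
    leaf∉nodes (here refl) n = fresh (nodes⊆verts t n)
    leaf∉nodes (there m)   n with ∈nodes⇒⊑ t n
    ... | _ , _ , p = node-not-leaf simple p m

    node-white : ∀ {v} → v ∈ nodes t → ∃ λ w → v ≡ W w
    node-white {v} n with preimage v
    ... | inj₂ w , e    = w , e
    ... | inj₁ i , refl = contradiction n (leaf∉nodes (black∈ i))

    leaf-black : ∀ {v} → v ∈ o ∷ leaves t → ∃ λ i → v ≡ B i
    leaf-black {v} n with preimage v
    ... | inj₁ i , e    = i , e
    ... | inj₂ w , refl = contradiction (white∈ w) (leaf∉nodes n)

  module FromGood {d m : ℕ} (D : Diagram d) (G : Graph m) (φ : Pt D ⤖ Fin m) {o : Fin m} {t : Tree (Fin m)} (R : Rep G o t)
    (pos : Fin m → Point) (pos-φ : ∀ x → pos (Bijection.to φ x) ≡ pt D x)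
    (black∈ : ∀ i → Bijection.to φ (inj₁ i) ∈ o ∷ leaves t) (white∈ : ∀ w → Bijection.to φ (inj₂ w) ∈ nodes t)
    (good : Good pos o t) where

    open Rep R using (fresh; simple)
    open RepLemmas R
    open Coloured {D = D} φ R black∈ white∈

    succ-orient : ∀ {i j k} → Succ o t (B i) (B j) → k ≢ i → k ≢ j → Pos (orient (black D i) (black D j) (black D k))
    succ-orient {i} {j} {k} s k≢i k≢j =
      subst₂ (λ a b → Pos (orient a b _)) (pos-φ (inj₁ i)) (pos-φ (inj₁ j)) (subst (λ c → Pos (orient _ _ c)) (pos-φ (inj₁ k))
        (succ-left good fresh simple s (black∈ k) (k≢i ∘ B-injective) (k≢j ∘ B-injective)))

    succ⇒hullEdge : ∀ {i j} → Succ o t (B i) (B j) → HullEdge D i j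
    succ⇒hullEdge s = succ-irrefl t (white∈ zero) fresh simple s ∘ cong B ,
      λ k l k≢i k≢j l≢i l≢j → *-pos (succ-orient s k≢i k≢j) (succ-orient s l≢i l≢j)

    inTriangle⇒threePaths : ∀ {w i j k} → InTriangle D w i j k → ThreePaths G (W w) (B i) (B j) (B k)
    inTriangle⇒threePaths {w} c with ∈nodes⇒⊑ t (white∈ w)
    ... | _ , _ , p = conv⇒median good fresh simple B black∈ p (ThreePaths G (W w))
      threePaths-swap threePaths-cyc split⇒threePaths (conv-cong (sym ∘ pos-φ ∘ inj₁) (sym (pos-φ (inj₂ w))) c)

    private
      -- `median-ind` asks for a predicate invariant under all permutations, so the orientation of
      -- the triangle is forgotten here.
      InTri± : Point → Point → Point → Point → Set
      InTri± p a b c = InTri p a b c ⊎ InTri p b a c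

      Median : Fin m → Fin m → Fin m → Set
      Median x y z = (∃ λ v → v ∈ nodes t × ThreePaths G v x y z × InTri± (pos v) (pos x) (pos y) (pos z)) ×
        (∀ {a b} → ThreePaths G a x y z → ThreePaths G b x y z → a ≡ b)

      median : ∀ {x y z} → x ∈ o ∷ leaves t → y ∈ o ∷ leaves t → z ∈ o ∷ leaves t → x ≢ y → y ≢ z → x ≢ z → Median x y z
      median = median-ind fresh simple Median
        (λ { ((v , n , P , T) , U) → (v , n , threePaths-swap P , Sum.swap T) ,
             λ p q → U (threePaths-swap p) (threePaths-swap q) })
        (λ { ((v , n , P , T) , U) → (v , n , threePaths-cyc P ,
               Sum.map inTri-cyc (λ s → inTri-cyc (inTri-cyc s)) T) ,
             λ p q → U (threePaths-cyc (threePaths-cyc p)) (threePaths-cyc (threePaths-cyc q)) })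
        (λ s → (_ , ⊑⇒∈nodes (Split.sub s) , split⇒threePaths s , inj₁ (good s)) ,
             λ p q → trans (threePaths-unique s p) (sym (threePaths-unique s q)))

      median-at : ∀ {i j k} → i ≢ j → j ≢ k → i ≢ k → Median (B i) (B j) (B k)
      median-at i≢j j≢k i≢k = median (black∈ _) (black∈ _) (black∈ _)
        (i≢j ∘ B-injective) (j≢k ∘ B-injective) (i≢k ∘ B-injective)

    inTri⇒inTriangle : ∀ {w i j k} → InTri± (pos (W w)) (pos (B i)) (pos (B j)) (pos (B k)) → InTriangle D w i j k
    inTri⇒inTriangle {w} {i} {j} {k} (inj₁ s) = conv-cong (pos-φ ∘ inj₁) (pos-φ (inj₂ w)) (inTri⇒conv (pos ∘ B) i j k s)
    inTri⇒inTriangle {w} {i} {j} {k} (inj₂ s) = conv-cong (pos-φ ∘ inj₁) (pos-φ (inj₂ w))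
      (conv-mono {f = pos ∘ B} tri-swap (inTri⇒conv (pos ∘ B) j i k s))

    triangle-median : ∀ {i j k} → i ≢ j → j ≢ k → i ≢ k →
      ∃ λ w → InTriangle D w i j k × ThreePaths G (W w) (B i) (B j) (B k)
    triangle-median i≢j j≢k i≢k with median-at i≢j j≢k i≢k
    ... | (v , n , P , T) , _ with node-white n
    ...   | w , refl = w , inTri⇒inTriangle T , P

    trianglesOneWhite : TrianglesOneWhite D
    trianglesOneWhite i j k i≢j j≢k i≢k with triangle-median i≢j j≢k i≢k
    ... | w , c , P = w , c , λ w' c' →
      W-injective (proj₂ (median-at i≢j j≢k i≢k) (inTriangle⇒threePaths c') P)

    isCharTree : IsCharTree D G φ
    isCharTree = record
      { isThreeTree = isThreeTree
      ; whiteDeg3   = node-is-deg3 ∘ white∈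
      ; blackLeaf   = leaf-is-leaf ∘ black∈
      ; cyclicOrder = λ i j e → succ⇒hullEdge (next i e)
      ; triangles   = λ w i j k i≢j j≢k i≢k → mk⇔ inTriangle⇒threePaths (from i≢j j≢k i≢k)
      }
      where
      next : ∀ i {y} → nextLeaf G (B i) ≡ y → Succ o t (B i) y
      next i e with succ-exists (black∈ i)
      ... | y , s = subst (Succ o t (B i)) (trans (sym (succ⇒nextLeaf s)) e) s
      from : ∀ {w i j k} → i ≢ j → j ≢ k → i ≢ k → ThreePaths G (W w) (B i) (B j) (B k) → InTriangle D w i j k
      from i≢j j≢k i≢k P with triangle-median i≢j j≢k i≢k
      ... | w , c , P' with W-injective (proj₂ (median-at i≢j j≢k i≢k) P P')
      ...   | refl = c

    isTDiagram : GeneralPosition D → IsTDiagram D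
    isTDiagram gp = record
      { generalPosition = gp
      ; convexPosition  = convex
      ; whiteInside     = inside
      ; oneWhite        = trianglesOneWhite
      }
      where
      convex : BlackConvexPosition D
      -- All other black points lie left of the line from `i` to its successor `j`. As a combination
      -- of the others, `i` would coincide with `j`, which a third black point refutes.
      convex i c with succ-exists (black∈ i)
      ... | y , s with leaf-black (proj₂ (succ-∈ s))
      ...   | j , refl with third i j
      ...     | k , k≢i , k≢j = pos-orient⇒≢ (succ-orient s k≢i k≢j)
        (conv-vertex c (Diagram.black D i) (Diagram.black D j) j (orient-aba _ _) (orient-abb _ _) others-left)
        where
        others-left : ∀ l → l ≢ i → l ≡ j ⊎ Pos (orient (Diagram.black D i) (Diagram.black D j) (Diagram.black D l))
        others-left l l≢i with l FinP.≟ j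
        ... | yes e   = inj₁ e
        ... | no l≢j  = inj₂ (succ-orient s l≢i l≢j)

      inside : WhiteInsideHull D
      inside w with ∈nodes⇒⊑ t (white∈ w)
      ... | l , r , p with leaf-black (there (⊑-leaves p (∈-++⁺ˡ (first∈leaves l)))) |
                           leaf-black (there (⊑-leaves p (∈-++⁺ʳ (leaves l) (first∈leaves r)))) | leaf-black (here refl)
      ...   | i , e₁ | j , e₂ | k , e₃ = conv-mono {f = Diagram.black D} (λ _ _ → tt) (inTri⇒inTriangle {w} {i} {j} {k} (inj₁
        (subst₂ (λ a b → InTri _ (pos a) (pos b) _) e₁ e₂ (subst (λ c → InTri _ _ _ (pos c)) e₃
          (good (split p (first∈leaves l) (first∈leaves r) (here refl) (fresh ∘ ⊑-verts p)))))))

-- Uniqueness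

rotEq-rot3 : ∀ {A : Set} {a b c : A} {xs ys} → Rot3 a b c xs → Rot3 a b c ys → RotEq xs ys
rotEq-rot3 {a = a} {b} {c} rot₀ rot₀ = [] , _ , refl , refl
rotEq-rot3 {a = a} {b} {c} rot₀ rot₁ = a ∷ b ∷ [] , _ , refl , refl
rotEq-rot3 {a = a} {b} {c} rot₀ rot₂ = a ∷ [] , _ , refl , refl
rotEq-rot3 {a = a} {b} {c} rot₁ rot₀ = c ∷ [] , _ , refl , refl
rotEq-rot3 {a = a} {b} {c} rot₁ rot₁ = [] , _ , refl , refl
rotEq-rot3 {a = a} {b} {c} rot₁ rot₂ = c ∷ a ∷ [] , _ , refl , refl
rotEq-rot3 {a = a} {b} {c} rot₂ rot₀ = b ∷ c ∷ [] , _ , refl , refl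
rotEq-rot3 {a = a} {b} {c} rot₂ rot₁ = b ∷ [] , _ , refl , refl
rotEq-rot3 {a = a} {b} {c} rot₂ rot₂ = [] , _ , refl , refl

rot3-map : ∀ {A B : Set} (f : A → B) {a b c xs} → Rot3 a b c xs → Rot3 (f a) (f b) (f c) (map f xs)
rot3-map f rot₀ = rot₀
rot3-map f rot₁ = rot₁
rot3-map f rot₂ = rot₂

rot3-reverse : ∀ {A : Set} {a b c : A} {xs} → Rot3 a b c xs → Rot3 a c b (reverse xs)
rot3-reverse rot₀ = rot₂
rot3-reverse rot₁ = rot₁
rot3-reverse rot₂ = rot₀

occ-map : ∀ {V W : Set} (f : V → W) {o u t s} → Occ o t u s → Occ (f o) (mapTree f t) (f u) (mapTree f s)
occ-map f top       = top
occ-map f (left p)  = left (occ-map f p)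
occ-map f (right p) = right (occ-map f p)

occ-mirror : ∀ {V : Set} {o u : V} {t s} → Occ o t u s → Occ o (mirror t) u (mirror s)
occ-mirror top       = top
occ-mirror (left p)  = right (occ-mirror p)
occ-mirror (right p) = left (occ-mirror p)

module CharTreeUniqueness (F : OrderedField) where
  open OrderedField F using (Carrier; 0#; 1#; _+_; _*_; -_; *-pos; 0≢1)
  open Geometry F
  open PlaneLemmas F
  open GoodLemmas F
  open FieldLemmas.Solver F using (solve; :-_; _:*_; _:=_)

  negated-square : ∀ x y z → x * y * ((- x) * z) * ((- y) * (- z)) ≡ - (x * y * z * (x * y * z))
  negated-square = solve 3 (λ x y z →
    x :* y :* ((:- x) :* z) :* ((:- y) :* (:- z)) := :- (x :* y :* z :* (x :* y :* z))) refl

  module _ {d : ℕ} (D : Diagram d) where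

    private
      b : Fin (3 ℕ.+ d) → Point
      b = Diagram.black D

    hull-sym : ∀ {i j} → HullEdge D i j → HullEdge D j i
    hull-sym {i} {j} (i≢j , h) = i≢j ∘ sym , λ k l k≢j k≢i l≢j l≢i →
      subst Pos (trans (sym (neg*neg _ _)) (cong₂ _*_ (orient-swap (b i) (b j) (b k)) (orient-swap (b i) (b j) (b l))))
        (h k l k≢i k≢j l≢i l≢j)

    -- Each hull edge at `i` makes the product of two signed areas positive. For three distinct
    -- neighbours the three products multiply to minus a square.
    hull-degree : ∀ {i a c e} → a ≢ c → a ≢ e → HullEdge D i a → HullEdge D i c → HullEdge D i e → c ≡ e
    hull-degree {i} {a} {c} {e} a≢c a≢e (i≢a , ha) (i≢c , hc) (i≢e , he) with c FinP.≟ e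
    ... | yes c≡e = c≡e
    ... | no c≢e = contradiction (*-pos (*-pos ace cae) eac) (λ q → ¬pos-neg (square-nonneg (x * y * z)) (≡-pos square q))
      where
      x = orient (b i) (b a) (b c)
      y = orient (b i) (b a) (b e)
      z = orient (b i) (b c) (b e)
      flip : ∀ p q → orient (b i) (b p) (b q) ≡ - orient (b i) (b q) (b p)
      flip p q = trans (orient-cyc (b i) (b p) (b q)) (trans (sym (orient-swap (b q) (b p) (b i)))
        (cong -_ (sym (orient-cyc (b i) (b q) (b p)))))
      ace = ha c e (i≢c ∘ sym) (a≢c ∘ sym) (i≢e ∘ sym) (a≢e ∘ sym)
      cae = hc a e (i≢a ∘ sym) a≢c (i≢e ∘ sym) (c≢e ∘ sym)
      eac = he a c (i≢a ∘ sym) a≢e (i≢c ∘ sym) c≢e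
      square : x * y * (orient (b i) (b c) (b a) * z) * (orient (b i) (b e) (b a) * orient (b i) (b e) (b c))
        ≡ - (x * y * z * (x * y * z))
      square = trans (cong₂ (λ p q → x * y * p * q) (cong (_* z) (flip c a)) (cong₂ _*_ (flip e a) (flip e c)))
        (negated-square x y z)

    conv⇒triangle : GeneralPosition D → ∀ {w} (is : List (Fin (3 ℕ.+ d))) → InConv (_∈ is) b (Diagram.white D w) →
      ∃ λ i → ∃₂ λ j k → i ∈ is × j ∈ is × k ∈ is × i ≢ j × j ≢ k × i ≢ k × InTriangle D w i j k
    conv⇒triangle gp [] (c , c0 , _ , Σc , _) = contradiction (trans (sym (sumF-0 λ i → c0 i λ ())) Σc) 0≢1
    conv⇒triangle gp {w} (i₀ ∷ is) c with extreme∨inTri b (Diagram.white D w) i₀ is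
      (λ i j _ _ i≢j → gp (inj₂ w) (inj₁ i) (inj₁ j) (λ ()) (λ { refl → i≢j refl }) (λ ()))
    ... | inj₁ (i , j , k , i∈ , j∈ , k∈ , s) = i , j , k , i∈ , j∈ , k∈ ,
      pos-orient⇒≢ o ∘ cong b , pos-orient⇒≢ (cyc⁺ o) ∘ cong b , pos-orient⇒≢ (cyc⁺ (cyc⁺ o)) ∘ cong b ∘ sym ,
      inTri⇒conv b i j k s
      where o = inTri⇒orient s
    -- An extreme direction would force the white point onto black point `s`, and then it is
    -- collinear with `s` and any further black point `k`.
    ... | inj₂ (s , _ , h) with third s s
    ...   | k , k≢s , _ = contradiction (conv-vertex c _ _ s (orient-aba _ (b s)) (orient-abb _ (b s)) h) λ e →
      gp (inj₂ w) (inj₁ s) (inj₁ k) (λ ()) (λ { refl → k≢s refl }) (λ ())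
        (trans (cong (λ p → orient p (b s) (b k)) e) (orient-aab (b s) (b k)))

  module Rooted {d m : ℕ} {D : Diagram d} {G : Graph m} {φ : Pt D ⤖ Fin m} (T : IsCharTree D G φ)
    {o : Fin m} {t : Tree (Fin m)} (R : Rep G o t) where

    open IsCharTree T
    open Rep R
    open RepLemmas R

    black∈ : ∀ i → φ' (inj₁ i) ∈ o ∷ leaves t
    black∈ i = leaf-vertex (blackLeaf i)

    white∈ : ∀ w → φ' (inj₂ w) ∈ nodes t
    white∈ w = deg3-vertex (whiteDeg3 w)

    open CharTreeLemmas.Coloured F {D = D} φ R black∈ white∈ public

    succ⇒hull : ∀ {i j} → Succ o t (B i) (B j) → HullEdge D i j
    succ⇒hull s = cyclicOrder _ _ (succ⇒nextLeaf s)

    two-cycle-free : ∀ {x y} → Succ o t x y → ¬ Succ o t y x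
    two-cycle-free = succ-no-2cycle t (white∈ zero) fresh simple

    succ-black : ∀ i → ∃ λ a → Succ o t (B i) (B a)
    succ-black i =
      let _ , s = succ-exists (black∈ i) ; a , e = leaf-black (proj₂ (succ-∈ s)) in a , subst (Succ o t (B i)) e s

    pred-black : ∀ i → ∃ λ c → Succ o t (B c) (B i)
    pred-black i =
      let _ , p = pred-exists (black∈ i) ; c , e = leaf-black (proj₁ (succ-∈ p)) in c , subst (λ x → Succ o t x (B i)) e p

    -- The leaf order only implies hull edges; this is the converse. Successor and predecessor are
    -- two distinct hull neighbours of `i`, and the degree leaves no room for a third.
    hull⇒succ : ∀ {i j a c} → Succ o t (B i) (B a) → Succ o t (B c) (B i) → HullEdge D i j →
      Succ o t (B i) (B j) ⊎ Succ o t (B j) (B i)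
    hull⇒succ {i} {j} {a} {c} s p h with a FinP.≟ j
    ... | yes a≡j = inj₁ (subst (λ x → Succ o t (B i) (B x)) a≡j s)
    ... | no a≢j  = inj₂ (subst (λ x → Succ o t (B x) (B i)) c≡j p)
      where
      a≢c : a ≢ c
      a≢c a≡c = two-cycle-free s (subst (λ x → Succ o t (B x) (B i)) (sym a≡c) p)
      c≡j : c ≡ j
      c≡j = hull-degree D a≢c a≢j (succ⇒hull s) (hull-sym D (succ⇒hull p)) h

    hull⇒next : ∀ {i j} → HullEdge D i j → nextLeaf G (B i) ≡ B j ⊎ nextLeaf G (B j) ≡ B i
    hull⇒next {i} h = Sum.map succ⇒nextLeaf succ⇒nextLeaf
      (hull⇒succ (proj₂ (succ-black i)) (proj₂ (pred-black i)) h)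

    next⇒hull : ∀ {i j} → nextLeaf G (B i) ≡ B j ⊎ nextLeaf G (B j) ≡ B i → HullEdge D i j
    next⇒hull (inj₁ e) = cyclicOrder _ _ e
    next⇒hull (inj₂ e) = hull-sym D (cyclicOrder _ _ e)

    lca⇒leaves≢o : ∀ {v x y} → Lca t v x y → x ≢ y × x ≢ o × y ≢ o
    lca⇒leaves≢o c@(l , r , p , m , n) =
      (λ { refl → leaves-disjoint (⊑-simple p simple) m n }) , ≢o (proj₁ (lca-∈ c)) , ≢o (proj₂ (lca-∈ c))
      where
      ≢o : ∀ {x} → x ∈ leaves t → x ≢ o
      ≢o m e = fresh (subst (_∈ verts t) e (leaves⊆verts t m))

    lca⇒split : ∀ {v x y} → Lca t v x y → Split o t v x y o
    lca⇒split (l , r , p , m , n) = split p m n (here refl) (fresh ∘ ⊑-verts p)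

    -- With the root leaf as third corner, the median is the lowest common ancestor of the other
    -- two. Triangles at one fixed black point therefore determine all such ancestors.
    lca⇒triangle : ∀ {w i j k} → o ≡ B k → Lca t (W w) (B i) (B j) → InTriangle D w i j k
    lca⇒triangle {w} {i} {j} {k} e c with lca⇒leaves≢o c
    ... | x≢y , x≢o , y≢o = Equivalence.from
      (triangles w i j k (x≢y ∘ cong B) (λ j≡k → y≢o (trans (cong B j≡k) (sym e))) (λ i≡k → x≢o (trans (cong B i≡k) (sym e))))
      (subst (ThreePaths G (W w) (B i) (B j)) e (split⇒threePaths (lca⇒split c)))

    triangle⇒lca : ∀ {w i j k} → o ≡ B k → i ≢ j → j ≢ k → i ≢ k → InTriangle D w i j k →
      Lca t (W w) (B i) (B j) ⊎ Lca t (W w) (B j) (B i)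
    triangle⇒lca {w} {i} {j} {k} e i≢j j≢k i≢k c with lca-exists t (i≢j ∘ B-injective) (in-t i i≢k) (in-t j j≢k)
      where
      in-t : ∀ a → a ≢ k → B a ∈ leaves t
      in-t a a≢k with black∈ a
      ... | here e'  = contradiction (B-injective (trans e' e)) a≢k
      ... | there m  = m
    ... | v , q = Sum.map
      (λ q → subst (λ u → Lca t u (B i) (B j)) (sym (threePaths-unique (lca⇒split q) P)) q)
      (λ q → subst (λ u → Lca t u (B j) (B i)) (sym (threePaths-unique (lca⇒split q) (threePaths-swap P))) q) q
      where
      P : ThreePaths G (W w) (B i) (B j) o
      P = subst (ThreePaths G (W w) (B i) (B j)) (sym e) (Equivalence.to (triangles w i j k i≢j j≢k i≢k) c)

  -- A triangle around the white point is read as three paths in the common tree and then as a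
  -- triangle of the other diagram. The target set `S` is kept general so that both directions of
  -- `EquivDiag` are instances.
  conv-transfer : ∀ {d m} {D E : Diagram d} {G : Graph m} {φ : Pt D ⤖ Fin m} {φ' : Pt E ⤖ Fin m} →
    GeneralPosition D → (T : IsCharTree D G φ) (T' : IsCharTree E G φ') →
    (f : Fin (3 ℕ.+ d) → Fin (3 ℕ.+ d)) → (∀ i → Bijection.to φ (inj₁ i) ≡ Bijection.to φ' (inj₁ (f i))) →
    ∀ {w w'} → Bijection.to φ (inj₂ w) ≡ Bijection.to φ' (inj₂ w') →
    ∀ is {S : Fin (3 ℕ.+ d) → Set} → (∀ {i} → i ∈ is → S (f i)) →
    InConv (_∈ is) (Diagram.black D) (Diagram.white D w) → InConv S (Diagram.black E) (Diagram.white E w')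
  conv-transfer {D = D} {E} {G} {φ} {φ'} gp T T' f f-eq {w} {w'} w-eq is {S} h c with conv⇒triangle D gp is c
  ... | i , j , k , i∈ , j∈ , k∈ , i≢j , j≢k , i≢k , tri = conv-mono {f = Diagram.black E} in-S
    (Equivalence.from (IsCharTree.triangles T' w' (f i) (f j) (f k) (f-≢ i≢j) (f-≢ j≢k) (f-≢ i≢k)) paths)
    where
    f-≢ : ∀ {a c} → a ≢ c → f a ≢ f c
    f-≢ {a} {c} a≢c e with Bijection.injective φ (trans (f-eq a) (trans (cong (λ x → Bijection.to φ' (inj₁ x)) e) (sym (f-eq c))))
    ... | refl = a≢c refl
    in-S : ∀ n → Tri (f i) (f j) (f k) n → S n
    in-S n (inj₁ refl)        = h i∈
    in-S n (inj₂ (inj₁ refl)) = h j∈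
    in-S n (inj₂ (inj₂ refl)) = h k∈
    paths : ThreePaths G (Bijection.to φ' (inj₂ w')) (Bijection.to φ' (inj₁ (f i))) (Bijection.to φ' (inj₁ (f j)))
      (Bijection.to φ' (inj₁ (f k)))
    paths = subst₂ (λ a c → ThreePaths G a c _ _) w-eq (f-eq i) (subst₂ (ThreePaths G _ _) (f-eq j) (f-eq k)
      (Equivalence.to (IsCharTree.triangles T w i j k i≢j j≢k i≢k) tri))

  same-tree⇒equiv : ∀ {d m} {D E : Diagram d} {G : Graph m} {φ : Pt D ⤖ Fin m} {φ' : Pt E ⤖ Fin m} →
    GeneralPosition D → GeneralPosition E → IsCharTree D G φ → IsCharTree E G φ' → ∀ {o t} → Rep G o t → EquivDiag D E
  same-tree⇒equiv {d} {m} {D} {E} {G} {φ} {φ'} gpD gpE T T' {o} {t} R = σ , τ , hull , arcs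
    where
    module A = Rooted T R
    module C = Rooted T' R

    bijection : ∀ {k} {P Q : Fin k → Fin m} → (∀ {i j} → P i ≡ P j → i ≡ j) → (∀ {i j} → Q i ≡ Q j → i ≡ j) →
      (∀ i → ∃ λ j → P i ≡ Q j) → (∀ j → ∃ λ i → Q j ≡ P i) → Fin k ⤖ Fin k
    bijection {P = P} {Q} P-inj Q-inj f g = mk⤖ {to = λ i → proj₁ (f i)}
      ( (λ {x} {y} e → P-inj (trans (proj₂ (f x)) (trans (cong Q e) (sym (proj₂ (f y))))))
      , λ j → proj₁ (g j) , λ { refl → Q-inj (trans (sym (proj₂ (f (proj₁ (g j))))) (sym (proj₂ (g j)))) } )

    b→ : ∀ i → ∃ λ j → A.B i ≡ C.B j
    b→ i = C.leaf-black (A.black∈ i)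
    b← : ∀ j → ∃ λ i → C.B j ≡ A.B i
    b← j = A.leaf-black (C.black∈ j)
    w→ : ∀ w → ∃ λ w' → A.W w ≡ C.W w'
    w→ w = C.node-white (A.white∈ w)
    w← : ∀ w' → ∃ λ w → C.W w' ≡ A.W w
    w← w' = A.node-white (C.white∈ w')

    σ : Fin (3 ℕ.+ d) ⤖ Fin (3 ℕ.+ d)
    σ = bijection A.B-injective C.B-injective b→ b←
    τ : Fin (1 ℕ.+ d) ⤖ Fin (1 ℕ.+ d)
    τ = bijection A.W-injective C.W-injective w→ w←

    next-transfer : ∀ {x y x' y'} → x ≡ x' → y ≡ y' → nextLeaf G x ≡ y ⊎ nextLeaf G y ≡ x →
      nextLeaf G x' ≡ y' ⊎ nextLeaf G y' ≡ x'
    next-transfer refl refl h = h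

    hull : ∀ i j → HullEdge D i j ⇔ HullEdge E (Bijection.to σ i) (Bijection.to σ j)
    hull i j = mk⇔
      (λ h → C.next⇒hull (next-transfer (proj₂ (b→ i)) (proj₂ (b→ j)) (A.hull⇒next h)))
      (λ h → A.next⇒hull (next-transfer (sym (proj₂ (b→ i))) (sym (proj₂ (b→ j))) (C.hull⇒next h)))

    arcs : ∀ is → Arc D is → ∀ w →
      InConv (λ j → j ∈ is) (Diagram.black D) (Diagram.white D w) ⇔
      InConv (λ j → j ∈ map (Bijection.to σ) is) (Diagram.black E) (Diagram.white E (Bijection.to τ w))
    arcs is _ w = mk⇔
      (conv-transfer gpD T T' (λ i → proj₁ (b→ i)) (λ i → proj₂ (b→ i)) (proj₂ (w→ w)) is (∈-map⁺ _))
      (conv-transfer gpE T' T (λ j → proj₁ (b← j)) (λ j → proj₂ (b← j)) (sym (proj₂ (w→ w))) (map (Bijection.to σ) is) back)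
      where
      back : ∀ {j} → j ∈ map (Bijection.to σ) is → proj₁ (b← j) ∈ is
      back {j} n with ∈-map⁻ (Bijection.to σ) n
      ... | i , i∈ , e = subst (_∈ is) (A.B-injective (trans (proj₂ (b→ i)) (trans (cong C.B (sym e)) (proj₂ (b← j))))) i∈

  module TwoTrees {d m m' : ℕ} {D : Diagram d} {G : Graph m} {G' : Graph m'} {φ : Pt D ⤖ Fin m} {φ' : Pt D ⤖ Fin m'}
    (T : IsCharTree D G φ) (T' : IsCharTree D G' φ') {t : Tree (Fin m)} {t' : Tree (Fin m')}
    (R : Rep G (Bijection.to φ (inj₁ zero)) t) (R' : Rep G' (Bijection.to φ' (inj₁ zero)) t') where

    private
      module A = Rooted T R
      module C = Rooted T' R'
      o  = A.B zero
      o' = C.B zero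

    ψ : Fin m → Fin m'
    ψ v = Bijection.to φ' (proj₁ (A.preimage v))

    ψ-φ : ∀ x → ψ (Bijection.to φ x) ≡ Bijection.to φ' x
    ψ-φ x = cong (Bijection.to φ') (sym (Bijection.injective φ (proj₂ (A.preimage (Bijection.to φ x)))))

    ψ-injective : ∀ {u v} → ψ u ≡ ψ v → u ≡ v
    ψ-injective {u} {v} e = trans (proj₂ (A.preimage u))
      (trans (cong (Bijection.to φ) (Bijection.injective φ' e)) (sym (proj₂ (A.preimage v))))

    ψ-bijection : Fin m ⤖ Fin m'
    ψ-bijection = mk⤖ {to = ψ} (ψ-injective , λ v → Bijection.to φ (proj₁ (C.preimage v)) ,
      λ { refl → trans (ψ-φ _) (sym (proj₂ (C.preimage v))) })

    private
      s : Tree (Fin m')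
      s = mapTree ψ t

      s-simple : Simple s
      s-simple = simple-map ψ ψ-injective (Rep.simple R)

      -- Hull adjacency carried over to `G'`. Consecutive leaves of both trees are related by it,
      -- and it inherits degree two.
      H : Fin m' → Fin m' → Set
      H x y = ∃₂ λ i j → x ≡ C.B i × y ≡ C.B j × HullEdge D i j

      H-sym : ∀ {x y} → H x y → H y x
      H-sym (i , j , e , e' , h) = j , i , e' , e , hull-sym D h

      H-degree : ∀ {x a c e} → a ≢ c → a ≢ e → H x a → H x c → H x e → c ≡ e
      H-degree {x} a≢c a≢e (i , j , xi , aj , h) (i' , k , xi' , ck , h') (i'' , l , xi'' , el , h'') =
        trans ck (trans (cong C.B (hull-degree D
          (λ j≡k → a≢c (trans aj (trans (cong C.B j≡k) (sym ck)))) (λ j≡l → a≢e (trans aj (trans (cong C.B j≡l) (sym el))))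
          h (subst (λ i → HullEdge D i k) (C.B-injective (trans (sym xi') xi)) h')
            (subst (λ i → HullEdge D i l) (C.B-injective (trans (sym xi'') xi)) h''))) (sym el))

      succ⇒H : ∀ {x y} → Succ o' t' x y → H x y
      succ⇒H q = let i , e = C.leaf-black (proj₁ (succ-∈ q)) ; j , e' = C.leaf-black (proj₂ (succ-∈ q)) in
        i , j , e , e' , C.succ⇒hull (subst₂ (Succ o' t') e e' q)

      succ⇒Hψ : ∀ {x y} → Succ o t x y → H (ψ x) (ψ y)
      succ⇒Hψ q = let i , e = A.leaf-black (proj₁ (succ-∈ q)) ; j , e' = A.leaf-black (proj₂ (succ-∈ q)) in
        i , j , trans (cong ψ e) (ψ-φ _) , trans (cong ψ e') (ψ-φ _) , A.succ⇒hull (subst₂ (Succ o t) e e' q)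

      H-first : H o' (first s)
      H-first = subst₂ H (ψ-φ _) (sym (first-map ψ t)) (succ⇒Hψ start)

      H-last : H o' (last s)
      H-last = H-sym (subst₂ H (sym (last-map ψ t)) (ψ-φ _) (succ⇒Hψ close))

      H-inner : ∀ {v l r} → node v l r ⊑ s → H (last l) (first r)
      H-inner p with ⊑-map⁻ ψ t p
      ... | _ , l , r , q , _ , refl , refl = subst₂ H (sym (last-map ψ l)) (sym (first-map ψ r)) (succ⇒Hψ (inner q))

      leaves-s⁺ : ∀ {x} → x ∈ leaves t' → x ∈ leaves s
      leaves-s⁺ {x} n with C.leaf-black (there n)
      ... | i , e with A.black∈ i
      ...   | here e' = contradiction (leaves⊆verts t' (subst (_∈ leaves t') (trans e (cong C.B (A.B-injective e'))) n))
                          (Rep.fresh R')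
      ...   | there k = subst (_∈ leaves s) (trans (ψ-φ _) (sym e)) (subst (ψ (A.B i) ∈_) (sym (leaves-map ψ t)) (∈-map⁺ ψ k))

      leaves-s⁻ : ∀ {x} → x ∈ leaves s → x ∈ leaves t'
      leaves-s⁻ {x} n with ∈-leaves-map⁻ ψ t n
      ... | y , k , e with A.leaf-black (there k)
      ...   | i , e' with C.black∈ i
      ...     | here e'' = contradiction (leaves⊆verts t (subst (_∈ leaves t) (trans e' (cong A.B (C.B-injective e''))) k))
                             (Rep.fresh R)
      ...     | there j = subst (_∈ leaves t') (sym (trans e (trans (cong ψ e') (ψ-φ _)))) j

      o'∉s : o' ∉ leaves s
      o'∉s n = Rep.fresh R' (leaves⊆verts t' (leaves-s⁻ n))

      lca-≡ : ∀ {k} {t : Tree (Fin k)} {v v' x x' y y'} → v ≡ v' → x ≡ x' → y ≡ y' → Lca t v x y → Lca t v' x' y'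
      lca-≡ refl refl refl p = p

      lca-colours : ∀ {v x y} → Lca t v x y → ∃ λ w → ∃₂ λ i j → v ≡ A.W w × x ≡ A.B i × y ≡ A.B j
      lca-colours c@(_ , _ , p , _) =
        let w , e₁ = A.node-white (⊑⇒∈nodes p)
            i , e₂ = A.leaf-black (there (proj₁ (lca-∈ c)))
            j , e₃ = A.leaf-black (there (proj₂ (lca-∈ c)))
        in w , i , j , e₁ , e₂ , e₃

      lca-black : ∀ {w i j} → Lca t (A.W w) (A.B i) (A.B j) →
        Lca t' (C.W w) (C.B i) (C.B j) ⊎ Lca t' (C.W w) (C.B j) (C.B i)
      lca-black p = let x≢y , x≢o , y≢o = A.lca⇒leaves≢o p in
        C.triangle⇒lca refl (x≢y ∘ cong A.B) (y≢o ∘ cong A.B) (x≢o ∘ cong A.B) (A.lca⇒triangle refl p)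

      lca-transfer : ∀ {w x y} → Lca s w x y → Lca t' w x y ⊎ Lca t' w y x
      lca-transfer p with lca-map⁻ ψ t p
      ... | _ , _ , _ , q , refl , refl , refl = let _ , _ , _ , e₁ , e₂ , e₃ = lca-colours q in Sum.map
        (lca-≡ (to-C e₁) (to-C e₂) (to-C e₃)) (lca-≡ (to-C e₁) (to-C e₃) (to-C e₂)) (lca-black (lca-≡ e₁ e₂ e₃ q))
        where
        to-C : ∀ {u x} → u ≡ Bijection.to φ x → Bijection.to φ' x ≡ ψ u
        to-C e = sym (trans (cong ψ e) (ψ-φ _))

      -- Preceded by `o'`, both leaf sequences run along hull edges without repetition and share
      -- their first edge, so `linked-unique` applies. The tree is a variable because the lemma is
      -- used for `mapTree ψ t` and for its mirror image.
      leaves-≡ : ∀ {s} → Simple s → o' ∉ leaves s → (∀ {v l r} → node v l r ⊑ s → H (last l) (first r)) → H o' (first s) →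
        (∀ {x} → x ∈ leaves s → x ∈ leaves t') → (∀ {x} → x ∈ leaves t' → x ∈ leaves s) → first s ≡ first t' →
        leaves s ≡ leaves t'
      leaves-≡ {s} σ o'∉ h h₀ ⊆₁ ⊆₂ e =
        let xs , exs = leaves≡first∷ s
            ys , eys = leaves≡first∷ t'
            eys' = trans eys (cong (_∷ ys) (sym e))
            Lx = linked-leaves {R = H} s h
            Ly = linked-leaves {R = H} t' (succ⇒H ∘ inner)
            Ux = unique-leaves σ
            Uy = unique-leaves (Rep.simple R')
            len = ℕP.≤-antisym (unique-⊆-length Ux ⊆₁) (unique-⊆-length Uy ⊆₂)
            o'∉' : o' ∉ leaves t'
            o'∉' n = Rep.fresh R' (leaves⊆verts t' n)
            xs≡ys = linked-unique {R = H} H-sym H-degree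
              (h₀ ∷ subst (Linked H) exs Lx) (h₀ ∷ subst (Linked H) eys' Ly)
              (∉⇒All≢ (o'∉ ∘ subst (_ ∈_) (sym exs)) ∷ subst Unique exs Ux)
              (∉⇒All≢ (o'∉' ∘ subst (_ ∈_) (sym eys')) ∷ subst Unique eys' Uy)
              (ℕP.suc-injective (trans (sym (cong length exs)) (trans len (cong length eys'))))
        in trans exs (trans (cong (first s ∷_) xs≡ys) (sym eys'))

    -- Both trees are rooted at black point 0, whose only hull neighbours are the first and the last
    -- leaf. The choice of `first t'` among them decides between the tree and its mirror image.
    tree-cases : mapTree ψ t ≡ t' ⊎ mirror (mapTree ψ t) ≡ t'
    tree-cases with first s FinP.≟ first t'
    ... | yes e = inj₁ (tree-≡ s-simple (Rep.simple R')
      (leaves-≡ s-simple o'∉s H-inner H-first leaves-s⁻ leaves-s⁺ e) lca-transfer)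
    ... | no ¬e = inj₂ (tree-≡ (simple-mirror s-simple) (Rep.simple R')
      (leaves-≡ (simple-mirror s-simple) (o'∉s ∘ leaves-mirror⁻ s) mirror-inner
        (subst (H o') (sym (first-mirror s)) H-last) (leaves-s⁻ ∘ leaves-mirror⁻ s) (leaves-mirror⁺ s ∘ leaves-s⁺)
        (trans (first-mirror s) last≡))
      (λ p → Sum.swap (lca-transfer (subst (λ u → Lca u _ _ _) (mirror-mirror s) (lca-mirror p)))))
      where
      first≢ : first s ≢ last s
      first≢ e = A.two-cycle-free start (subst (λ x → Succ o t x o)
        (sym (ψ-injective (trans (sym (first-map ψ t)) (trans e (last-map ψ t))))) close)
      last≡ : last s ≡ first t'
      last≡ = H-degree first≢ ¬e H-first H-last (succ⇒H start)
      mirror-inner : ∀ {v l r} → node v l r ⊑ mirror s → H (last l) (first r)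
      mirror-inner {l = l} {r} p = subst₂ H (first-mirror l) (last-mirror r) (H-sym (H-inner
        (subst (node _ (mirror r) (mirror l) ⊑_) (mirror-mirror s) (⊑-mirror p))))

    private
      module P = RepLemmas R
      module P' = RepLemmas R'

      RotEither : Fin m' → Fin m' → Fin m' → List (Fin m') → Set
      RotEither a b c xs = Rot3 a b c xs ⊎ Rot3 a c b xs

      rotEither-∈ : ∀ {a b c x xs} → RotEither a b c xs → x ≡ a ⊎ x ≡ b ⊎ x ≡ c → x ∈ xs
      rotEither-∈ (inj₁ ρ) (inj₁ refl)        = rot3-∈ ρ
      rotEither-∈ (inj₁ ρ) (inj₂ (inj₁ refl)) = rot3-∈ (rot3-cyc ρ)
      rotEither-∈ (inj₁ ρ) (inj₂ (inj₂ refl)) = rot3-∈ (rot3-cyc (rot3-cyc ρ))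
      rotEither-∈ (inj₂ ρ) (inj₁ refl)        = rot3-∈ ρ
      rotEither-∈ (inj₂ ρ) (inj₂ (inj₁ refl)) = rot3-∈ (rot3-cyc (rot3-cyc ρ))
      rotEither-∈ (inj₂ ρ) (inj₂ (inj₂ refl)) = rot3-∈ (rot3-cyc ρ)

      rotEither-∈⁻ : ∀ {a b c x xs} → RotEither a b c xs → x ∈ xs → x ≡ a ⊎ x ≡ b ⊎ x ≡ c
      rotEither-∈⁻ (inj₁ ρ) n = rot3-∈⁻ ρ n
      rotEither-∈⁻ (inj₂ ρ) n = Sum.map₂ Sum.swap (rot3-∈⁻ ρ n)

      ∈-nbrs-one : ∀ {xs ys u a} → xs ≡ a ∷ [] → ys ≡ ψ a ∷ [] → u ∈ xs ⇔ ψ u ∈ ys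
      ∈-nbrs-one refl refl = mk⇔ (λ { (here e) → here (cong ψ e) }) (λ { (here e) → here (ψ-injective e) })

      ∈-nbrs-three : ∀ {xs ys u a b c} → Rot3 a b c xs → RotEither (ψ a) (ψ b) (ψ c) ys → u ∈ xs ⇔ ψ u ∈ ys
      ∈-nbrs-three {u = u} {a} {b} {c} ρ ρ' = mk⇔
        (λ n → rotEither-∈ ρ' (Sum.map (cong ψ) (Sum.map (cong ψ) (cong ψ)) (rot3-∈⁻ ρ n)))
        (λ n → three (Sum.map ψ-injective (Sum.map ψ-injective ψ-injective) (rotEither-∈⁻ ρ' n)))
        where
        three : u ≡ a ⊎ u ≡ b ⊎ u ≡ c → u ∈ _
        three (inj₁ refl)        = rot3-∈ ρ
        three (inj₂ (inj₁ refl)) = rot3-∈ (rot3-cyc ρ)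
        three (inj₂ (inj₂ refl)) = rot3-∈ (rot3-cyc (rot3-cyc ρ))

      adjacency : root t' ≡ ψ (root t) →
        (∀ {u v} → Occ o t u (leaf v) → nbrs G' (ψ v) ≡ ψ u ∷ []) →
        (∀ {u v l r} → Occ o t u (node v l r) → RotEither (ψ u) (ψ (root l)) (ψ (root r)) (nbrs G' (ψ v))) →
        ∀ u v → Adj G u v ⇔ Adj G' (ψ u) (ψ v)
      adjacency e leaf-case node-case u v with P.position v
      ... | P.origin refl = ∈-nbrs-one (Rep.rootNbr R)
              (trans (cong (nbrs G') (ψ-φ _)) (trans (Rep.rootNbr R') (cong (_∷ []) e)))
      ... | P.atLeaf p    = ∈-nbrs-one (P.leaf-nbrs p) (leaf-case p)
      ... | P.atNode p    = ∈-nbrs-three (P.node-rot p) (node-case p)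

      occ-straight : mapTree ψ t ≡ t' → ∀ {u s} → Occ o t u s → Occ o' t' (ψ u) (mapTree ψ s)
      occ-straight e {u} {s} p = subst₂ (λ a b → Occ a b (ψ u) (mapTree ψ s)) (ψ-φ _) e (occ-map ψ p)

      occ-mirrored : mirror (mapTree ψ t) ≡ t' → ∀ {u s} → Occ o t u s → Occ o' t' (ψ u) (mirror (mapTree ψ s))
      occ-mirrored e {u} {s} p =
        subst₂ (λ a b → Occ a b (ψ u) (mirror (mapTree ψ s))) (ψ-φ _) e (occ-mirror (occ-map ψ p))

      node-straight : mapTree ψ t ≡ t' → ∀ {u v l r} → Occ o t u (node v l r) →
        Rot3 (ψ u) (ψ (root l)) (ψ (root r)) (nbrs G' (ψ v))
      node-straight e {l = l} {r} p =
        subst₂ (λ a b → Rot3 _ a b _) (root-map ψ l) (root-map ψ r) (P'.node-rot (occ-straight e p))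

      node-mirrored : mirror (mapTree ψ t) ≡ t' → ∀ {u v l r} → Occ o t u (node v l r) →
        Rot3 (ψ u) (ψ (root r)) (ψ (root l)) (nbrs G' (ψ v))
      node-mirrored e {l = l} {r} p = subst₂ (λ a b → Rot3 _ a b _)
        (trans (root-mirror (mapTree ψ r)) (root-map ψ r)) (trans (root-mirror (mapTree ψ l)) (root-map ψ l))
        (P'.node-rot (occ-mirrored e p))

      deg3-occ : ∀ {v} → IsDeg3 G v → ∃ λ u → ∃₂ λ l r → Occ o t u (node v l r)
      deg3-occ e with ∈nodes⇒⊑ t (P.deg3-vertex e)
      ... | l , r , p = _ , l , r , proj₂ (⊑⇒occ top p)

    isoCompatible : IsoCompatible D G G' φ φ'
    isoCompatible with tree-cases
    ... | inj₁ e = ψ-bijection ,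
      adjacency (trans (cong root (sym e)) (root-map ψ t)) (P'.leaf-nbrs ∘ occ-straight e) (inj₁ ∘ node-straight e) , ψ-φ ,
      inj₁ λ v deg → let _ , _ , _ , p = deg3-occ deg in
        rotEq-rot3 (node-straight e p) (rot3-map ψ (P.node-rot p))
    ... | inj₂ e = ψ-bijection ,
      adjacency (trans (cong root (sym e)) (trans (root-mirror (mapTree ψ t)) (root-map ψ t)))
        (P'.leaf-nbrs ∘ occ-mirrored e) (inj₂ ∘ node-mirrored e) , ψ-φ ,
      inj₂ λ v deg → let _ , _ , _ , p = deg3-occ deg in
        rotEq-rot3 (node-mirrored e p) (rot3-reverse (rot3-map ψ (P.node-rot p)))

  charTree-unique : ∀ {d m m'} {D : Diagram d} {G : Graph m} {G' : Graph m'} {φ : Pt D ⤖ Fin m} {φ' : Pt D ⤖ Fin m'} →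
    IsCharTree D G φ → IsCharTree D G' φ' → IsoCompatible D G G' φ φ'
  charTree-unique {G = G} {G'} T T' = TwoTrees.isoCompatible T T'
    (proj₂ (FromThreeTree.rep-at-leaf G (IsCharTree.isThreeTree T) (IsCharTree.blackLeaf T zero)))
    (proj₂ (FromThreeTree.rep-at-leaf G' (IsCharTree.isThreeTree T') (IsCharTree.blackLeaf T' zero)))

-- The tree of a diagram

allPairs-++⁻ : ∀ {A : Set} {R : A → A → Set} as {bs} → AllPairs R (as ++ bs) →
  AllPairs R as × AllPairs R bs × (∀ {a b} → a ∈ as → b ∈ bs → R a b)
allPairs-++⁻ []       p       = [] , p , λ ()
allPairs-++⁻ (a ∷ as) (q ∷ p) with allPairs-++⁻ as p
... | p₁ , p₂ , h = AllP.++⁻ˡ as q ∷ p₁ , p₂ , λ { (here refl) n → All.lookup (AllP.++⁻ʳ as q) n ; (there m) n → h m n }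

sorted-last : ∀ {A : Set} {R : A → A → Set} x xs → AllPairs R (x ∷ xs) →
  ∃ λ e → e ∈ x ∷ xs × (∀ {k} → k ∈ x ∷ xs → k ≡ e ⊎ R k e)
sorted-last x [] _ = x , here refl , λ { (here e) → inj₁ e }
sorted-last x (y ∷ ys) (q ∷ p) with sorted-last y ys p
... | e , m , h = e , there m , λ { (here refl) → inj₂ (All.lookup q m) ; (there n) → h n }

module CharTreeExistence (F : OrderedField) where
  open OrderedField F using (Carrier; 0#; -_)
  open Geometry F
  open PlaneLemmas F
  open GoodLemmas F

  module _ {d : ℕ} (D : Diagram d) (TD : IsTDiagram D) where
    open IsTDiagram TD

    private
      b : Fin (3 ℕ.+ d) → Point
      b = Diagram.black D
      W : Fin (1 ℕ.+ d) → Point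
      W = Diagram.white D

      I : Set
      I = Fin (3 ℕ.+ d)

      bbb≢0 : ∀ {i j k} → i ≢ j → j ≢ k → i ≢ k → orient (b i) (b j) (b k) ≢ 0#
      bbb≢0 {i} {j} {k} p q r = generalPosition (inj₁ i) (inj₁ j) (inj₁ k)
        (λ { refl → p refl }) (λ { refl → q refl }) (λ { refl → r refl })

      bbw≢0 : ∀ {i j w} → i ≢ j → orient (b i) (b j) (W w) ≢ 0#
      bbw≢0 {i} {j} {w} p = generalPosition (inj₁ i) (inj₁ j) (inj₂ w) (λ { refl → p refl }) (λ ()) (λ ())

      flip : ∀ {p q r} → Pos (- orient p q r) → Pos (orient q p r)
      flip = ≡-pos (orient-swap _ _ _)

      flip₂ : ∀ {p q r} → Pos (- orient p q r) → Pos (orient p r q)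
      flip₂ {p} {q} {r} h = ≡-pos (trans (orient-swap p q r) (orient-cyc q p r)) h

      asym : ∀ {p q r} → Pos (orient p q r) → Pos (orient q p r) → ⊥
      asym {p} {q} {r} x y = pos-asym x (≡-pos (sym (orient-swap p q r)) y)

      asym₂ : ∀ {p q r} → Pos (orient p q r) → Pos (orient p r q) → ⊥
      asym₂ {p} {q} {r} x y = asym x (cyc⁺ (cyc⁺ y))

      b-≢ : ∀ {i j p} → Pos (orient (b i) (b j) p) → i ≢ j
      b-≢ h refl = pos-orient⇒≢ h refl

      no-black-inside : ∀ {i j k l} → i ≢ j → i ≢ k → i ≢ l → ¬ InTri (b i) (b j) (b k) (b l)
      no-black-inside {i} {j} {k} {l} p q r s = convexPosition i (conv-mono {f = b} others (inTri⇒conv b j k l s))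
        where
        others : ∀ n → Tri j k l n → n ≢ i
        others n (inj₁ refl)        = p ∘ sym
        others n (inj₂ (inj₁ refl)) = q ∘ sym
        others n (inj₂ (inj₂ refl)) = r ∘ sym

      -- The counterclockwise order of the black points as seen from black point 0.
      R : I → I → Set
      R i j = Pos (orient (b zero) (b i) (b j))

      R⇒≢ : ∀ {i j} → R i j → i ≢ j
      R⇒≢ h = b-≢ (cyc⁺ h)

      R⇒0≢ : ∀ {i j} → R i j → zero ≢ i × zero ≢ j
      R⇒0≢ h = b-≢ h , (λ e → b-≢ (cyc⁺ (cyc⁺ h)) (sym e))

      R-total : ∀ {i j} → zero ≢ i → zero ≢ j → i ≢ j → R i j ⊎ R j i
      R-total p q r with pos∨neg (bbb≢0 p r q)
      ... | inj₁ h = inj₁ h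
      ... | inj₂ h = inj₂ (flip₂ h)

      -- Comparison of angles is not transitive in general. It is here because a failure would put
      -- black point 0 inside the triangle `i`, `j`, `k`.
      R-trans : ∀ {i j k} → R i j → R j k → R i k
      R-trans {i} {j} {k} h g with i FinP.≟ k
      ... | yes refl = ⊥-elim (asym₂ h g)
      ... | no i≢k with R-total (proj₁ (R⇒0≢ h)) (proj₂ (R⇒0≢ g)) i≢k
      ...   | inj₁ r = r
      ...   | inj₂ r = ⊥-elim (no-black-inside (proj₁ (R⇒0≢ h)) (proj₁ (R⇒0≢ g)) (proj₂ (R⇒0≢ g)) (cyc⁺ h , cyc⁺ g , cyc⁺ r))

      -- Otherwise `j` would lie inside the triangle 0, `i`, `k`.
      R-convex : ∀ {i j k} → R i j → R j k → Pos (orient (b i) (b j) (b k))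
      R-convex {i} {j} {k} h g with pos∨neg (bbb≢0 (R⇒≢ h) (R⇒≢ g) (R⇒≢ (R-trans h g)))
      ... | inj₁ r = r
      ... | inj₂ r = ⊥-elim (no-black-inside (proj₂ (R⇒0≢ h) ∘ sym) (R⇒≢ h ∘ sym) (R⇒≢ g) (h , flip₂ r , cyc⁺ (cyc⁺ g)))

      In : Fin (1 ℕ.+ d) → I → I → I → Set
      In w i j k = InTri (W w) (b i) (b j) (b k)

      aab-≥0 : ∀ {p q} → 0# ≤ orient p q p
      aab-≥0 = inj₂ (sym (orient-aba _ _))

      abb-≥0 : ∀ {p q} → 0# ≤ orient p q q
      abb-≥0 = inj₂ (sym (orient-abb _ _))

      -- Convexity gives a weak inequality, and general position makes it strict.
      line : ∀ {p q w i j k} → p ≢ q → InTriangle D w i j k → 0# ≤ orient (b p) (b q) (b i) → 0# ≤ orient (b p) (b q) (b j) →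
        0# ≤ orient (b p) (b q) (b k) → Pos (orient (b p) (b q) (W w))
      line {p} {q} {w} {i} {j} {k} p≢q c hi hj hk = 0≤⇒pos (conv-nonneg c (b p) (b q) left-of) (bbw≢0 p≢q)
        where
        left-of : ∀ n → Tri i j k n → 0# ≤ orient (b p) (b q) (b n)
        left-of n (inj₁ refl)        = hi
        left-of n (inj₂ (inj₁ refl)) = hj
        left-of n (inj₂ (inj₂ refl)) = hk

      line-in : ∀ {p q w i j k} → p ≢ q → In w i j k → 0# ≤ orient (b p) (b q) (b i) → 0# ≤ orient (b p) (b q) (b j) →
        0# ≤ orient (b p) (b q) (b k) → Pos (orient (b p) (b q) (W w))
      line-in p≢q s = line p≢q (inTri⇒conv b _ _ _ s)

      inTriangle⇒In : ∀ {w i j k} → Pos (orient (b i) (b j) (b k)) → InTriangle D w i j k → In w i j k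
      inTriangle⇒In h c =
        line (b-≢ h) c aab-≥0 abb-≥0 (inj₁ h) ,
        line (b-≢ (cyc⁺ h)) c (inj₁ (cyc⁺ h)) aab-≥0 abb-≥0 ,
        line (b-≢ (cyc⁺ (cyc⁺ h))) c abb-≥0 (inj₁ (cyc⁺ (cyc⁺ h))) aab-≥0

      In-unique : ∀ {w w' i j k} → In w i j k → In w' i j k → w ≡ w'
      In-unique {i = i} {j} {k} s s' = let h = inTri⇒orient s
                                           _ , _ , u = oneWhite i j k (b-≢ h) (b-≢ (cyc⁺ h)) (b-≢ (cyc⁺ (cyc⁺ h)) ∘ sym)
        in trans (u _ (inTri⇒conv b i j k s)) (sym (u _ (inTri⇒conv b i j k s')))

      In⇒R : ∀ {w i j} → In w zero i j → R i j
      In⇒R = inTri⇒orient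

      Precedes : I → Fin (1 ℕ.+ d) → Set
      Follows  : Fin (1 ℕ.+ d) → I → Set
      Precedes k w = Pos (orient (b zero) (b k) (W w))
      Follows w k = Pos (orient (b zero) (W w) (b k))

      In⇒before : ∀ {w i j} → In w zero i j → Precedes i w
      In⇒before = proj₁

      In⇒after : ∀ {w i j} → In w zero i j → Follows w j
      In⇒after (_ , _ , h) = cyc⁺ h

      before-after⊥ : ∀ {w k} → Precedes k w → Follows w k → ⊥
      before-after⊥ = asym₂

      before∨after : ∀ {k} w → zero ≢ k → Precedes k w ⊎ Follows w k
      before∨after w 0≢k with pos∨neg (bbw≢0 {w = w} 0≢k)
      ... | inj₁ h = inj₁ h
      ... | inj₂ h = inj₂ (flip₂ h)

      -- By convexity the triangle 0, `x`, `e` lies left of the chord from `k` to `e`, so of the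
      -- sides of the smaller triangle only the one from 0 to `k` has to be assumed.
      trim-left : ∀ {w x k e} → In w zero x e → x ≡ k ⊎ R x k → k ≡ e ⊎ R k e → Precedes k w → In w zero k e
      trim-left s (inj₁ refl) _           h = s
      trim-left s (inj₂ xk)   (inj₁ refl) h = ⊥-elim (before-after⊥ h (In⇒after s))
      trim-left s (inj₂ xk)   (inj₂ ke)   h =
        h , line-in (R⇒≢ ke) s (inj₁ (cyc⁺ ke)) (inj₁ (cyc⁺ (R-convex xk ke))) abb-≥0 , proj₂ (proj₂ s)

      trim-right : ∀ {w x k e} → In w zero x e → x ≡ k ⊎ R x k → k ≡ e ⊎ R k e → Follows w k → In w zero x k
      trim-right s (inj₁ refl) _           h = ⊥-elim (before-after⊥ (In⇒before s) h)
      trim-right s (inj₂ xk)   (inj₁ refl) h = s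
      trim-right s (inj₂ xk)   (inj₂ ke)   h =
        proj₁ s , line-in (R⇒≢ xk) s (inj₁ (cyc⁺ xk)) aab-≥0 (inj₁ (R-convex xk ke)) , cyc⁺ (cyc⁺ h)

      -- If `k'` preceded `w`, trimming would put `w` into the triangle 0, `k'`, `e`, which lies
      -- beyond the line from 0 to `k`.
      after-mono : ∀ {w x k k' e} → In w zero x e → x ≡ k ⊎ R x k → R k k' → k' ≡ e ⊎ R k' e → Follows w k → Follows w k'
      after-mono {w} {x} {k} {k'} {e} s xk kk' k'e h with before∨after w (proj₂ (R⇒0≢ kk'))
      ... | inj₂ g = g
      ... | inj₁ g = ⊥-elim (before-after⊥
        (line-in (proj₁ (R⇒0≢ kk')) (trim-left s (inj₂ xk') k'e g) aab-≥0 (inj₁ kk') (inj₁ ke)) h)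
        where
        xk' : R x k'
        xk' = Sum.[ (λ e → subst (λ i → R i k') (sym e) kk') , (λ r → R-trans r kk') ] xk
        ke : R k e
        ke = Sum.[ (λ e → subst (R k) e kk') , R-trans kk' ] k'e

      Point-tree : Set
      Point-tree = Tree (Pt D)

      -- The triangle condition is asked for every pair of leaves from the two sides, not just for
      -- the ends of the interval by which the white point was chosen; the trimming lemmas provide
      -- this.
      NodeOK : Point-tree → Set
      NodeOK t = ∀ {v l r} → node v l r ⊑ t → ∃ λ w → v ≡ inj₂ w ×
        (∀ {x y} → x ∈ leaves l → y ∈ leaves r → ∃₂ λ i j → x ≡ inj₁ i × y ≡ inj₁ j × In w zero i j)

      cut : ∀ {x e} w → In w zero x e → ∀ ks → AllPairs R ks →
        (∀ {k} → k ∈ ks → x ≡ k ⊎ R x k) → (∀ {k} → k ∈ ks → k ≡ e ⊎ R k e) →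
        ∃₂ λ as bs → ks ≡ as ++ bs × (∀ {k} → k ∈ as → Precedes k w) × (∀ {k} → k ∈ bs → Follows w k)
      cut w s [] _ _ _ = [] , [] , refl , (λ ()) , (λ ())
      cut {x} w s (k ∷ ks) (q ∷ p) lo hi with before∨after w (0≢ (lo (here refl)))
        where
        0≢ : ∀ {k} → x ≡ k ⊎ R x k → zero ≢ k
        0≢ (inj₁ refl) = proj₁ (R⇒0≢ (In⇒R s))
        0≢ (inj₂ r)    = proj₂ (R⇒0≢ r)
      ... | inj₂ h = [] , k ∷ ks , refl , (λ ()) ,
        λ { (here refl) → h ; (there m) → after-mono s (lo (here refl)) (All.lookup q m) (hi (there m)) h }
      ... | inj₁ h with cut w s ks p (lo ∘ there) (hi ∘ there)
      ...   | as , bs , e , B , A = k ∷ as , bs , cong (k ∷_) e , (λ { (here refl) → h ; (there m) → B m }) , A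

      -- The bound `n` carries the recursion, as the two pieces of the interval are obtained by a
      -- geometric cut and are not sublists in the structural sense.
      build : ∀ n x xs → length (x ∷ xs) ℕ.≤ n → AllPairs R (x ∷ xs) → ∃ λ t → leaves t ≡ map inj₁ (x ∷ xs) × NodeOK t
      build n x [] _ _ = leaf (inj₁ x) , refl , λ ()
      build (suc n) x (y ∷ ys) (s≤s len) sorted@(x< ∷ _) with sorted-last x (y ∷ ys) sorted
      ... | e , here refl , hi = ⊥-elim (Sum.[ R⇒≢ xy ∘ sym , (λ r → asym₂ r xy) ] (hi (there (here refl))))
        where
        xy : R x y
        xy = All.lookup x< (here refl)
      ... | e , there e∈ , hi with oneWhite zero x e (proj₁ (R⇒0≢ xe)) (R⇒≢ xe) (proj₂ (R⇒0≢ xe))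
        where
        xe : R x e
        xe = All.lookup x< e∈
      ...   | w , c , _ = split-at (cut w s (x ∷ y ∷ ys) sorted lo hi)
        where
        s : In w zero x e
        s = inTriangle⇒In (All.lookup x< e∈) c
        lo : ∀ {k} → k ∈ x ∷ y ∷ ys → x ≡ k ⊎ R x k
        lo (here e')  = inj₁ (sym e')
        lo (there m)  = inj₂ (All.lookup x< m)
        split-at : (∃₂ λ as bs → x ∷ y ∷ ys ≡ as ++ bs × (∀ {k} → k ∈ as → Precedes k w) × (∀ {k} → k ∈ bs → Follows w k)) →
          ∃ λ t → leaves t ≡ map inj₁ (x ∷ y ∷ ys) × NodeOK t
        -- Both pieces are nonempty, since `w` comes after the end `x` and before the end `e`.
        split-at ([] , bs , eq , B , A) = ⊥-elim (before-after⊥ (In⇒before s) (A (subst (x ∈_) eq (here refl))))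
        split-at (a ∷ as , [] , eq , B , A) = ⊥-elim (before-after⊥
          (B (subst (e ∈_) (trans eq (ListP.++-identityʳ (a ∷ as))) (there e∈))) (In⇒after s))
        split-at (a ∷ as , b' ∷ bs , eq , B , A) with allPairs-++⁻ (a ∷ as) (subst (AllPairs R) eq sorted)
        ... | pa , pb , ab with build n a as (ℕP.≤-trans la len) pa | build n b' bs (ℕP.≤-trans lb len) pb
          where
          total : length (y ∷ ys) ≡ length as ℕ.+ length (b' ∷ bs)
          total = ℕP.suc-injective (trans (cong length eq) (ListP.length-++ (a ∷ as)))
          la : length (a ∷ as) ℕ.≤ length (y ∷ ys)
          la = subst (suc (length as) ℕ.≤_) (sym (trans total (ℕP.+-suc _ _))) (s≤s (ℕP.m≤m+n _ _))
          lb : length (b' ∷ bs) ℕ.≤ length (y ∷ ys)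
          lb = subst (length (b' ∷ bs) ℕ.≤_) (sym total) (ℕP.m≤n+m _ _)
        ...   | l , el , okl | r , er , okr = node (inj₂ w) l r ,
          trans (cong₂ _++_ el er) (trans (sym (ListP.map-++ inj₁ (a ∷ as) (b' ∷ bs))) (cong (map inj₁) (sym eq))) , ok
          where
          ok : NodeOK (node (inj₂ w) l r)
          ok (inl p) = okl p
          ok (inr p) = okr p
          ok top = w , refl , λ m n → at (∈-map⁻ inj₁ (subst (_ ∈_) el m)) (∈-map⁻ inj₁ (subst (_ ∈_) er n))
            where
            at : ∀ {x y} → (∃ λ i → i ∈ a ∷ as × x ≡ inj₁ i) → (∃ λ j → j ∈ b' ∷ bs × y ≡ inj₁ j) →
              ∃₂ λ i j → x ≡ inj₁ i × y ≡ inj₁ j × In w zero i j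
            at (i , i∈ , refl) (j , j∈ , refl) = i , j , refl , refl ,
              trim-right (trim-left s (lo (in-as i∈)) (hi (in-as i∈)) (B i∈)) (inj₂ (ab i∈ j∈)) (hi (in-bs j∈)) (A j∈)
              where
              in-as : ∀ {k} → k ∈ a ∷ as → k ∈ x ∷ y ∷ ys
              in-as {k} m = subst (k ∈_) (sym eq) (∈-++⁺ˡ m)
              in-bs : ∀ {k} → k ∈ b' ∷ bs → k ∈ x ∷ y ∷ ys
              in-bs {k} m = subst (k ∈_) (sym eq) (∈-++⁺ʳ (a ∷ as) m)

      nodeOK-⊑ : ∀ {s t} → s ⊑ t → NodeOK t → NodeOK s
      nodeOK-⊑ p ok q = ok (⊑-trans q p)

      -- Replaces the corner 0 by a leaf `k` that comes after `i` and `j`. Here `w'` sits at the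
      -- vertex separating `k` from them, which is why it serves both triangles. `In-extend′` treats
      -- a `k` that comes before them.
      In-extend : ∀ {w w' i j k} → In w zero i j → In w' zero i k → In w' zero j k → In w i j k
      In-extend {w} {w'} {i} {j} {k} s s₁ s₂ = proj₁ (proj₂ s) , jkw , kiw
        where
        ij = In⇒R s
        jk = In⇒R s₂
        ik = In⇒R s₁
        jkw : Pos (orient (b j) (b k) (W w))
        jkw = line-in (R⇒≢ jk) s (inj₁ (cyc⁺ jk)) (inj₁ (cyc⁺ (R-convex ij jk))) aab-≥0
        k0w : Pos (orient (b k) (b zero) (W w))
        k0w = line-in (proj₂ (R⇒0≢ jk) ∘ sym) s abb-≥0 (inj₁ (cyc⁺ (cyc⁺ ik))) (inj₁ (cyc⁺ (cyc⁺ jk)))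
        -- Otherwise w lies in the triangle 0, i, k, so that w = w', but the line through 0 and j separates them.
        w≢w' : w ≢ w'
        w≢w' e = before-after⊥ (In⇒before s₂) (subst (λ w → Follows w j) e (In⇒after s))
        kiw : Pos (orient (b k) (b i) (W w))
        kiw = Sum.[ (λ h → h) , (λ h → contradiction (In-unique (In⇒before s , flip h , k0w) s₁) w≢w') ]
          (pos∨neg (bbw≢0 (R⇒≢ ik ∘ sym)))

      In-extend′ : ∀ {w w' i j k} → In w zero i j → In w' zero k i → In w' zero k j → In w i j k
      In-extend′ {w} {w'} {i} {j} {k} s s₁ s₂ = proj₁ (proj₂ s) , jkw , kiw
        where
        ij = In⇒R s
        ki = In⇒R s₁
        kj = In⇒R s₂
        kiw : Pos (orient (b k) (b i) (W w))
        kiw = line-in (R⇒≢ ki) s (inj₁ (cyc⁺ ki)) abb-≥0 (inj₁ (R-convex ki ij))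
        0kw : Pos (orient (b zero) (b k) (W w))
        0kw = line-in (proj₁ (R⇒0≢ kj)) s aab-≥0 (inj₁ ki) (inj₁ kj)
        w≢w' : w ≢ w'
        w≢w' e = before-after⊥ (In⇒before s) (subst (λ w → Follows w i) (sym e) (In⇒after s₁))
        jkw : Pos (orient (b j) (b k) (W w))
        jkw = Sum.[ (λ h → h) , (λ h → contradiction (In-unique (0kw , flip h , proj₂ (proj₂ s)) s₂) w≢w') ]
          (pos∨neg (bbw≢0 (R⇒≢ kj ∘ sym)))

      nodeOK⇒good : ∀ {t} → NodeOK t → Good (pt D) (inj₁ zero) t
      nodeOK⇒good {t} ok (split p m n (here refl) z∉) with ok p
      ... | w , refl , h with h m n
      ...   | i , j , refl , refl , s = inTri-cyc {W w} s
      nodeOK⇒good {t} ok (split p m n (there k) z∉) with ok p | separating-node p k z∉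
      ... | w , refl , h | _ , _ , _ , q , inj₁ (⊆l , z∈r) with ok q | h m n
      ...   | w' , _ , h' | i , j , refl , refl , s with h' (⊆l (∈-++⁺ˡ m)) z∈r | h' (⊆l (∈-++⁺ʳ _ n)) z∈r
      ...     | i' , k' , refl , refl , s₁ | j' , _ , refl , refl , s₂ = In-extend s s₁ s₂
      nodeOK⇒good {t} ok (split p m n (there k) z∉) | w , refl , h | _ , _ , _ , q , inj₂ (⊆r , z∈l) with ok q | h m n
      ...   | w' , _ , h' | i , j , refl , refl , s with h' z∈l (⊆r (∈-++⁺ˡ m)) | h' z∈l (⊆r (∈-++⁺ʳ _ n))
      ...     | k' , i' , refl , refl , s₁ | _ , j' , refl , refl , s₂ = In-extend′ s s₁ s₂

      AllBlack : Point-tree → Set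
      AllBlack t = ∀ {x} → x ∈ leaves t → ∃ λ i → x ≡ inj₁ i

      node-In : ∀ {t w} → NodeOK t → inj₂ w ∈ nodes t → ∃₂ λ i j → inj₁ i ∈ leaves t × inj₁ j ∈ leaves t × In w zero i j
      node-In {t} ok m with ∈nodes⇒⊑ t m
      ... | l , r , p with ok p
      ...   | w , refl , h with h (first∈leaves l) (first∈leaves r)
      ...     | i , j , e , e' , s = i , j , subst (_∈ leaves t) e (⊑-leaves p (∈-++⁺ˡ (first∈leaves l))) ,
        subst (_∈ leaves t) e' (⊑-leaves p (∈-++⁺ʳ (leaves l) (first∈leaves r))) , s

      -- Repetitions are excluded by angles around black point 0. A white point at a vertex of `l`
      -- comes before some leaf of `l`, whereas the one at the root comes after all of them; a white
      -- point belonging to `r` also comes after all leaves of `l`.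
      nodeOK⇒simple : ∀ t → NodeOK t → AllBlack t → Simple t
      nodeOK⇒simple (leaf v) ok ab = leaf
      nodeOK⇒simple (node v l r) ok ab with ok top
      ... | w , refl , h = node (λ m → v∉l (verts⊆leaves∪nodes l m)) (λ m → v∉r (verts⊆leaves∪nodes r m))
          (λ m n → dis (verts⊆leaves∪nodes l m) (verts⊆leaves∪nodes r n))
          (nodeOK⇒simple l okl (ab ∘ ∈-++⁺ˡ)) (nodeOK⇒simple r okr (ab ∘ ∈-++⁺ʳ (leaves l)))
        where
        okl : NodeOK l
        okl = nodeOK-⊑ (inl top) ok
        okr : NodeOK r
        okr = nodeOK-⊑ (inr top) ok
        lr : ∀ {i j} → inj₁ i ∈ leaves l → inj₁ j ∈ leaves r → In w zero i j
        lr m n with h m n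
        ... | _ , _ , refl , refl , s = s
        first-r : ∃ λ j → inj₁ j ∈ leaves r
        first-r with ab (∈-++⁺ʳ (leaves l) (first∈leaves r))
        ... | j , e = j , subst (_∈ leaves r) e (first∈leaves r)
        first-l : ∃ λ j → inj₁ j ∈ leaves l
        first-l with ab (∈-++⁺ˡ (first∈leaves l))
        ... | j , e = j , subst (_∈ leaves l) e (first∈leaves l)
        v∉l : inj₂ w ∈ leaves l ⊎ inj₂ w ∈ nodes l → ⊥
        v∉l (inj₁ m) with ab (∈-++⁺ˡ m)
        ... | _ , ()
        v∉l (inj₂ m) with node-In okl m
        ... | _ , c , _ , mc , s = before-after⊥ (In⇒before (lr mc (proj₂ first-r))) (In⇒after s)
        v∉r : inj₂ w ∈ leaves r ⊎ inj₂ w ∈ nodes r → ⊥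
        v∉r (inj₁ m) with ab (∈-++⁺ʳ (leaves l) m)
        ... | _ , ()
        v∉r (inj₂ m) with node-In okr m
        ... | a , _ , ma , _ , s = before-after⊥ (In⇒before s) (In⇒after (lr (proj₂ first-l) ma))
        dis : ∀ {x} → x ∈ leaves l ⊎ x ∈ nodes l → x ∈ leaves r ⊎ x ∈ nodes r → ⊥
        dis {inj₁ i} (inj₁ m) (inj₁ n) = R⇒≢ (In⇒R (lr m n)) refl
        dis {inj₁ i} (inj₂ m) _ with ∈nodes⇒⊑ l m
        ... | _ , _ , p with okl p
        ...   | _ , () , _
        dis {inj₁ i} _ (inj₂ n) with ∈nodes⇒⊑ r n
        ... | _ , _ , p with okr p
        ...   | _ , () , _
        dis {inj₂ w'} (inj₁ m) _ with ab (∈-++⁺ˡ m)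
        ... | _ , ()
        dis {inj₂ w'} _ (inj₁ n) with ab (∈-++⁺ʳ (leaves l) n)
        ... | _ , ()
        dis {inj₂ w'} (inj₂ m) (inj₂ n) with node-In okl m | node-In okr n
        ... | _ , c , _ , mc , s | a , e , ma , me , s' = before-after⊥
          (line-in (proj₁ (R⇒0≢ (In⇒R (lr mc ma)))) s' aab-≥0 (inj₁ (In⇒R (lr mc ma))) (inj₁ (In⇒R (lr mc me)))) (In⇒after s)

      insert : ∀ x xs → zero ≢ x → AllPairs R xs → (∀ {y} → y ∈ xs → zero ≢ y × y ≢ x) →
        ∃ λ ys → AllPairs R ys × length ys ≡ suc (length xs) × x ∈ ys ×
          (∀ {y} → y ∈ xs → y ∈ ys) × (∀ {y} → y ∈ ys → y ≡ x ⊎ y ∈ xs)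
      insert x [] 0≢x p h = x ∷ [] , [] ∷ [] , refl , here refl , (λ ()) , λ { (here e) → inj₁ e }
      insert x (z ∷ zs) 0≢x (q ∷ p) h with R-total 0≢x (proj₁ (h (here refl))) (proj₂ (h (here refl)) ∘ sym)
      ... | inj₁ xz = x ∷ z ∷ zs , (xz ∷ All.map (R-trans xz) q) ∷ q ∷ p , refl , here refl , there ,
        λ { (here e) → inj₁ e ; (there m) → inj₂ m }
      ... | inj₂ zx with insert x zs 0≢x p (h ∘ there)
      ...   | ys , p' , len , x∈ , ⊆ , ⊇ = z ∷ ys ,
        All.tabulate (λ m → Sum.[ (λ e → subst (R z) (sym e) zx) , All.lookup q ] (⊇ m)) ∷ p' , cong suc len , there x∈ ,
        (λ { (here e) → here e ; (there m) → there (⊆ m) }) , λ { (here e) → inj₂ (here e) ; (there m) → Sum.map₂ there (⊇ m) }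

      sort : ∀ xs → Unique xs → (∀ {y} → y ∈ xs → zero ≢ y) →
        ∃ λ ys → AllPairs R ys × length ys ≡ length xs × (∀ {y} → y ∈ xs → y ∈ ys) × (∀ {y} → y ∈ ys → y ∈ xs)
      sort [] _ _ = [] , [] , refl , (λ ()) , (λ ())
      sort (x ∷ xs) (x∉ ∷ u) h with sort xs u (h ∘ there)
      ... | ys , p , len , ⊆ , ⊇ with insert x ys (h (here refl)) p (λ m → h (there (⊇ m)) , λ { refl → All≢⇒∉ x∉ (⊇ m) })
      ...   | zs , p' , len' , x∈ , ⊆' , ⊇' = zs , p' , trans len' (cong suc len) ,
        (λ { (here refl) → x∈ ; (there m) → ⊆' (⊆ m) }) , (λ m → Sum.[ here , there ∘ ⊇ ] (⊇' m))

      others : List I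
      others = map suc (allFin (2 ℕ.+ d))

      others-unique : Unique others
      others-unique = UniqueP.map⁺ FinP.suc-injective (UniqueP.allFin⁺ (2 ℕ.+ d))

      0∉others : ∀ {y} → y ∈ others → zero ≢ y
      0∉others m refl with ∈-map⁻ suc m
      ... | _ , _ , ()

      record DiagramTree : Set where
        field
          t      : Point-tree
          ok     : NodeOK t
          blacks : AllBlack t
          0∉     : inj₁ zero ∉ leaves t
          all    : ∀ i → inj₁ (suc i) ∈ leaves t
          count  : length (leaves t) ≡ 2 ℕ.+ d

      diagramTree : DiagramTree
      diagramTree with sort others others-unique 0∉others
      ... | [] , _ , _ , ⊆ , _ with ⊆ (here refl)
      ...   | ()
      diagramTree | x ∷ xs , p , len , ⊆ , ⊇ with build (length (x ∷ xs)) x xs ℕP.≤-refl p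
      ... | t , e , ok = record
        { t = t
        ; ok = ok
        ; blacks = λ m → let i , _ , e' = ∈-map⁻ inj₁ (subst (_ ∈_) e m) in i , e'
        ; 0∉ = λ m → 0∉ (∈-map⁻ inj₁ (subst (_ ∈_) e m))
        ; all = λ i → subst (inj₁ (suc i) ∈_) (sym e) (∈-map⁺ inj₁ (⊆ (∈-map⁺ suc (∈-allFin i))))
        ; count = trans (cong length e) (trans (ListP.length-map inj₁ (x ∷ xs)) (trans len
            (trans (ListP.length-map suc (allFin (2 ℕ.+ d))) (ListP.length-tabulate {n = 2 ℕ.+ d} (λ i → i)))))
        }
        where
        0∉ : ¬ ∃ λ i → i ∈ x ∷ xs × inj₁ zero ≡ inj₁ i
        0∉ (_ , m , refl) = 0∉others (⊇ m) refl

    charTree-from : DiagramTree → ∃ λ m → ∃ λ (G : Graph m) → ∃ λ (φ : Pt D ⤖ Fin m) → IsCharTree D G φ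
    charTree-from T = m , treeGraph o s , φ ,
      CharTreeLemmas.FromGood.isCharTree F D (treeGraph o s) φ rep pos pos-f black∈ white∈
        (good-map f pos-f (nodeOK⇒good ok))
      where
      open DiagramTree T

      m : ℕ
      m = (3 ℕ.+ d) ℕ.+ (1 ℕ.+ d)

      f : Pt D → Fin m
      f = Fin.join (3 ℕ.+ d) (1 ℕ.+ d)

      pos : Fin m → Point
      pos v = pt D (Fin.splitAt (3 ℕ.+ d) v)

      pos-f : ∀ x → pos (f x) ≡ pt D x
      pos-f x = cong (pt D) (FinP.splitAt-join (3 ℕ.+ d) (1 ℕ.+ d) x)

      f-injective : ∀ {x y} → f x ≡ f y → x ≡ y
      f-injective {x} {y} e = trans (sym (FinP.splitAt-join (3 ℕ.+ d) (1 ℕ.+ d) x))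
        (trans (cong (Fin.splitAt (3 ℕ.+ d)) e) (FinP.splitAt-join (3 ℕ.+ d) (1 ℕ.+ d) y))

      φ : Pt D ⤖ Fin m
      φ = mk⤖ {to = f} (f-injective , λ v → Fin.splitAt (3 ℕ.+ d) v , λ { refl → FinP.join-splitAt (3 ℕ.+ d) (1 ℕ.+ d) v })

      o : Fin m
      o = f (inj₁ zero)

      s : Tree (Fin m)
      s = mapTree f t

      t-simple : Simple t
      t-simple = nodeOK⇒simple t ok blacks

      node-white : ∀ {i} → inj₁ i ∉ nodes t
      node-white n with ∈nodes⇒⊑ t n
      ... | _ , _ , p with ok p
      ...   | _ , () , _

      0∉t : inj₁ zero ∉ verts t
      0∉t n = Sum.[ 0∉ , node-white ] (verts⊆leaves∪nodes t n)

      o∉ : o ∉ verts s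
      o∉ n with ∈-verts-map⁻ f t n
      ... | x , n' , e = 0∉t (subst (_∈ verts t) (sym (f-injective e)) n')

      -- A binary tree with `2 + d` leaves has `1 + d` inner vertices. Being distinct, the vertices
      -- exhaust the labels, and this is how every white point is known to have been used.
      count-verts : length (o ∷ verts s) ≡ m
      count-verts = cong suc (trans (cong length (verts-map f t)) (trans (ListP.length-map f (verts t))
        (trans (length-verts t) (cong₂ ℕ._+_ count
          (ℕP.suc-injective (trans (sym (length-leaves t)) count))))))

      cover : ∀ v → v ≡ o ⊎ v ∈ verts s
      cover v with unique-covers (∉⇒All≢ o∉ ∷ unique-verts (simple-map f f-injective t-simple)) count-verts v
      ... | here e  = inj₁ e
      ... | there n = inj₂ n

      rep : Rep (treeGraph o s) o s
      rep = treeGraph-rep o s o∉ (simple-map f f-injective t-simple) cover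

      black∈ : ∀ i → f (inj₁ i) ∈ o ∷ leaves s
      black∈ zero    = here refl
      black∈ (suc i) = there (subst (f (inj₁ (suc i)) ∈_) (sym (leaves-map f t)) (∈-map⁺ f (all i)))

      white∈ : ∀ w → f (inj₂ w) ∈ nodes s
      white∈ w with cover (f (inj₂ w))
      ... | inj₁ e with f-injective {inj₂ w} {inj₁ zero} e
      ...   | ()
      white∈ w | inj₂ n with verts⊆leaves∪nodes s n
      ... | inj₂ k = k
      ... | inj₁ k with ∈-leaves-map⁻ f t k
      ...   | x , k' , e with trans (f-injective {inj₂ w} {x} e) (proj₂ (blacks k'))
      ...     | ()

    charTree-exists : ∃ λ m → ∃ λ (G : Graph m) → ∃ λ (φ : Pt D ⤖ Fin m) → IsCharTree D G φ
    charTree-exists = charTree-from diagramTree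

-- Realisation of a tree

enumerate : ∀ {A : Set} (xs : List A) {k} → Unique xs → length xs ≡ k → ∃ λ (f : Fin k → A) →
  (∀ {i j} → f i ≡ f j → i ≡ j) × (∀ i → f i ∈ xs) × (∀ {x} → x ∈ xs → ∃ λ i → f i ≡ x)
enumerate xs u refl = lookup xs , lookup-injective u , ∈-lookup , λ m → Any.index m , sym (lookup-index m)

vertex-count : ∀ {d m} {G : Graph m} {o t} → Rep G o t → m ≡ 2 ℕ.* d ℕ.+ 4 → length (nodes t) ≡ suc d
vertex-count {d} {m} {G} {o} {t} R m≡ = ℕP.*-cancelˡ-≡ _ _ 2 (ℕP.suc-injective (ℕP.suc-injective (begin
  2 ℕ.+ 2 ℕ.* n                    ≡⟨ solve 1 (λ n → con 2 :+ con 2 :* n := con 1 :+ (con 1 :+ n :+ n)) refl n ⟩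
  suc (suc n ℕ.+ n)                ≡⟨ cong (λ k → suc (k ℕ.+ n)) (sym (length-leaves t)) ⟩
  suc (length (leaves t) ℕ.+ n)    ≡⟨ cong suc (sym (length-verts t)) ⟩
  length (o ∷ verts t)             ≡⟨ ℕP.≤-antisym (unique-length uniq) all ⟩
  m                                ≡⟨ m≡ ⟩
  2 ℕ.* d ℕ.+ 4                    ≡⟨ solve 1 (λ d → con 2 :* d :+ con 4 := con 2 :+ con 2 :* (con 1 :+ d)) refl d ⟩
  2 ℕ.+ 2 ℕ.* suc d                ∎)))
  where
  open ≡-Reasoning
  open +-*-Solver using (solve; con; _:+_; _:*_; _:=_)
  open Rep R
  n = length (nodes t)
  uniq : Unique (o ∷ verts t)
  uniq = ∉⇒All≢ fresh ∷ unique-verts simple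
  all : m ℕ.≤ length (o ∷ verts t)
  all = subst (ℕ._≤ length (o ∷ verts t)) (ListP.length-tabulate {n = m} (λ i → i))
    (unique-⊆-length {ys = o ∷ verts t} (UniqueP.allFin⁺ m) λ {x} _ → Sum.[ here , there ] (cover x))

module Realisation (F : OrderedField) where
  open OrderedField F
  open Geometry F
  open PlaneLemmas F
  open GoodLemmas F
  open Solver

  -- Validity for all sufficiently small positive `ε`. The bound is inclusive so that `δ` itself is
  -- a witness.
  Eventually : (Carrier → Set) → Set
  Eventually P = ∃ λ δ → Pos δ × (∀ ε → Pos ε → ε ≤ δ → P ε)

  ≤-<-weaken : ∀ {x y z} → x ≤ y → y < z → x ≤ z
  ≤-<-weaken (inj₁ p)    q = inj₁ (<-trans p q)
  ≤-<-weaken (inj₂ refl) q = inj₁ q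

  eventually-× : ∀ {P Q : Carrier → Set} → Eventually P → Eventually Q → Eventually (λ ε → P ε × Q ε)
  eventually-× (δ , δ>0 , p) (δ' , δ'>0 , q) with compare δ δ'
  ... | tri< l _ _    = δ , δ>0 , λ ε e h → p ε e h , q ε e (≤-<-weaken h l)
  ... | tri≈ _ refl _ = δ , δ>0 , λ ε e h → p ε e h , q ε e h
  ... | tri> _ _ l    = δ' , δ'>0 , λ ε e h → p ε e (≤-<-weaken h l) , q ε e h

  eventually-all : ∀ {A : Set} {P : A → Carrier → Set} (xs : List A) → (∀ {x} → x ∈ xs → Eventually (P x)) →
    Eventually (λ ε → ∀ {x} → x ∈ xs → P x ε)
  eventually-all [] h = 1# , 0<1 , λ _ _ _ ()
  eventually-all (x ∷ xs) h with eventually-× (h (here refl)) (eventually-all xs (h ∘ there))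
  ... | δ , δ>0 , f = δ , δ>0 , λ ε e l → λ { (here refl) → proj₁ (f ε e l) ; (there m) → proj₂ (f ε e l) m }

  eventually-witness : ∀ {P} → Eventually P → ∃ λ ε → Pos ε × P ε
  eventually-witness (δ , δ>0 , f) = δ , δ>0 , f δ δ>0 (inj₂ refl)

  SameSign : Carrier → Carrier → Set
  SameSign x y = Pos (x * y)

  sameSign-pos : ∀ {x y} → SameSign x y → Pos y → Pos x
  sameSign-pos s q = *-pos-cancelʳ q s

  sameSign-≢0 : ∀ {x y} → SameSign x y → x ≢ 0#
  sameSign-≢0 {y = y} s refl = pos⇒≢0 s (zeroˡ y)

  sameSign-≡ : ∀ {x x' y y'} → x ≡ x' → y ≡ y' → SameSign x y → SameSign x' y'
  sameSign-≡ refl refl s = s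

  sameSign-neg : ∀ {x y} → SameSign x y → SameSign (- x) (- y)
  sameSign-neg {x} {y} = ≡-pos (sym (neg*neg x y))

  abstract
    perturbed-square : ∀ c ε k → (c + ε * k) * c ≡ c * c + ε * (k * c)
    perturbed-square = solve 3 (λ c ε k → (c :+ ε :* k) :* c := c :* c :+ ε :* (k :* c)) refl

    difference-form : ∀ δ ε A B → δ * (A + B) + ε * (- B) ≡ δ * A + (δ - ε) * B
    difference-form = solve 4 (λ δ ε A B → δ :* (A :+ B) :+ ε :* (:- B) := δ :* A :+ (δ :- ε) :* B) refl

  ≤⇒0≤- : ∀ {x y} → x ≤ y → 0# ≤ (y - x)
  ≤⇒0≤- {x} (inj₁ p)    = inj₁ (subst (_< _) (-‿inverseʳ x) (+-mono-< (- x) p))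
  ≤⇒0≤- {x} (inj₂ refl) = inj₂ (sym (-‿inverseʳ x))

  pos+0≤ : ∀ {x y} → Pos x → 0# ≤ y → Pos (x + y)
  pos+0≤ p (inj₁ q)        = +-pos p q
  pos+0≤ {x} p (inj₂ refl) = ≡-pos (sym (+-identityʳ x)) p

  -- With A = c² and B = - kc > 0, the bound δ = A / (A + B) works.
  eventually-sameSign : ∀ {c} k → c ≢ 0# → Eventually (λ ε → SameSign (c + ε * k) c)
  eventually-sameSign {c} k c≢0 with compare 0# (k * c)
  ... | tri< q _ _ = 1# , 0<1 , λ ε e _ → ≡-pos (sym (perturbed-square c ε k)) (+-pos (square-pos c≢0) (*-pos e q))
  ... | tri≈ _ q _ = 1# , 0<1 , λ ε e _ → ≡-pos (sym (perturbed-square c ε k)) (pos+0≤ (square-pos c≢0) (0≤* (inj₁ e) (inj₂ q)))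
  ... | tri> _ _ q = δ , *-pos A>0 r>0 , λ ε e l → ≡-pos (sym (trans (perturbed-square c ε k) (shape ε)))
      (pos+0≤ (*-pos (*-pos A>0 r>0) A>0) (0≤* (≤⇒0≤- l) (inj₁ B>0)))
    where
    A = c * c
    B = - (k * c)
    A>0 : Pos A
    A>0 = square-pos c≢0
    B>0 : Pos B
    B>0 = neg⇒pos q
    inv = pos-inverse (+-pos A>0 B>0)
    r = proj₁ inv
    r>0 = proj₂ (proj₂ inv)
    δ = A * r
    shape : ∀ ε → A + ε * (k * c) ≡ δ * A + (δ - ε) * B
    shape ε = begin
      A + ε * (k * c)            ≡⟨ cong₂ (λ x y → x + ε * y) (sym (trans (*-comm A 1#) (*-identityˡ A))) (sym (-‿involutive (k * c))) ⟩
      A * 1# + ε * (- B)         ≡⟨ cong (λ x → A * x + ε * (- B)) (sym (trans (*-comm r _) (proj₁ (proj₂ inv)))) ⟩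
      A * (r * (A + B)) + ε * (- B) ≡⟨ cong (_+ ε * (- B)) (sym (*-assoc A r (A + B))) ⟩
      δ * (A + B) + ε * (- B)    ≡⟨ difference-form δ ε A B ⟩
      δ * A + (δ - ε) * B        ∎
      where open ≡-Reasoning

  -- A displacement from `l` in two scales: `ε` brings the point close to `l` along the direction of
  -- `a`, and `η` tilts this direction by a multiple of the one to `z`.
  shifted : Point → Point → Point → Carrier → Carrier → Point
  shifted l a z ε η = proj₁ l + ε * ((proj₁ a - proj₁ l) + η * (proj₁ z - proj₁ l)) ,
                      proj₂ l + ε * ((proj₂ a - proj₂ l) + η * (proj₂ z - proj₂ l))

  -- The slope of the orientation as a function of `ε`; being free of `ε`, it fits
  -- `eventually-sameSign`.
  drift : Point → Point → Point → Point → Point → Carrier → Carrier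
  drift x y l a z η = ((proj₁ y - proj₁ x) * ((proj₂ a - proj₂ l) + η * (proj₂ z - proj₂ l)))
    - ((proj₂ y - proj₂ x) * ((proj₁ a - proj₁ l) + η * (proj₁ z - proj₁ l)))

  abstract
    orient-shifted : ∀ x y l a z ε η → orient x y (shifted l a z ε η) ≡ orient x y l + ε * drift x y l a z η
    orient-shifted (x₁ , x₂) (y₁ , y₂) (l₁ , l₂) (a₁ , a₂) (z₁ , z₂) = solve 12
      (λ x₁ x₂ y₁ y₂ l₁ l₂ a₁ a₂ z₁ z₂ ε η →
        :orient x₁ x₂ y₁ y₂ (l₁ :+ ε :* ((a₁ :- l₁) :+ η :* (z₁ :- l₁))) (l₂ :+ ε :* ((a₂ :- l₂) :+ η :* (z₂ :- l₂)))
        := :orient x₁ x₂ y₁ y₂ l₁ l₂ :+ ε :* (((y₁ :- x₁) :* ((a₂ :- l₂) :+ η :* (z₂ :- l₂)))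
             :- ((y₂ :- x₂) :* ((a₁ :- l₁) :+ η :* (z₁ :- l₁)))))
      refl x₁ x₂ y₁ y₂ l₁ l₂ a₁ a₂ z₁ z₂

    -- When `l` is on the line the constant term vanishes and the direction of `a` decides. For `y`
    -- equal to `a` that term vanishes too, and the tilt decides.
    orient-shifted-base : ∀ y l a z ε η → orient l y (shifted l a z ε η) ≡ ε * (orient l y a + η * orient l y z)
    orient-shifted-base (y₁ , y₂) (l₁ , l₂) (a₁ , a₂) (z₁ , z₂) = solve 10
      (λ y₁ y₂ l₁ l₂ a₁ a₂ z₁ z₂ ε η →
        :orient l₁ l₂ y₁ y₂ (l₁ :+ ε :* ((a₁ :- l₁) :+ η :* (z₁ :- l₁))) (l₂ :+ ε :* ((a₂ :- l₂) :+ η :* (z₂ :- l₂)))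
        := ε :* (:orient l₁ l₂ y₁ y₂ a₁ a₂ :+ η :* :orient l₁ l₂ y₁ y₂ z₁ z₂))
      refl y₁ y₂ l₁ l₂ a₁ a₂ z₁ z₂

  orient-cyc-≢0 : ∀ {a b c} → orient a b c ≢ 0# → orient b c a ≢ 0#
  orient-cyc-≢0 {a} {b} {c} h e = h (trans (orient-cyc a b c) e)

  orient-swap-≢0 : ∀ {a b c} → orient a b c ≢ 0# → orient b a c ≢ 0#
  orient-swap-≢0 {a} {b} {c} h e = h (trans (sym (orient-swap b a c)) (trans (cong -_ e) -0#≈0#))

  orient-≢0-≡ : ∀ {a b c a' b' c'} → a ≡ a' → b ≡ b' → c ≡ c' → orient a' b' c' ≢ 0# → orient a b c ≢ 0#
  orient-≢0-≡ refl refl refl h = h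

  module _ {V : Set} (_≟_ : DecidableEquality V) where

    GenPos : (V → Point) → List V → Set
    GenPos pos vs = ∀ {x y z} → x ∈ vs → y ∈ vs → z ∈ vs → x ≢ y → y ≢ z → x ≢ z →
      orient (pos x) (pos y) (pos z) ≢ 0#

    -- p lies infinitesimally close to l, in the direction of a, tilted infinitesimally towards (s > 0) or away from (s < 0) z.
    record Lexicographic (pos : V → Point) (vs : List V) (l a z : V) (s : Carrier) (p : Point) : Set where
      field
        away : ∀ {x y} → x ∈ vs → y ∈ vs → x ≢ y → x ≢ l → y ≢ l →
          SameSign (orient (pos x) (pos y) p) (orient (pos x) (pos y) (pos l))
        near : ∀ {y} → y ∈ vs → y ≢ l → y ≢ a → SameSign (orient (pos l) (pos y) p) (orient (pos l) (pos y) (pos a))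
        tie  : SameSign (orient (pos l) (pos a) p) (s * orient (pos l) (pos a) (pos z))

    eventually-≢ : ∀ {P : Carrier → Set} x y → (x ≢ y → Eventually P) → Eventually (λ ε → x ≢ y → P ε)
    eventually-≢ x y h with x ≟ y
    ... | yes e  = 1# , 0<1 , λ _ _ _ ¬e → contradiction e ¬e
    ... | no x≢y with h x≢y
    ...   | δ , δ>0 , f = δ , δ>0 , λ ε e l _ → f ε e l

    extend : ∀ {pos vs l a z s} → GenPos pos vs → l ∈ vs → a ∈ vs → z ∈ vs →
      l ≢ a → a ≢ z → l ≢ z → s ≢ 0# → ∃ (Lexicographic pos vs l a z s)
    extend {pos} {vs} {l} {a} {z} {s} gp l∈ a∈ z∈ l≢a a≢z l≢z s≢0 = p , record
      { away = λ {x} {y} x∈ y∈ x≢y x≢l y≢l →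
          sameSign-≡ (sym (orient-shifted (pos x) (pos y) L A Z ε η)) refl (ε-good x∈ y∈ x≢y x≢l y≢l)
      ; near = λ {y} y∈ y≢l y≢a → ≡-pos (sym (trans (cong (_* orient L (pos y) A) (trans (orient-shifted-base (pos y) L A Z ε η)
          (cong (λ t → ε * (orient L (pos y) A + t)) (*-assoc η' s _)))) (*-assoc ε _ _))) (*-pos ε>0 (η-good y∈ y≢l y≢a))
      ; tie = ≡-pos (sym (trans (cong (_* (s * orient L A Z)) (trans (orient-shifted-base A L A Z ε η)
          (cong₂ (λ t u → ε * (t + u)) (orient-abb L A) (*-assoc η' s _)))) (tie-form ε η' _)))
          (*-pos (*-pos ε>0 η'>0) (square-pos so≢0))
      }
      where
      L = pos l
      A = pos a
      Z = pos z

      abstract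
        tie-form : ∀ ε η t → ε * (0# + η * t) * t ≡ ε * η * (t * t)
        tie-form = solve 3 (λ ε η t → ε :* (con ℤ.0ℤ :+ η :* t) :* t := ε :* η :* (t :* t)) refl

      so≢0 : s * orient L A Z ≢ 0#
      so≢0 e = Sum.[ (λ q → gp l∈ a∈ z∈ l≢a a≢z l≢z (zero-factor q e)) , (λ q → gp l∈ a∈ z∈ l≢a a≢z l≢z
        (zero-factor q (trans (sym (-‿distribˡ-* s _)) (trans (cong -_ e) -0#≈0#)))) ] (pos∨neg s≢0)
        where
        zero-factor : ∀ {x y} → Pos x → x * y ≡ 0# → y ≡ 0#
        zero-factor {x} {y} q e with inverse x (pos⇒≢0 q)
        ... | r , xr = trans (sym (*-identityˡ y)) (trans (cong (_* y) (trans (sym xr) (*-comm x r)))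
          (trans (*-assoc r x y) (trans (cong (r *_) e) (zeroʳ r))))

      η-small : Eventually (λ η → ∀ {y} → y ∈ vs → y ≢ l → y ≢ a →
        SameSign (orient L (pos y) A + η * (s * orient L (pos y) Z)) (orient L (pos y) A))
      η-small = eventually-all vs λ {y} y∈ → eventually-≢ y l λ y≢l → eventually-≢ y a λ y≢a →
        eventually-sameSign _ (gp l∈ y∈ a∈ (y≢l ∘ sym) y≢a l≢a)

      -- `η` is fixed before `ε`, because the drift that `ε` has to tame depends on `η`.
      η' = proj₁ (eventually-witness η-small)
      η'>0 = proj₁ (proj₂ (eventually-witness η-small))
      η-good : ∀ {y} → y ∈ vs → y ≢ l → y ≢ a →
        SameSign (orient L (pos y) A + η' * (s * orient L (pos y) Z)) (orient L (pos y) A)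
      η-good = proj₂ (proj₂ (eventually-witness η-small))
      η = η' * s

      ε-small : Eventually (λ ε → ∀ {x} → x ∈ vs → ∀ {y} → y ∈ vs → x ≢ y → x ≢ l → y ≢ l →
        SameSign (orient (pos x) (pos y) L + ε * drift (pos x) (pos y) L A Z η) (orient (pos x) (pos y) L))
      ε-small = eventually-all vs λ {x} x∈ → eventually-all vs λ {y} y∈ →
        eventually-≢ x y λ x≢y → eventually-≢ x l λ x≢l → eventually-≢ y l λ y≢l →
        eventually-sameSign _ (gp x∈ y∈ l∈ x≢y y≢l x≢l)

      ε = proj₁ (eventually-witness ε-small)
      ε>0 = proj₁ (proj₂ (eventually-witness ε-small))
      ε-good : ∀ {x} → x ∈ vs → ∀ {y} → y ∈ vs → x ≢ y → x ≢ l → y ≢ l →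
        SameSign (orient (pos x) (pos y) L + ε * drift (pos x) (pos y) L A Z η) (orient (pos x) (pos y) L)
      ε-good = proj₂ (proj₂ (eventually-witness ε-small))

      p : Point
      p = shifted L A Z ε η

    abstract
      lexicographic-extension : ∀ {pos vs l a z s} → GenPos pos vs → l ∈ vs → a ∈ vs → z ∈ vs →
        l ≢ a → a ≢ z → l ≢ z → s ≢ 0# → ∃ (Lexicographic pos vs l a z s)
      lexicographic-extension = extend

    place : (V → Point) → V → Point → V → Point
    place pos b p x with x ≟ b
    ... | yes _ = p
    ... | no _  = pos x

    place-at : ∀ pos b p → place pos b p b ≡ p
    place-at pos b p with b ≟ b
    ... | yes _ = refl
    ... | no ¬e = contradiction refl ¬e

    place-≢ : ∀ pos b p {x} → x ≢ b → place pos b p x ≡ pos x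
    place-≢ pos b p {x} x≢b with x ≟ b
    ... | yes e = contradiction e x≢b
    ... | no _  = refl

    Generic : (V → Point) → List V → Point → Set
    Generic pos vs p = ∀ {x y} → x ∈ vs → y ∈ vs → x ≢ y → orient (pos x) (pos y) p ≢ 0#

    lexicographic-generic : ∀ {pos vs l a z s p} → Lexicographic pos vs l a z s p → Generic pos vs p
    lexicographic-generic {pos} {vs} {l} {a} {p = p} lex {x} {y} x∈ y∈ x≢y = cases (x ≟ l) (y ≟ l)
      where
      at-l : ∀ {y} → y ∈ vs → y ≢ l → orient (pos l) (pos y) p ≢ 0#
      at-l {y} y∈ y≢l with y ≟ a
      ... | yes refl = sameSign-≢0 (Lexicographic.tie lex)
      ... | no y≢a   = sameSign-≢0 (Lexicographic.near lex y∈ y≢l y≢a)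
      cases : _ → _ → orient (pos x) (pos y) p ≢ 0#
      cases (yes refl) (yes refl) = contradiction refl x≢y
      cases (no x≢l)   (no y≢l)   = sameSign-≢0 (Lexicographic.away lex x∈ y∈ x≢y x≢l y≢l)
      cases (yes refl) (no y≢l)   = at-l y∈ y≢l
      cases (no x≢l)   (yes refl) = orient-swap-≢0 (at-l x∈ x≢l)

    place-genPos : ∀ {pos vs b p} → b ∉ vs → GenPos pos vs → Generic pos vs p → GenPos (place pos b p) (b ∷ vs)
    place-genPos {pos} {vs} {b} {p} b∉ gp gen = go
      where
      old : ∀ {x} → x ∈ vs → place pos b p x ≡ pos x
      old m = place-≢ pos b p (λ { refl → b∉ m })
      pair : ∀ {x y} → x ∈ vs → y ∈ vs → x ≢ y → orient (place pos b p x) (place pos b p y) (place pos b p b) ≢ 0#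
      pair m n x≢y = orient-≢0-≡ (old m) (old n) (place-at pos b p) (gen m n x≢y)
      go : GenPos (place pos b p) (b ∷ vs)
      go (here refl) (here refl) _           x≢y _   _   = contradiction refl x≢y
      go (here refl) (there n)   (here refl) _   _   x≢z = contradiction refl x≢z
      go (here refl) (there n)   (there k)   _   y≢z _   = orient-cyc-≢0 (orient-cyc-≢0 (pair n k y≢z))
      go (there m)   (here refl) (here refl) _   y≢z _   = contradiction refl y≢z
      go (there m)   (here refl) (there k)   _   _   x≢z = orient-cyc-≢0 (pair k m (x≢z ∘ sym))
      go (there m)   (there n)   (here refl) x≢y _   _   = pair m n x≢y
      go (there m)   (there n)   (there k)   x≢y y≢z x≢z = orient-≢0-≡ (old m) (old n) (old k) (gp m n k x≢y y≢z x≢z)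

  -- Point configurations by growing cherries

  module _ {m : ℕ} where

    private
      V = Fin m
      _≟_ = FinP._≟_ {m}

    Config : V → Tree V → Set
    Config o t = ∃ λ pos → Good pos o t × GenPos _≟_ pos (o ∷ verts t)

    module GrowStep {o : V} {t' t : Tree V} {a b w n p : V} (σ : Simple t) (o∉ : o ∉ verts t) (g : Grow _≟_ a b w t' t)
      {pos : V → Point} (good : Good pos o t') (gp : GenPos _≟_ pos (o ∷ verts t'))
      (an : Succ o t' a n) (p∈ : p ∈ o ∷ leaves t') (a≢n : a ≢ n) (n≢p : n ≢ p) (a≢p : a ≢ p) where

      private
        σ' : Simple t'
        σ' = grow-simple _≟_ a b w σ g
        o∉' : o ∉ verts t'
        o∉' = o∉ ∘ grow-verts _≟_ a b w g

        vs : List V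
        vs = o ∷ verts t'

        L⊆vs : ∀ {x} → x ∈ o ∷ leaves t' → x ∈ vs
        L⊆vs (here e)  = here e
        L⊆vs (there m) = there (leaves⊆verts t' m)

        a∈L : a ∈ o ∷ leaves t'
        a∈L = proj₁ (succ-∈ an)
        n∈L : n ∈ o ∷ leaves t'
        n∈L = proj₂ (succ-∈ an)

        b∉ : b ∉ vs
        b∉ (here refl) = o∉ (leaves⊆verts t (grow-b _≟_ a b w g))
        b∉ (there m)   = grow-b∉ _≟_ a b w σ g m

        w∉ : w ∉ b ∷ vs
        w∉ (here refl) with ∈nodes⇒⊑ t (grow-w _≟_ a b w g)
        ... | _ , _ , q = node-not-leaf σ q (grow-b _≟_ a b w g)
        w∉ (there (here refl)) = o∉ (nodes⊆verts t (grow-w _≟_ a b w g))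
        w∉ (there (there m))   = grow-w∉ _≟_ a b w σ g m

        ∈⇒≢ : ∀ {x y : V} {ys} → y ∉ ys → x ∈ ys → x ≢ y
        ∈⇒≢ y∉ x∈ refl = y∉ x∈

        -- All leaves lie left of the hull edge from `a` to `n`. Tilting away from `p` puts `b` on
        -- its right, so that the hull stays strictly convex with `b` between `a` and `n`.
        step₁ : ∃ (Lexicographic _≟_ pos vs a n p (- 1#))
        step₁ = lexicographic-extension _≟_ {s = - 1#} gp (L⊆vs a∈L) (L⊆vs n∈L) (L⊆vs p∈) a≢n n≢p a≢p
          (λ e → 0≢1 (trans (sym -0#≈0#) (trans (cong -_ (sym e)) (-‿involutive 1#))))

        P : Point
        P = proj₁ step₁

        lex₁ : Lexicographic _≟_ pos vs a n p (- 1#) P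
        lex₁ = proj₂ step₁
        module L₁ = Lexicographic lex₁

        swap₂ : ∀ {x y z} → - orient x y z ≡ orient x z y
        swap₂ {x} {y} {z} = trans (orient-swap x y z) (orient-cyc y x z)

        neg-swap : ∀ {x y z} → Pos (orient x y z) → Pos (- orient x z y)
        neg-swap = ≡-pos (sym swap₂)

        -- This makes `a`, `b` a hull edge. For leaves other than `n` the direction of `n` gives the
        -- sign; for `n` itself only the tilt does.
        b-first : ∀ {y} → y ∈ o ∷ leaves t' → y ≢ a → Pos (orient (pos a) P (pos y))
        b-first {y} y∈ y≢a with y ≟ n
        ... | no y≢n = ≡-pos swap₂ (sameSign-pos (sameSign-neg (L₁.near (L⊆vs y∈) y≢a y≢n))
                         (neg-swap (succ-left good o∉' σ' an y∈ y≢a y≢n)))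
        ... | yes refl = ≡-pos swap₂ (sameSign-pos (sameSign-neg L₁.tie)
                           (≡-pos (sym (trans (cong -_ (sym (-‿distribˡ-* 1# _))) (trans (-‿involutive _) (*-identityˡ _))))
                             (succ-left good o∉' σ' an p∈ (a≢p ∘ sym) (n≢p ∘ sym))))

        pos₁ : V → Point
        pos₁ = place _≟_ pos b P

        vs₁ : List V
        vs₁ = b ∷ vs

        gp₁ : GenPos _≟_ pos₁ vs₁
        gp₁ = place-genPos _≟_ b∉ gp (lexicographic-generic _≟_ lex₁)

        old₁ : ∀ {x} → x ∈ vs → pos₁ x ≡ pos x
        old₁ m = place-≢ _≟_ pos b P (∈⇒≢ b∉ m)

        new₁ : pos₁ b ≡ P
        new₁ = place-at _≟_ pos b P

        -- The tilt towards `n` places the white point just inside the new hull edge from `a` to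
        -- `b`.
        step₂ : ∃ (Lexicographic _≟_ pos₁ vs₁ a b n 1#)
        step₂ = lexicographic-extension _≟_ {s = 1#} gp₁ (there (L⊆vs a∈L)) (here refl) (there (L⊆vs n∈L))
          (∈⇒≢ b∉ (L⊆vs a∈L)) (∈⇒≢ b∉ (L⊆vs n∈L) ∘ sym) a≢n (0≢1 ∘ sym)

        Q : Point
        Q = proj₁ step₂

        lex₂ : Lexicographic _≟_ pos₁ vs₁ a b n 1# Q
        lex₂ = proj₂ step₂
        module L₂ = Lexicographic lex₂

        pos₂ : V → Point
        pos₂ = place _≟_ pos₁ w Q

        gp₂ : GenPos _≟_ pos₂ (w ∷ vs₁)
        gp₂ = place-genPos _≟_ w∉ gp₁ (lexicographic-generic _≟_ lex₂)

        old₂ : ∀ {x} → x ∈ vs₁ → pos₂ x ≡ pos₁ x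
        old₂ m = place-≢ _≟_ pos₁ w Q (∈⇒≢ w∉ m)

        new₂ : pos₂ w ≡ Q
        new₂ = place-at _≟_ pos₁ w Q

        orient-≡ : ∀ {x y z x' y' z'} → x ≡ x' → y ≡ y' → z ≡ z' → Pos (orient x y z) → Pos (orient x' y' z')
        orient-≡ refl refl refl h = h

        vs-≢ : ∀ {x y z} → Pos (orient (pos x) (pos y) (pos z)) → x ≢ y
        vs-≢ h refl = pos-orient⇒≢ h refl

        replace-x : ∀ {y v} → y ∈ vs → v ∈ vs → Pos (orient (pos a) (pos y) (pos v)) → Pos (orient P (pos y) (pos v))
        replace-x y∈ v∈ h = cyc⁺ (cyc⁺ (sameSign-pos (L₁.away y∈ v∈ (vs-≢ (cyc⁺ h)) (vs-≢ h ∘ sym) (vs-≢ (cyc⁺ (cyc⁺ h)))) (cyc⁺ h)))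

        -- The point `b` is on the same side as `a` of every line through two other old points, so
        -- replacing `b` by `a` does not change the sign.
        old-white : ∀ {x y v} → collapse _≟_ a b w x ∈ vs → collapse _≟_ a b w y ∈ vs → v ∈ vs →
          Pos (orient (pos (collapse _≟_ a b w x)) (pos (collapse _≟_ a b w y)) (pos v)) →
          Pos (orient (pos₁ x) (pos₁ y) (pos₁ v))
        old-white {x} {y} {v} x∈ y∈ v∈ h = go (x ≟ b) (y ≟ b)
          where
          x' = collapse _≟_ a b w x
          y' = collapse _≟_ a b w y
          go : _ → _ → Pos (orient (pos₁ x) (pos₁ y) (pos₁ v))
          go (yes refl) (yes refl) = contradiction refl (vs-≢ h)
          go (yes refl) (no y≢b)   = orient-≡ (sym new₁) (sym (old₁ y∈₀)) (sym (old₁ v∈)) (replace-x y∈₀ v∈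
            (subst₂ (λ i j → Pos (orient (pos i) (pos j) (pos v))) (collapse-b _≟_ a b w) ey h))
            where
            ey = collapse-≢ _≟_ a b w y≢b
            y∈₀ = subst (_∈ vs) ey y∈
          go (no x≢b) (yes refl)   = orient-≡ (sym (old₁ x∈₀)) (sym new₁) (sym (old₁ v∈)) (cyc⁺ (cyc⁺ (replace-x v∈ x∈₀
            (cyc⁺ (subst₂ (λ i j → Pos (orient (pos i) (pos j) (pos v))) ex (collapse-b _≟_ a b w) h)))))
            where
            ex = collapse-≢ _≟_ a b w x≢b
            x∈₀ = subst (_∈ vs) ex x∈
          go (no x≢b) (no y≢b)     = orient-≡ (sym (old₁ x∈₀)) (sym (old₁ y∈₀)) (sym (old₁ v∈))
            (subst₂ (λ i j → Pos (orient (pos i) (pos j) (pos v))) ex ey h)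
            where
            ex = collapse-≢ _≟_ a b w x≢b
            ey = collapse-≢ _≟_ a b w y≢b
            x∈₀ = subst (_∈ vs) ex x∈
            y∈₀ = subst (_∈ vs) ey y∈

        collapse-vs : ∀ {x} → x ∈ o ∷ leaves t → collapse _≟_ a b w x ∈ vs
        collapse-vs (here refl) = subst (_∈ vs) (sym (collapse-≢ _≟_ a b w (λ { refl → b∉ (here refl) }))) (here refl)
        collapse-vs (there m)   = there (leaves⊆verts t' (collapse-leaves _≟_ a b w σ g m))

        leaf₁ : ∀ {x} → x ∈ o ∷ leaves t → x ∈ vs₁
        leaf₁ (here e)  = there (here e)
        leaf₁ (there m) with grow-verts⁻ _≟_ a b w g (leaves⊆verts t m)
        ... | inj₁ e           = here e
        ... | inj₂ (inj₂ k)    = there (there k)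
        ... | inj₂ (inj₁ refl) with ∈nodes⇒⊑ t (grow-w _≟_ a b w g)
        ...   | _ , _ , q = contradiction m (node-not-leaf σ q)

        still-leaf : ∀ {z} → z ∈ o ∷ leaves t → z ≢ b → z ∈ o ∷ leaves t'
        still-leaf (here e)  _   = here e
        still-leaf (there m) z≢b = there (subst (_∈ leaves t') (collapse-≢ _≟_ a b w z≢b) (collapse-leaves _≟_ a b w σ g m))

        -- The sides `a b`, `b z` and `z a` are settled by the clauses `tie`, `away` and `near` of
        -- the second extension, each combined with `b-first`.
        cherry-good : ∀ {z} → z ∈ o ∷ leaves t' → z ≢ a → InTri Q (pos a) P (pos z)
        cherry-good {z} z∈ z≢a = abQ , bzQ , zaQ
          where
          a∈ = L⊆vs a∈L
          z∈vs = L⊆vs z∈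
          abz : Pos (orient (pos a) P (pos z))
          abz = b-first z∈ z≢a
          b≢z : b ≢ z
          b≢z e = ∈⇒≢ b∉ z∈vs (sym e)
          abQ : Pos (orient (pos a) P Q)
          abQ = orient-≡ (old₁ a∈) new₁ refl (sameSign-pos L₂.tie (≡-pos (sym (*-identityˡ _))
            (orient-≡ (sym (old₁ a∈)) (sym new₁) (sym (old₁ (L⊆vs n∈L))) (b-first n∈L (a≢n ∘ sym)))))
          bzQ : Pos (orient P (pos z) Q)
          bzQ = orient-≡ new₁ (old₁ z∈vs) refl (sameSign-pos (L₂.away (here refl) (there z∈vs) b≢z (∈⇒≢ b∉ a∈ ∘ sym) z≢a)
            (orient-≡ (sym new₁) (sym (old₁ z∈vs)) (sym (old₁ a∈)) (cyc⁺ abz)))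
          zaQ : Pos (orient (pos z) (pos a) Q)
          zaQ = ≡-pos (orient-swap _ _ _) (sameSign-pos (sameSign-neg (sameSign-≡ (cong₂ (λ i j → orient i j Q) (old₁ a∈) (old₁ z∈vs))
            (trans (cong₂ (λ i j → orient i j (pos₁ b)) (old₁ a∈) (old₁ z∈vs)) (cong (orient (pos a) (pos z)) new₁))
            (L₂.near (there z∈vs) z≢a (b≢z ∘ sym)))) (neg-swap abz))

        old-good : ∀ {v x y z} → x ∈ o ∷ leaves t → y ∈ o ∷ leaves t → z ∈ o ∷ leaves t →
          Split o t' v (collapse _≟_ a b w x) (collapse _≟_ a b w y) (collapse _≟_ a b w z) →
          InTri (pos₂ v) (pos₂ x) (pos₂ y) (pos₂ z)
        old-good {v} {x} {y} {z} x∈ y∈ z∈ s =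
          inTri-≡ (sym (old₂ (there v∈))) (sym (old₂ (leaf₁ x∈))) (sym (old₂ (leaf₁ y∈))) (sym (old₂ (leaf₁ z∈)))
          ( old-white {x} {y} (collapse-vs x∈) (collapse-vs y∈) v∈ (proj₁ (good s))
          , old-white {y} {z} (collapse-vs y∈) (collapse-vs z∈) v∈ (proj₁ (proj₂ (good s)))
          , old-white {z} {x} (collapse-vs z∈) (collapse-vs x∈) v∈ (proj₂ (proj₂ (good s))) )
          where
          v∈ : v ∈ vs
          v∈ = there (nodes⊆verts t' (⊑⇒∈nodes (Split.sub s)))

        grown : Good pos₂ o t
        grown s@(split {l} {r} q x∈ y∈ z∈ z∉) with split-shrink _≟_ a b w o∉ σ g s
        ... | inj₂ s' = old-good (there (⊑-leaves q (∈-++⁺ˡ x∈))) (there (⊑-leaves q (∈-++⁺ʳ (leaves l) y∈))) z∈ s'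
        ... | inj₁ (refl , refl , refl , z≢a , z≢b) =
            inTri-≡ (sym new₂) (sym (trans (old₂ (there (L⊆vs a∈L))) (old₁ (L⊆vs a∈L))))
            (sym (trans (old₂ (here refl)) new₁)) (sym (trans (old₂ (leaf₁ z∈)) (old₁ (L⊆vs z∈'))))
            (cherry-good z∈' z≢a)
          where
          z∈' : _ ∈ o ∷ leaves t'
          z∈' = still-leaf z∈ z≢b

      config : Config o t
      config = pos₂ , grown , λ x∈ y∈ z∈ → gp₂ (in-vs x∈) (in-vs y∈) (in-vs z∈)
        where
        in-vs : ∀ {x} → x ∈ o ∷ verts t → x ∈ w ∷ vs₁
        in-vs (here e)  = there (there (here e))
        in-vs (there m) with grow-verts⁻ _≟_ a b w g m
        ... | inj₁ e        = there (here e)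
        ... | inj₂ (inj₁ e) = here e
        ... | inj₂ (inj₂ k) = there (there (there k))

    module Base (o v a b : V) (σ : Simple (node v (leaf a) (leaf b))) (o∉ : o ∉ verts (node v (leaf a) (leaf b))) where

      private
        pO pA pB pV : Point
        pO = - 1# , - 1#
        pA = 1# , 0#
        pB = 0# , 1#
        pV = 0# , 0#

        abstract
          -- The solver interprets the integer 1 as `1# + 0#`, which is not literally `1#`; the
          -- coordinate is therefore a variable `u`, and the three areas come out as squares.
          square₁ : ∀ u → orient (u , 0#) (0# , u) (0# , 0#) ≡ u * u
          square₁ = solve 1 (λ u → :orient u (con ℤ.0ℤ) (con ℤ.0ℤ) u (con ℤ.0ℤ) (con ℤ.0ℤ) := u :* u) refl
          square₂ : ∀ u → orient (0# , u) (- u , - u) (0# , 0#) ≡ u * u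
          square₂ = solve 1 (λ u → :orient (con ℤ.0ℤ) u (:- u) (:- u) (con ℤ.0ℤ) (con ℤ.0ℤ) := u :* u) refl
          square₃ : ∀ u → orient (- u , - u) (u , 0#) (0# , 0#) ≡ u * u
          square₃ = solve 1 (λ u → :orient (:- u) (:- u) u (con ℤ.0ℤ) (con ℤ.0ℤ) (con ℤ.0ℤ) := u :* u) refl

        inTri : InTri pV pA pB pO
        inTri = ≡-pos (sym (square₁ 1#)) (*-pos 0<1 0<1) , ≡-pos (sym (square₂ 1#)) (*-pos 0<1 0<1) ,
          ≡-pos (sym (square₃ 1#)) (*-pos 0<1 0<1)

        distinct : ∀ {v a b : V} → Simple (node v (leaf a) (leaf b)) → v ≢ a × v ≢ b × a ≢ b
        distinct (node v∉l v∉r dis _ _) = v∉l ∘ here , v∉r ∘ here , dis (here refl) ∘ here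

        v≢a = proj₁ (distinct σ)
        v≢b = proj₁ (proj₂ (distinct σ))
        a≢b = proj₂ (proj₂ (distinct σ))
        o≢v : o ≢ v
        o≢v e = o∉ (here e)
        o≢a : o ≢ a
        o≢a e = o∉ (there (here e))
        o≢b : o ≢ b
        o≢b e = o∉ (there (there (here e)))

        pos₁ pos₂ pos₃ : V → Point
        pos₁ = place _≟_ (λ _ → pO) a pA
        pos₂ = place _≟_ pos₁ b pB
        pos₃ = place _≟_ pos₂ v pV

        o₁ : pos₁ o ≡ pO
        o₁ = place-≢ _≟_ (λ _ → pO) a pA o≢a
        a₁ : pos₁ a ≡ pA
        a₁ = place-at _≟_ (λ _ → pO) a pA
        o₂ : pos₂ o ≡ pO
        o₂ = trans (place-≢ _≟_ pos₁ b pB o≢b) o₁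
        a₂ : pos₂ a ≡ pA
        a₂ = trans (place-≢ _≟_ pos₁ b pB a≢b) a₁
        b₂ : pos₂ b ≡ pB
        b₂ = place-at _≟_ pos₁ b pB
        o₃ : pos₃ o ≡ pO
        o₃ = trans (place-≢ _≟_ pos₂ v pV o≢v) o₂
        a₃ : pos₃ a ≡ pA
        a₃ = trans (place-≢ _≟_ pos₂ v pV (v≢a ∘ sym)) a₂
        b₃ : pos₃ b ≡ pB
        b₃ = trans (place-≢ _≟_ pos₂ v pV (v≢b ∘ sym)) b₂
        v₃ : pos₃ v ≡ pV
        v₃ = place-at _≟_ pos₂ v pV

        gp₀ : GenPos _≟_ (λ _ → pO) (o ∷ [])
        gp₀ (here refl) (here refl) _ x≢y _ _ = contradiction refl x≢y

        gp₁ : GenPos _≟_ pos₁ (a ∷ o ∷ [])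
        gp₁ = place-genPos _≟_ (λ { (here e) → o≢a (sym e) }) gp₀ λ { (here refl) (here refl) x≢y → contradiction refl x≢y }

        gen₂ : Generic _≟_ pos₁ (a ∷ o ∷ []) pB
        gen₂ (here refl) (here refl) x≢y = contradiction refl x≢y
        gen₂ (there (here refl)) (there (here refl)) x≢y = contradiction refl x≢y
        gen₂ (here refl) (there (here refl)) _ = orient-≢0-≡ a₁ o₁ refl
          (orient-swap-≢0 (orient-cyc-≢0 (orient-cyc-≢0 (pos⇒≢0 (inTri⇒orient inTri)))))
        gen₂ (there (here refl)) (here refl) _ = orient-≢0-≡ o₁ a₁ refl
          (orient-cyc-≢0 (orient-cyc-≢0 (pos⇒≢0 (inTri⇒orient inTri))))

        gp₂ : GenPos _≟_ pos₂ (b ∷ a ∷ o ∷ [])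
        gp₂ = place-genPos _≟_ (λ { (here e) → a≢b (sym e) ; (there (here e)) → o≢b (sym e) }) gp₁ gen₂

        ab : orient pA pB pV ≢ 0#
        ab = pos⇒≢0 (proj₁ inTri)
        bo : orient pB pO pV ≢ 0#
        bo = pos⇒≢0 (proj₁ (proj₂ inTri))
        oa : orient pO pA pV ≢ 0#
        oa = pos⇒≢0 (proj₂ (proj₂ inTri))

        gen₃ : Generic _≟_ pos₂ (b ∷ a ∷ o ∷ []) pV
        gen₃ (here refl) (here refl) x≢y = contradiction refl x≢y
        gen₃ (here refl) (there (here refl)) _ = orient-≢0-≡ b₂ a₂ refl (orient-swap-≢0 ab)
        gen₃ (here refl) (there (there (here refl))) _ = orient-≢0-≡ b₂ o₂ refl bo
        gen₃ (there (here refl)) (here refl) _ = orient-≢0-≡ a₂ b₂ refl ab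
        gen₃ (there (here refl)) (there (here refl)) x≢y = contradiction refl x≢y
        gen₃ (there (here refl)) (there (there (here refl))) _ = orient-≢0-≡ a₂ o₂ refl (orient-swap-≢0 oa)
        gen₃ (there (there (here refl))) (here refl) _ = orient-≢0-≡ o₂ b₂ refl (orient-swap-≢0 bo)
        gen₃ (there (there (here refl))) (there (here refl)) _ = orient-≢0-≡ o₂ a₂ refl oa
        gen₃ (there (there (here refl))) (there (there (here refl))) x≢y = contradiction refl x≢y

        gp₃ : GenPos _≟_ pos₃ (v ∷ b ∷ a ∷ o ∷ [])
        gp₃ = place-genPos _≟_ (λ { (here e) → v≢b e ; (there (here e)) → v≢a e ; (there (there (here e))) → o≢v (sym e) })
          gp₂ gen₃

        reorder : ∀ {x} → x ∈ o ∷ v ∷ a ∷ b ∷ [] → x ∈ v ∷ b ∷ a ∷ o ∷ []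
        reorder (here e)                         = there (there (there (here e)))
        reorder (there (here e))                 = here e
        reorder (there (there (here e)))         = there (there (here e))
        reorder (there (there (there (here e)))) = there (here e)

        good : Good pos₃ o (node v (leaf a) (leaf b))
        good (split top (here refl) (here refl) (here refl) z∉) = inTri-≡ (sym v₃) (sym a₃) (sym b₃) (sym o₃) inTri
        good (split top (here refl) (here refl) (there (here refl)) z∉) = contradiction (there (here refl)) z∉
        good (split top (here refl) (here refl) (there (there (here refl))) z∉) = contradiction (there (there (here refl))) z∉

      config : Config o (node v (leaf a) (leaf b))
      config = pos₃ , good , λ x∈ y∈ z∈ → gp₃ (reorder x∈) (reorder y∈) (reorder z∈)

    -- The successor and the predecessor of `a` supply `n` and `p`. An inner vertex of `t'` makes
    -- the cycle long enough for `a`, `n`, `p` to be distinct.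
    grow-config : ∀ {o t' t a b w} → Simple t → o ∉ verts t → Grow _≟_ a b w t' t → ∀ {k} → k ∈ nodes t' →
      Config o t' → Config o t
    grow-config {o} {t'} {a = a} {b} {w} σ o∉ g k∈ (pos , good , gp) =
      let n , an = succ-exists {o = o} (there (grow-a _≟_ a b w g))
          p , pa = pred-exists {o = o} (there (grow-a _≟_ a b w g))
          o∉' = o∉ ∘ grow-verts _≟_ a b w g
          σ' = grow-simple _≟_ a b w σ g
      in GrowStep.config σ o∉ g good gp an (proj₁ (succ-∈ pa)) (succ-irrefl t' k∈ o∉' σ' an)
        (λ n≡p → succ-no-2cycle t' k∈ o∉' σ' an (subst (λ x → Succ o t' x a) (sym n≡p) pa))
        (succ-irrefl t' k∈ o∉' σ' pa ∘ sym)

    -- The induction starts with one inner vertex, the smallest tree in which a leaf has two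
    -- different neighbours in the cyclic order, as the growing step requires.
    realise : ∀ n {o} t → length (nodes t) ≡ suc n → Simple t → o ∉ verts t → Config o t
    realise n       (leaf _) ()
    realise zero    (node v (leaf a) (leaf b)) e σ o∉ = Base.config _ v a b σ o∉
    realise zero    (node v (node _ _ _) _) ()
    realise zero    (node v (leaf _) (node _ _ _)) ()
    realise (suc n) {o} t@(node v l r) e σ o∉ with grow-exists _≟_ v l r
    ... | a , b , w , t' , g = grow-config σ o∉ g (proj₂ (nonempty (nodes t') shorter)) (realise n t' shorter
        (grow-simple _≟_ a b w σ g) (o∉ ∘ grow-verts _≟_ a b w g))
      where
      shorter : length (nodes t') ≡ suc n
      shorter = ℕP.suc-injective (trans (sym (grow-nodes _≟_ a b w g)) e)
      nonempty : ∀ (xs : List V) {n} → length xs ≡ suc n → ∃ (_∈ xs)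
      nonempty (x ∷ xs) _ = x , here refl

  module _ {d m : ℕ} {G : Graph m} {o : Fin m} {t : Tree (Fin m)} (R : Rep G o t) (count : length (nodes t) ≡ suc d) where
    open Rep R

    tree-realised : ∃ λ (D : Diagram d) → IsTDiagram D × ∃ λ (φ : Pt D ⤖ Fin m) → IsCharTree D G φ
    tree-realised =
      let f , f-inj , f∈ , f-onto = enumerate (o ∷ leaves t) (∉⇒All≢ (fresh ∘ leaves⊆verts t) ∷ unique-leaves simple)
            (cong suc (trans (length-leaves t) (cong suc count)))
          g , g-inj , g∈ , g-onto = enumerate (nodes t) (unique-nodes simple) count
      in from (realise d t count simple fresh) f f-inj f∈ f-onto g g-inj g∈ g-onto
      where
      from : Config o t → (f : Fin (3 ℕ.+ d) → Fin m) → (∀ {i j} → f i ≡ f j → i ≡ j) → (∀ i → f i ∈ o ∷ leaves t) →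
        (∀ {x} → x ∈ o ∷ leaves t → ∃ λ i → f i ≡ x) → (g : Fin (1 ℕ.+ d) → Fin m) → (∀ {i j} → g i ≡ g j → i ≡ j) →
        (∀ i → g i ∈ nodes t) → (∀ {x} → x ∈ nodes t → ∃ λ i → g i ≡ x) →
        ∃ λ (D : Diagram d) → IsTDiagram D × ∃ λ (φ : Pt D ⤖ Fin m) → IsCharTree D G φ
      from (pos , good , gp) f f-inj f∈ f-onto g g-inj g∈ g-onto =
        D , C.isTDiagram general , φ , C.isCharTree
        where
        D : Diagram d
        D = record { black = pos ∘ f ; white = pos ∘ g }

        to : Pt D → Fin m
        to (inj₁ i) = f i
        to (inj₂ w) = g w

        leaf≢node : ∀ i w → f i ≢ g w
        leaf≢node i w e with f∈ i | ∈nodes⇒⊑ t (g∈ w)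
        ... | here e' | _         = fresh (subst (_∈ verts t) (trans (sym e) e') (nodes⊆verts t (g∈ w)))
        ... | there m | _ , _ , p = node-not-leaf simple p (subst (_∈ leaves t) e m)

        to-injective : ∀ {x y} → to x ≡ to y → x ≡ y
        to-injective {inj₁ i} {inj₁ j} e = cong inj₁ (f-inj e)
        to-injective {inj₁ i} {inj₂ w} e = contradiction e (leaf≢node i w)
        to-injective {inj₂ w} {inj₁ i} e = contradiction (sym e) (leaf≢node i w)
        to-injective {inj₂ v} {inj₂ w} e = cong inj₂ (g-inj e)

        onto : ∀ v → ∃ λ x → to x ≡ v
        onto v with RepLemmas.leaf∨node R v
        ... | inj₁ m = let i , e = f-onto m in inj₁ i , e
        ... | inj₂ m = let w , e = g-onto m in inj₂ w , e

        φ : Pt D ⤖ Fin m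
        φ = mk⤖ {to = to} (to-injective , λ v → proj₁ (onto v) , λ { refl → proj₂ (onto v) })

        pos-φ : ∀ x → pos (to x) ≡ pt D x
        pos-φ (inj₁ i) = refl
        pos-φ (inj₂ w) = refl

        in-tree : ∀ x → to x ∈ o ∷ verts t
        in-tree x with cover (to x)
        ... | inj₁ e = here e
        ... | inj₂ m = there m

        general : GeneralPosition D
        general x y z x≢y y≢z x≢z = orient-≢0-≡ (sym (pos-φ x)) (sym (pos-φ y)) (sym (pos-φ z))
          (gp (in-tree x) (in-tree y) (in-tree z) (x≢y ∘ to-injective {x} {y})
            (y≢z ∘ to-injective {y} {z}) (x≢z ∘ to-injective {x} {z}))

        module C = CharTreeLemmas.FromGood F D G φ R pos pos-φ f∈ g∈ good

  threeTree-realised : ∀ d (G : Graph (2 ℕ.* d ℕ.+ 4)) → IsThreeTree G →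
    ∃ λ (D : Diagram d) → IsTDiagram D × ∃ λ (φ : Pt D ⤖ Fin (2 ℕ.* d ℕ.+ 4)) → IsCharTree D G φ
  threeTree-realised d G T =
    let _ , leaf-o = FromThreeTree.leaf-exists G T (Fin.fromℕ< {0} (ℕP.m≤n⇒m≤o+n (2 ℕ.* d) (s≤s z≤n)))
        _ , R = FromThreeTree.rep-at-leaf G T leaf-o
    in tree-realised R (vertex-count R refl)

open import Data.Nat using (_+_; _*_)

theorem3p12 : (F : OrderedField) → let open Geometry F in
    -- (1) existence and uniqueness of characteristic trees
    (∀ d (D : Diagram d) → IsTDiagram D →
       (∃ λ m → ∃ λ (G : Graph m) → ∃ λ (φ : Pt D ⤖ Fin m) → IsCharTree D G φ) ×
       (∀ m m' (G : Graph m) (G' : Graph m') (φ : Pt D ⤖ Fin m) (φ' : Pt D ⤖ Fin m') →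
          IsCharTree D G φ → IsCharTree D G' φ' → IsoCompatible D G G' φ φ')) ×
    -- (2) realisation of every 3-tree, unique up to equivalence by diagonals
    (∀ d (G : Graph (2 * d + 4)) → IsThreeTree G →
       (∃ λ (D : Diagram d) → IsTDiagram D × ∃ λ (φ : Pt D ⤖ Fin (2 * d + 4)) → IsCharTree D G φ) ×
       (∀ (D E : Diagram d) (φ : Pt D ⤖ Fin (2 * d + 4)) (φ' : Pt E ⤖ Fin (2 * d + 4)) →
          IsTDiagram D → IsTDiagram E → IsCharTree D G φ → IsCharTree E G φ' → EquivDiag D E))
theorem3p12 F =
  (λ d D TD → charTree-exists D TD , λ m m' G G' φ φ' T T' → charTree-unique T T') ,
  (λ d G T → threeTree-realised d G T , λ D E φ φ' TD TE TD-G TE-G →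
    same-tree⇒equiv (IsTDiagram.generalPosition TD) (IsTDiagram.generalPosition TE) TD-G TE-G
      (proj₂ (FromThreeTree.rep-at-leaf G T (IsCharTree.blackLeaf TD-G zero))))
  where
  open Geometry F
  open CharTreeExistence F
  open CharTreeUniqueness F
  open Realisation F
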